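{- Let $n,m,r,\lambda$ be positive integers with $m>4$ and $n\ge 4.847323\,m$. Any partial $r$-factorization of $\lambda K_m^4$ (with respect to $n$) can be extended to a connected $r$-factorization of $\lambda K_n^4$ if and only if $(n,r,\lambda)$ is $4$-admissible and no component of any color class of $\lambda K_m^4$ is $r$-regular.
   Context: $\lambda K_n^h$: $n$ vertices, every $h$-subset an edge of multiplicity $\lambda$; $\lambda K_m^h$ is its sub-hypergraph induced on a fixed set of $m$ vertices. Degree counts edges containing a vertex. An $r$-factor is a spanning sub-hypergraph in which every vertex has degree $r$. With $k=\lambda\binom{n-1}{h-1}/r$, a partial $r$-factorization of $\lambda K_m^h$ is a coloring of its edges with colors from $[k]$ such that each vertex has degree at most $r$ in every color class (color classes are spanning sub-hypergraphs on all $m$ vertices; components include isolated vertices). It extends to a connected $r$-factorization of $\lambda K_n^h$ if some coloring of all edges of $\lambda K_n^h$ with colors from $[k]$ agrees with it on $\lambda K_m^h$ and every color class is a connected $r$-factor. $(n,r,\lambda)$ is $h$-admissible if $h\mid rn$ and $r\mid\lambda\binom{n-1}{h-1}$. -}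

module Defs where

open import Data.Nat using (ℕ; zero; suc; _+_; _*_; _∸_; _≤_; _<_; _<?_; NonZero)
open import Data.Nat.Properties using (_≟_)
open import Data.Nat.Divisibility using (_∣_)
open import Data.Nat.DivMod using (_/_)
open import Data.Nat.Combinatorics using (_C_)
open import Data.Bool using (Bool; true; false)
open import Data.Fin using (Fin; toℕ; fromℕ<)
import Data.Fin.Properties as FinP
open import Data.Fin.Subset using (Subset; _∈_; ∣_∣)
open import Data.Fin.Subset.Properties using (_∈?_)
open import Data.Vec using (Vec; []; _∷_; tabulate; lookup)
open import Data.List using (List; []; _∷_; length; filter; cartesianProduct; map; _++_; allFin)
open import Data.Product using (Σ; _×_; _,_; ∃; ∃-syntax)
open import Relation.Nullary using (¬_; yes; no)
open import Relation.Nullary.Decidable using (_×-dec_)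
open import Relation.Binary.PropositionalEquality using (_≡_)

allSubsets : (N : ℕ) → List (Subset N)
allSubsets zero = [] ∷ []
allSubsets (suc N) = map (true ∷_) (allSubsets N) ++ map (false ∷_) (allSubsets N)

-- An edge-colouring of the complete h-uniform multihypergraph  l K_N^h  with
-- colours Fin k.  The copies of an h-subset S are indexed by Fin l; only the
-- values on subsets with ∣ S ∣ ≡ h are meaningful (other values are ignored).
Colouring : (N l k : ℕ) → Set
Colouring N l k = Subset N → Fin l → Fin k

edges : (N h l : ℕ) → List (Subset N × Fin l)
edges N h l = cartesianProduct (filter (λ S → ∣ S ∣ ≟ h) (allSubsets N)) (allFin l)

deg : ∀ {N l k} (h : ℕ) → Colouring N l k → Fin k → Fin N → ℕ
deg {N} {l} h c j v =
  length (filter (λ { (S , i) → (v ∈? S) ×-dec (FinP._≟_ (c S i) j) }) (edges N h l))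

data Reach {N l k : ℕ} (h : ℕ) (c : Colouring N l k) (j : Fin k) : Fin N → Fin N → Set where
  here : ∀ {u} → Reach h c j u u
  step : ∀ {u w v} (S : Subset N) (i : Fin l) → ∣ S ∣ ≡ h → c S i ≡ j →
         u ∈ S → w ∈ S → Reach h c j w v → Reach h c j u v

numColours : (n h l r : ℕ) → .{{NonZero r}} → ℕ
numColours n h l r = (l * ((n ∸ 1) C (h ∸ 1))) / r

IsPartialFactorization : ∀ {m l k} (h r : ℕ) → Colouring m l k → Set
IsPartialFactorization h r c = ∀ j v → deg h c j v ≤ r

IsConnectedFactorization : ∀ {n l k} (h r : ℕ) → Colouring n l k → Set
IsConnectedFactorization h r F =
  (∀ j v → deg h F j v ≡ r) × (∀ j u v → Reach h F j u v)

-- K_m^h is the sub-hypergraph induced on the first m vertices of Fin n.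
liftSubset : (m n : ℕ) → Subset m → Subset n
liftSubset m n S = tabulate λ v → f v (toℕ v <? m)
  where
  f : ∀ v → Relation.Nullary.Dec (toℕ v < m) → Bool
  f v (yes p) = lookup S (fromℕ< p)
  f v (no _)  = false

Agrees : ∀ {m n l k} (h : ℕ) → Colouring n l k → Colouring m l k → Set
Agrees {m} {n} h F c = ∀ (S : Subset m) → ∣ S ∣ ≡ h → ∀ i → F (liftSubset m n S) i ≡ c S i

Extends : ∀ {m l k} (n h r : ℕ) → Colouring m l k → Set
Extends {m} {l} {k} n h r c =
  ∃[ F ] (IsConnectedFactorization {n} {l} {k} h r F × Agrees h F c)

Admissible : (h n r l : ℕ) → Set
Admissible h n r l = (h ∣ r * n) × (r ∣ l * ((n ∸ 1) C (h ∸ 1)))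

RegularComponent : ∀ {m l k} (h r : ℕ) → Colouring m l k → Fin k → Fin m → Set
RegularComponent h r c j v = ∀ w → Reach h c j v w → deg h c j w ≡ r

NoRegularComponent : ∀ {m l k} (h r : ℕ) → Colouring m l k → Set
NoRegularComponent h r c = ∀ j v → ¬ RegularComponent h r c j v

{-# OPTIONS --safe #-}
module Submission where

-- Amalgamate the n − m new vertices into one vertex α; an edge meeting α in t places has t hinges.
-- The given colouring extends to the amalgamated hypergraph: edges with three, then two, old
-- vertices are coloured greedily, which is where n ≥ 4.847323 m enters, in the form
-- C(n−1,3) ≤ 2 C(n−m,3); edges with one old vertex fill every degree up to r, and edges inside α
-- fill every colour class up to rn/4 edges. As no component in K_m^4 is r-regular, each component
-- of a colour class minus α has a hinge.
--
-- Then vertices are split off from α one by one. When α stands for P vertices, a fraction 1/P of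
-- the hinges is a fractional choice of the edges of the new vertex. It is rounded by an integer
-- flow that takes at most ⌈d/P⌉ of the d hinges of each connected group and fewer than r from the
-- groups with one hinge, so the new vertex joins groups that still have a hinge left. The
-- inequality Σ (d − 1) ≥ P − 1 over the groups of a colour survives the step; it
-- guarantees that the one-hinge groups have at most (r − 1) P hinges.
--
-- Conversely, admissibility is double counting, and an r-regular component in K_m^4 could not be
-- left by a colour class of the extension.

open import Defs
open import Data.Bool using (Bool; true; false)
import Data.Bool.Properties as Boolₚ
open import Data.Empty using (⊥)
open import Data.Fin using (Fin; zero; suc; toℕ; _↑ˡ_; _↑ʳ_; splitAt)
import Data.Fin as Fin
import Data.Fin.Properties as Finₚ
open import Data.Fin.Subset using (Subset; _∈_; ∣_∣)
import Data.Fin.Subset as Subset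
import Data.Fin.Subset.Properties as Subsetₚ
open import Data.Integer as ℤ using (ℤ; -[1+_]; 0ℤ; 1ℤ)
import Data.Integer.Properties as ℤₚ
import Data.Integer.Divisibility.Signed as ℤ∣
import Data.Integer.Tactic.RingSolver as ℤ-Ring
open import Data.List using (List; []; _∷_; _++_; map; length; filter; concatMap; replicate; cartesianProduct; allFin)
import Data.List as List
import Data.List.Properties as Listₚ
open import Data.List.Membership.Propositional using (lose) renaming (_∈_ to _∈ₗ_)
import Data.List.Membership.Propositional.Properties as ∈ₗ
open import Data.List.Relation.Unary.Any using (here; there)
import Data.List.Relation.Unary.Any as Any
open import Data.Nat
import Data.Nat.Combinatorics as Comb
open import Data.Nat.Divisibility using (_∣_; divides; _∣0; ∣m+n∣m⇒∣n; m∣m*n)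
import Data.Nat.Divisibility as ∣ₚ
open import Data.Nat.DivMod using (_/_; _%_; m≡m%n+[m/n]*n; m%n<n; m/n*n≡m)
open import Data.Nat.Induction using (<-wellFounded)
open import Data.Nat.Properties
open import Data.Nat.Tactic.RingSolver using (solve-∀)
open import Data.Product using (Σ; ∃-syntax; _×_; _,_; proj₁; proj₂)
open import Data.Sum using (_⊎_; inj₁; inj₂; [_,_]′)
import Data.Sum as Sum
open import Data.Vec using ([]; _∷_; lookup)
import Data.Vec as Vec
import Data.Vec.Properties as Vecₚ
open import Function using (_∘_; id; case_of_)
open import Function.Bundles using (_⇔_; mk⇔)
open import Induction.WellFounded using (Acc; acc)
open import Relation.Binary.Definitions using (DecidableEquality)
open import Relation.Binary.PropositionalEquality
open import Relation.Nullary using (Dec; yes; no; does; ¬_; contradiction)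
open import Relation.Nullary.Decidable using (_×-dec_; ¬?)
import Relation.Nullary.Decidable as Dec
open import Relation.Unary using (Pred; Decidable)
open import Relation.Binary.Construct.Closure.Equivalence as EqClosure using (EqClosure)
open import Relation.Binary.Construct.Closure.ReflexiveTransitive using (ε; _◅_)
open import Relation.Binary.Construct.Closure.Symmetric using (fwd; bwd)
import Data.List.Relation.Unary.Any.Properties as Anyₚ
import Data.Product.Properties as ×ₚ
import Data.Sum.Properties as ⊎ₚ

∑ : {A : Set} → List A → (A → ℕ) → ℕ
∑ []       f = 0
∑ (x ∷ xs) f = f x + ∑ xs f

module _ {A : Set} where

  ∑-cong∈ : ∀ (xs : List A) {f g : A → ℕ} → (∀ x → x ∈ₗ xs → f x ≡ g x) → ∑ xs f ≡ ∑ xs g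
  ∑-cong∈ []       eq = refl
  ∑-cong∈ (x ∷ xs) eq = cong₂ _+_ (eq x (here refl)) (∑-cong∈ xs (λ y y∈ → eq y (there y∈)))

  ∑-cong : ∀ (xs : List A) {f g : A → ℕ} → (∀ x → f x ≡ g x) → ∑ xs f ≡ ∑ xs g
  ∑-cong xs eq = ∑-cong∈ xs (λ x _ → eq x)

  ∑-mono∈ : ∀ (xs : List A) {f g : A → ℕ} → (∀ x → x ∈ₗ xs → f x ≤ g x) → ∑ xs f ≤ ∑ xs g
  ∑-mono∈ []       le = z≤n
  ∑-mono∈ (x ∷ xs) le = +-mono-≤ (le x (here refl)) (∑-mono∈ xs (λ y y∈ → le y (there y∈)))

  ∑-mono : ∀ (xs : List A) {f g : A → ℕ} → (∀ x → f x ≤ g x) → ∑ xs f ≤ ∑ xs g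
  ∑-mono xs le = ∑-mono∈ xs (λ x _ → le x)

  ∑-zero : ∀ (xs : List A) → ∑ xs (λ _ → 0) ≡ 0
  ∑-zero []       = refl
  ∑-zero (x ∷ xs) = ∑-zero xs

  ∑-const : ∀ (xs : List A) c → ∑ xs (λ _ → c) ≡ length xs * c
  ∑-const []       c = refl
  ∑-const (x ∷ xs) c = cong (c +_) (∑-const xs c)

  ∑-+ : ∀ (xs : List A) (f g : A → ℕ) → ∑ xs (λ x → f x + g x) ≡ ∑ xs f + ∑ xs g
  ∑-+ []       f g = refl
  ∑-+ (x ∷ xs) f g = begin
    f x + g x + ∑ xs (λ y → f y + g y)   ≡⟨ cong (f x + g x +_) (∑-+ xs f g) ⟩
    f x + g x + (∑ xs f + ∑ xs g)        ≡⟨ interchange (f x) (g x) (∑ xs f) (∑ xs g) ⟩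
    f x + ∑ xs f + (g x + ∑ xs g)        ∎
    where
    open ≡-Reasoning
    interchange : ∀ a b c d → a + b + (c + d) ≡ a + c + (b + d)
    interchange = solve-∀

  ∑-*ˡ : ∀ (xs : List A) c (f : A → ℕ) → ∑ xs (λ x → c * f x) ≡ c * ∑ xs f
  ∑-*ˡ []       c f = sym (*-zeroʳ c)
  ∑-*ˡ (x ∷ xs) c f = trans (cong (c * f x +_) (∑-*ˡ xs c f)) (sym (*-distribˡ-+ c (f x) (∑ xs f)))

  ∑-*ʳ : ∀ (xs : List A) c (f : A → ℕ) → ∑ xs (λ x → f x * c) ≡ ∑ xs f * c
  ∑-*ʳ xs c f = trans (∑-cong xs (λ x → *-comm (f x) c)) (trans (∑-*ˡ xs c f) (*-comm c (∑ xs f)))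

  ∑-++ : ∀ (xs ys : List A) (f : A → ℕ) → ∑ (xs ++ ys) f ≡ ∑ xs f + ∑ ys f
  ∑-++ []       ys f = refl
  ∑-++ (x ∷ xs) ys f = trans (cong (f x +_) (∑-++ xs ys f)) (sym (+-assoc (f x) (∑ xs f) (∑ ys f)))

  ∑-replicate : ∀ n (x : A) (f : A → ℕ) → ∑ (replicate n x) f ≡ n * f x
  ∑-replicate zero    x f = refl
  ∑-replicate (suc n) x f = cong (f x +_) (∑-replicate n x f)

  term≤∑ : ∀ {xs : List A} {x} (f : A → ℕ) → x ∈ₗ xs → f x ≤ ∑ xs f
  term≤∑ f (here refl)                = m≤m+n (f _) _
  term≤∑ {y ∷ xs} f (there x∈xs) = ≤-trans (term≤∑ f x∈xs) (m≤n+m (∑ xs f) (f y))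

  ∑≡0⇒term≡0 : ∀ {xs : List A} {x} (f : A → ℕ) → ∑ xs f ≡ 0 → x ∈ₗ xs → f x ≡ 0
  ∑≡0⇒term≡0 f eq x∈xs = n≤0⇒n≡0 (subst (f _ ≤_) eq (term≤∑ f x∈xs))

  ∑>0⇒term>0 : ∀ (xs : List A) (f : A → ℕ) → 0 < ∑ xs f → ∃[ x ] (x ∈ₗ xs × 0 < f x)
  ∑>0⇒term>0 (x ∷ xs) f lt with f x in eq
  ... | suc _ = x , here refl , subst (0 <_) (sym eq) z<s
  ... | zero  with ∑>0⇒term>0 xs f lt
  ...   | y , y∈ , lt′ = y , there y∈ , lt′

  ∑-mono-<∈ : ∀ {xs : List A} {x} {f g : A → ℕ} → (∀ y → f y ≤ g y) → x ∈ₗ xs → f x < g x → ∑ xs f < ∑ xs g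
  ∑-mono-<∈ {_ ∷ xs} le (here refl)  lt = +-mono-<-≤ lt (∑-mono xs le)
  ∑-mono-<∈ {y ∷ xs} le (there x∈) lt = +-mono-≤-< (le y) (∑-mono-<∈ le x∈ lt)

∑-map : ∀ {A B : Set} (g : A → B) (xs : List A) (f : B → ℕ) → ∑ (map g xs) f ≡ ∑ xs (f ∘ g)
∑-map g []       f = refl
∑-map g (x ∷ xs) f = cong (f (g x) +_) (∑-map g xs f)

∑-concatMap : ∀ {A B : Set} (g : A → List B) (xs : List A) (f : B → ℕ) →
              ∑ (concatMap g xs) f ≡ ∑ xs (λ x → ∑ (g x) f)
∑-concatMap g []       f = refl
∑-concatMap g (x ∷ xs) f = trans (∑-++ (g x) (concatMap g xs) f) (cong (∑ (g x) f +_) (∑-concatMap g xs f))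

∑-swap : ∀ {A B : Set} (xs : List A) (ys : List B) (f : A → B → ℕ) →
         ∑ xs (λ x → ∑ ys (f x)) ≡ ∑ ys (λ y → ∑ xs (λ x → f x y))
∑-swap []       ys f = sym (∑-zero ys)
∑-swap (x ∷ xs) ys f = trans (cong (∑ ys (f x) +_) (∑-swap xs ys f)) (sym (∑-+ ys (f x) _))

∑-cartesianProduct : ∀ {A B : Set} (xs : List A) (ys : List B) (f : A × B → ℕ) →
                     ∑ (cartesianProduct xs ys) f ≡ ∑ xs (λ x → ∑ ys (λ y → f (x , y)))
∑-cartesianProduct []       ys f = refl
∑-cartesianProduct (x ∷ xs) ys f =
  trans (∑-++ (map (x ,_) ys) (cartesianProduct xs ys) f)
        (cong₂ _+_ (∑-map (x ,_) ys f) (∑-cartesianProduct xs ys f))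

allFin-suc : ∀ n → allFin (suc n) ≡ zero ∷ map suc (allFin n)
allFin-suc n = cong (zero ∷_) (sym (Listₚ.map-tabulate id suc))

∑Fin-suc : ∀ n (f : Fin (suc n) → ℕ) → ∑ (allFin (suc n)) f ≡ f zero + ∑ (allFin n) (f ∘ suc)
∑Fin-suc n f = trans (cong (λ xs → ∑ xs f) (allFin-suc n)) (cong (f zero +_) (∑-map suc (allFin n) f))

∑Fin-const : ∀ n c → ∑ (allFin n) (λ _ → c) ≡ n * c
∑Fin-const n c = trans (∑-const (allFin n) c) (cong (_* c) (Listₚ.length-tabulate {n = n} id))

∑Fin-lookup : ∀ {A : Set} (xs : List A) (f : A → ℕ) →
              ∑ (allFin (length xs)) (f ∘ List.lookup xs) ≡ ∑ xs f
∑Fin-lookup []       f = refl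
∑Fin-lookup (x ∷ xs) f =
  trans (∑Fin-suc (length xs) (f ∘ List.lookup (x ∷ xs))) (cong (f x +_) (∑Fin-lookup xs f))

term≤∑Fin : ∀ {n} (f : Fin n → ℕ) i → f i ≤ ∑ (allFin n) f
term≤∑Fin f i = term≤∑ f (∈ₗ.∈-allFin i)

∑Fin>0 : ∀ {n} (f : Fin n → ℕ) → 0 < ∑ (allFin n) f → ∃[ i ] (0 < f i)
∑Fin>0 {n} f lt with ∑>0⇒term>0 (allFin n) f lt
... | i , _ , lt′ = i , lt′

-- Iverson brackets

𝟙 : Bool → ℕ
𝟙 true  = 1
𝟙 false = 0

⟦_⟧ : {P : Set} → Dec P → ℕ
⟦ P? ⟧ = 𝟙 (does P?)

module _ {P : Set} where

  ⟦⟧-yes : (P? : Dec P) → P → ⟦ P? ⟧ ≡ 1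
  ⟦⟧-yes (yes _) _ = refl
  ⟦⟧-yes (no ¬p) p = contradiction p ¬p

  ⟦⟧-no : (P? : Dec P) → ¬ P → ⟦ P? ⟧ ≡ 0
  ⟦⟧-no (yes p) ¬p = contradiction p ¬p
  ⟦⟧-no (no _)  _  = refl

  ⟦⟧≤1 : (P? : Dec P) → ⟦ P? ⟧ ≤ 1
  ⟦⟧≤1 (yes _) = ≤-refl
  ⟦⟧≤1 (no _)  = z≤n

  ⟦⟧>0 : (P? : Dec P) → 0 < ⟦ P? ⟧ → P
  ⟦⟧>0 (yes p) _ = p

⟦⟧-iff : ∀ {P Q : Set} (P? : Dec P) (Q? : Dec Q) → (P → Q) → (Q → P) → ⟦ P? ⟧ ≡ ⟦ Q? ⟧
⟦⟧-iff (yes _) (yes _) _   _   = refl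
⟦⟧-iff (yes p) (no ¬q) p⇒q _   = contradiction (p⇒q p) ¬q
⟦⟧-iff (no ¬p) (yes q) _   q⇒p = contradiction (q⇒p q) ¬p
⟦⟧-iff (no _)  (no _)  _   _   = refl

⟦⟧-× : ∀ {P Q : Set} (P? : Dec P) (Q? : Dec Q) → ⟦ P? ×-dec Q? ⟧ ≡ ⟦ P? ⟧ * ⟦ Q? ⟧
⟦⟧-× (yes _) (yes _) = refl
⟦⟧-× (yes _) (no _)  = refl
⟦⟧-× (no _)  _       = refl

⟦⟧-*-cong : ∀ {P : Set} (P? : Dec P) {a b} → (P → a ≡ b) → ⟦ P? ⟧ * a ≡ ⟦ P? ⟧ * b
⟦⟧-*-cong (yes p) eq = cong (1 *_) (eq p)
⟦⟧-*-cong (no _)  _  = refl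

m*n>0 : ∀ m n → 0 < m * n → 0 < m × 0 < n
m*n>0 (suc m) (suc n) _  = z<s , z<s
m*n>0 (suc m) zero    lt = contradiction (subst (0 <_) (*-zeroʳ m) lt) λ ()

length-filter : ∀ {A : Set} {P : Pred A _} (P? : Decidable P) (xs : List A) →
                length (filter P? xs) ≡ ∑ xs (λ x → ⟦ P? x ⟧)
length-filter P? []       = refl
length-filter P? (x ∷ xs) with does (P? x)
... | true  = cong suc (length-filter P? xs)
... | false = length-filter P? xs

∑-filter : ∀ {A : Set} {P : Pred A _} (P? : Decidable P) (xs : List A) (f : A → ℕ) →
           ∑ (filter P? xs) f ≡ ∑ xs (λ x → ⟦ P? x ⟧ * f x)
∑-filter P? []       f = refl
∑-filter P? (x ∷ xs) f with does (P? x)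
... | true  = cong₂ _+_ (sym (*-identityˡ (f x))) (∑-filter P? xs f)
... | false = ∑-filter P? xs f

module _ {A : Set} (_≟A_ : DecidableEquality A) where

  ⟦≟⟧-sym : ∀ x y → ⟦ x ≟A y ⟧ ≡ ⟦ y ≟A x ⟧
  ⟦≟⟧-sym x y = ⟦⟧-iff (x ≟A y) (y ≟A x) sym sym

  ⟦≟⟧-subst : ∀ x y (f : A → ℕ) → ⟦ x ≟A y ⟧ * f x ≡ ⟦ x ≟A y ⟧ * f y
  ⟦≟⟧-subst x y f = ⟦⟧-*-cong (x ≟A y) (cong f)

  ∑-⟦≟⟧ : ∀ (xs : List A) a → ∑ xs (λ x → ⟦ x ≟A a ⟧) ≡ 1 →
          ∀ (f : A → ℕ) → ∑ xs (λ x → ⟦ x ≟A a ⟧ * f x) ≡ f a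
  ∑-⟦≟⟧ xs a once f = begin
    ∑ xs (λ x → ⟦ x ≟A a ⟧ * f x)  ≡⟨ ∑-cong xs (λ x → ⟦≟⟧-subst x a f) ⟩
    ∑ xs (λ x → ⟦ x ≟A a ⟧ * f a)  ≡⟨ ∑-*ʳ xs (f a) _ ⟩
    ∑ xs (λ x → ⟦ x ≟A a ⟧) * f a  ≡⟨ cong (_* f a) once ⟩
    1 * f a                        ≡⟨ *-identityˡ (f a) ⟩
    f a                            ∎
    where open ≡-Reasoning

∑Fin-once : ∀ {n} (a : Fin n) → ∑ (allFin n) (λ i → ⟦ i Fin.≟ a ⟧) ≡ 1
∑Fin-once {suc n} zero = begin
  ∑ (allFin (suc n)) (λ i → ⟦ i Fin.≟ zero ⟧)  ≡⟨ ∑Fin-suc n (λ i → ⟦ i Fin.≟ zero ⟧) ⟩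
  1 + ∑ (allFin n) (λ _ → 0)                   ≡⟨ cong suc (∑-zero (allFin n)) ⟩
  1                                            ∎
  where open ≡-Reasoning
∑Fin-once {suc n} (suc a) = begin
  ∑ (allFin (suc n)) (λ i → ⟦ i Fin.≟ suc a ⟧)  ≡⟨ ∑Fin-suc n (λ i → ⟦ i Fin.≟ suc a ⟧) ⟩
  ∑ (allFin n) (λ i → ⟦ suc i Fin.≟ suc a ⟧)    ≡⟨ ∑-cong (allFin n) (λ i → ⟦⟧-iff (suc i Fin.≟ suc a) (i Fin.≟ a) Finₚ.suc-injective (cong suc)) ⟩
  ∑ (allFin n) (λ i → ⟦ i Fin.≟ a ⟧)            ≡⟨ ∑Fin-once a ⟩
  1                                             ∎
  where open ≡-Reasoning

∑Fin-⟦≟⟧ : ∀ {n} (a : Fin n) (f : Fin n → ℕ) → ∑ (allFin n) (λ i → ⟦ i Fin.≟ a ⟧ * f i) ≡ f a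
∑Fin-⟦≟⟧ a = ∑-⟦≟⟧ Fin._≟_ (allFin _) a (∑Fin-once a)

-- Subsets

_≟S_ : ∀ {q} → DecidableEquality (Subset q)
_≟S_ = Vecₚ.≡-dec Boolₚ._≟_

∷-≟S : ∀ {q} a b (S T : Subset q) → ⟦ (a ∷ S) ≟S (b ∷ T) ⟧ ≡ ⟦ a Boolₚ.≟ b ⟧ * ⟦ S ≟S T ⟧
∷-≟S a b S T = trans (⟦⟧-iff ((a ∷ S) ≟S (b ∷ T)) ((a Boolₚ.≟ b) ×-dec (S ≟S T)) Vecₚ.∷-injective
                        λ { (refl , refl) → refl })
                     (⟦⟧-× (a Boolₚ.≟ b) (S ≟S T))

∑Subsets-suc : ∀ q (f : Subset (suc q) → ℕ) →
               ∑ (allSubsets (suc q)) f ≡ ∑ (allSubsets q) (f ∘ (true ∷_)) + ∑ (allSubsets q) (f ∘ (false ∷_))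
∑Subsets-suc q f = trans (∑-++ (map (true ∷_) (allSubsets q)) (map (false ∷_) (allSubsets q)) f)
                         (cong₂ _+_ (∑-map (true ∷_) (allSubsets q) f) (∑-map (false ∷_) (allSubsets q) f))

∑Subsets-once : ∀ {q} (S : Subset q) → ∑ (allSubsets q) (λ T → ⟦ T ≟S S ⟧) ≡ 1
∑Subsets-once [] = refl
∑Subsets-once {suc q} (b ∷ S) = begin
  ∑ (allSubsets (suc q)) (λ T → ⟦ T ≟S (b ∷ S) ⟧)    ≡⟨ ∑Subsets-suc q _ ⟩
  ∑ (allSubsets q) (λ T → ⟦ (true ∷ T) ≟S (b ∷ S) ⟧) + ∑ (allSubsets q) (λ T → ⟦ (false ∷ T) ≟S (b ∷ S) ⟧)
                                                     ≡⟨ cong₂ _+_ (half true) (half false) ⟩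
  ⟦ true Boolₚ.≟ b ⟧ * 1 + ⟦ false Boolₚ.≟ b ⟧ * 1   ≡⟨ either b ⟩
  1                                                  ∎
  where
  open ≡-Reasoning
  half : ∀ a → ∑ (allSubsets q) (λ T → ⟦ (a ∷ T) ≟S (b ∷ S) ⟧) ≡ ⟦ a Boolₚ.≟ b ⟧ * 1
  half a = trans (∑-cong (allSubsets q) (λ T → ∷-≟S a b T S))
                 (trans (∑-*ˡ (allSubsets q) ⟦ a Boolₚ.≟ b ⟧ _) (cong (⟦ a Boolₚ.≟ b ⟧ *_) (∑Subsets-once S)))
  either : ∀ b → ⟦ true Boolₚ.≟ b ⟧ * 1 + ⟦ false Boolₚ.≟ b ⟧ * 1 ≡ 1
  either true  = refl
  either false = refl

∑Subsets-⟦≟⟧ : ∀ {q} (S : Subset q) (f : Subset q → ℕ) → ∑ (allSubsets q) (λ T → ⟦ T ≟S S ⟧ * f T) ≡ f S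
∑Subsets-⟦≟⟧ S = ∑-⟦≟⟧ _≟S_ (allSubsets _) S (∑Subsets-once S)

∈-allSubsets : ∀ {q} (S : Subset q) → S ∈ₗ allSubsets q
∈-allSubsets []          = here refl
∈-allSubsets (true ∷ S)  = ∈ₗ.∈-++⁺ˡ (∈ₗ.∈-map⁺ (true ∷_) (∈-allSubsets S))
∈-allSubsets (false ∷ S) = ∈ₗ.∈-++⁺ʳ _ (∈ₗ.∈-map⁺ (false ∷_) (∈-allSubsets S))

_∋_ : ∀ {q} → Subset q → Fin q → ℕ
S ∋ v = 𝟙 (lookup S v)

∋≡⟦∈?⟧ : ∀ {q} (S : Subset q) v → ⟦ v Subsetₚ.∈? S ⟧ ≡ S ∋ v
∋≡⟦∈?⟧ S v with lookup S v in eq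
... | true  = ⟦⟧-yes (v Subsetₚ.∈? S) (Vecₚ.lookup⇒[]= v S eq)
... | false = ⟦⟧-no (v Subsetₚ.∈? S) λ v∈S → case trans (sym eq) (Vecₚ.[]=⇒lookup v∈S) of λ ()

∋>0⇒∈ : ∀ {q} (S : Subset q) v → 0 < S ∋ v → v ∈ S
∋>0⇒∈ S v lt with lookup S v in eq
... | true = Vecₚ.lookup⇒[]= v S eq

∈⇒∋≡1 : ∀ {q} (S : Subset q) {v} → v ∈ S → S ∋ v ≡ 1
∈⇒∋≡1 S v∈S = cong 𝟙 (Vecₚ.[]=⇒lookup v∈S)

∑∋≡∣∣ : ∀ {q} (S : Subset q) → ∑ (allFin q) (S ∋_) ≡ ∣ S ∣
∑∋≡∣∣ []                  = refl
∑∋≡∣∣ {suc q} (true ∷ S)  = trans (∑Fin-suc q ((true ∷ S) ∋_)) (cong suc (∑∋≡∣∣ S))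
∑∋≡∣∣ {suc q} (false ∷ S) = trans (∑Fin-suc q ((false ∷ S) ∋_)) (∑∋≡∣∣ S)

-- Rounding of integer flows

∑ℤ : ∀ {N} → (Fin N → ℤ) → ℤ
∑ℤ {zero}  f = 0ℤ
∑ℤ {suc N} f = f zero ℤ.+ ∑ℤ (f ∘ suc)

∑ℤ-cong : ∀ {N} {f g : Fin N → ℤ} → (∀ i → f i ≡ g i) → ∑ℤ f ≡ ∑ℤ g
∑ℤ-cong {zero}  eq = refl
∑ℤ-cong {suc N} eq = cong₂ ℤ._+_ (eq zero) (∑ℤ-cong (eq ∘ suc))

∑ℤ-+ : ∀ {N} (f g : Fin N → ℤ) → ∑ℤ (λ i → f i ℤ.+ g i) ≡ ∑ℤ f ℤ.+ ∑ℤ g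
∑ℤ-+ {zero}  f g = refl
∑ℤ-+ {suc N} f g = trans (cong (ℤ._+_ (f zero ℤ.+ g zero)) (∑ℤ-+ (f ∘ suc) (g ∘ suc)))
                         (interchange (f zero) (g zero) (∑ℤ (f ∘ suc)) (∑ℤ (g ∘ suc)))
  where
  interchange : ∀ a b c d → a ℤ.+ b ℤ.+ (c ℤ.+ d) ≡ a ℤ.+ c ℤ.+ (b ℤ.+ d)
  interchange = ℤ-Ring.solve-∀

∑ℤ-*ˡ : ∀ {N} c (f : Fin N → ℤ) → ∑ℤ (λ i → c ℤ.* f i) ≡ c ℤ.* ∑ℤ f
∑ℤ-*ˡ {zero}  c f = sym (ℤₚ.*-zeroʳ c)
∑ℤ-*ˡ {suc N} c f = trans (cong (ℤ._+_ (c ℤ.* f zero)) (∑ℤ-*ˡ c (f ∘ suc)))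
                          (sym (ℤₚ.*-distribˡ-+ c (f zero) (∑ℤ (f ∘ suc))))

∑ℤ-∣ : ∀ {N} {p} (f : Fin N → ℤ) → (∀ i → p ℤ∣.∣ f i) → p ℤ∣.∣ ∑ℤ f
∑ℤ-∣ {zero}  f d = ℤ∣.divides 0ℤ refl
∑ℤ-∣ {suc N} f d = ℤ∣.∣m∣n⇒∣m+n (d zero) (∑ℤ-∣ (f ∘ suc) (d ∘ suc))

∣∑ℤ∣≤∑∣∣ : ∀ {N} (f : Fin N → ℤ) → ℤ.∣ ∑ℤ f ∣ ≤ ∑ (allFin N) (λ i → ℤ.∣ f i ∣)
∣∑ℤ∣≤∑∣∣ {zero}  f = z≤n
∣∑ℤ∣≤∑∣∣ {suc N} f = begin
  ℤ.∣ f zero ℤ.+ ∑ℤ (f ∘ suc) ∣                      ≤⟨ ℤₚ.∣i+j∣≤∣i∣+∣j∣ (f zero) _ ⟩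
  ℤ.∣ f zero ∣ + ℤ.∣ ∑ℤ (f ∘ suc) ∣                  ≤⟨ +-monoʳ-≤ ℤ.∣ f zero ∣ (∣∑ℤ∣≤∑∣∣ (f ∘ suc)) ⟩
  ℤ.∣ f zero ∣ + ∑ (allFin N) (λ i → ℤ.∣ f (suc i) ∣) ≡⟨ ∑Fin-suc N (λ i → ℤ.∣ f i ∣) ⟨
  ∑ (allFin (suc N)) (λ i → ℤ.∣ f i ∣)               ∎
  where open ≤-Reasoning

cons : ∀ {N} {A : Set} → A → (Fin N → A) → Fin (suc N) → A
cons a f zero    = a
cons a f (suc i) = f i

module Flow {V : Set} (_≟V_ : DecidableEquality V) where

  net : ∀ {N} → (Fin N → V) → (Fin N → V) → (Fin N → ℤ) → (V → ℤ) → ℤ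
  net s t x φ = ∑ℤ λ i → x i ℤ.* (φ (s i) ℤ.- φ (t i))

  net-+ : ∀ {N} (s t : Fin N → V) x y φ → net s t (λ i → x i ℤ.+ y i) φ ≡ net s t x φ ℤ.+ net s t y φ
  net-+ {N} s t x y φ = trans (∑ℤ-cong λ i → ℤₚ.*-distribʳ-+ (φ (s i) ℤ.- φ (t i)) (x i) (y i)) (∑ℤ-+ {N} _ _)

  net-*ˡ : ∀ {N} (s t : Fin N → V) c x φ → net s t (λ i → c ℤ.* x i) φ ≡ c ℤ.* net s t x φ
  net-*ˡ {N} s t c x φ = trans (∑ℤ-cong λ i → ℤₚ.*-assoc c (x i) _) (∑ℤ-*ˡ {N} c _)

  net-cong : ∀ {N} (s t : Fin N → V) {x y} φ → (∀ i → x i ≡ y i) → net s t x φ ≡ net s t y φ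
  net-cong s t φ eq = ∑ℤ-cong λ i → cong (ℤ._* (φ (s i) ℤ.- φ (t i))) (eq i)

  at : V → V → ℤ
  at v w = ℤ.+ ⟦ w ≟V v ⟧

  weight : ∀ {N} → (Fin N → V) → (Fin N → V) → (Fin N → ℤ) → V → ℕ
  weight {N} s t y w = ∑ (allFin N) (λ i → ℤ.∣ y i ∣ * (⟦ s i ≟V w ⟧ + ⟦ t i ≟V w ⟧))

  ∣net-at∣≤weight : ∀ {N} (s t : Fin N → V) y w → ℤ.∣ net s t y (at w) ∣ ≤ weight s t y w
  ∣net-at∣≤weight {N} s t y w = ≤-trans (∣∑ℤ∣≤∑∣∣ (λ i → y i ℤ.* (at w (s i) ℤ.- at w (t i)))) (∑-mono (allFin N) λ i → begin
    ℤ.∣ y i ℤ.* (at w (s i) ℤ.- at w (t i)) ∣      ≡⟨ ℤₚ.abs-* (y i) _ ⟩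
    ℤ.∣ y i ∣ * ℤ.∣ at w (s i) ℤ.- at w (t i) ∣    ≤⟨ *-monoʳ-≤ ℤ.∣ y i ∣ (ℤₚ.∣i-j∣≤∣i∣+∣j∣ (at w (s i)) (at w (t i))) ⟩
    ℤ.∣ y i ∣ * (⟦ s i ≟V w ⟧ + ⟦ t i ≟V w ⟧)      ∎)
    where open ≤-Reasoning

  merge : V → V → V → V
  merge u v w with w ≟V v
  ... | yes _ = u
  ... | no _  = w

  merge-v : ∀ u v → merge u v v ≡ u
  merge-v u v with v ≟V v
  ... | yes _  = refl
  ... | no v≢v = contradiction refl v≢v

  merge-≢ : ∀ u v w → w ≢ v → merge u v w ≡ w
  merge-≢ u v w w≢v with w ≟V v
  ... | yes w≡v = contradiction w≡v w≢v
  ... | no _    = refl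

  merge-split : ∀ u v w (φ : V → ℤ) → φ w ≡ φ (merge u v w) ℤ.+ (φ v ℤ.- φ u) ℤ.* at v w
  merge-split u v w φ with w ≟V v
  ... | yes refl = lemma (φ w) (φ u)
    where
    lemma : ∀ a b → a ≡ b ℤ.+ (a ℤ.- b) ℤ.* 1ℤ
    lemma = ℤ-Ring.solve-∀
  ... | no _     = lemma (φ w) (φ v) (φ u)
    where
    lemma : ∀ a b c → a ≡ a ℤ.+ (b ℤ.- c) ℤ.* 0ℤ
    lemma = ℤ-Ring.solve-∀

  merge-at-u : ∀ u v → u ≢ v → ∀ w → ⟦ merge u v w ≟V u ⟧ ≡ ⟦ w ≟V u ⟧ + ⟦ w ≟V v ⟧
  merge-at-u u v u≢v w with w ≟V v
  ... | no _     = sym (+-identityʳ _)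
  ... | yes refl = trans (⟦⟧-yes (u ≟V u) refl) (sym (cong (_+ 1) (⟦⟧-no (w ≟V u) (u≢v ∘ sym))))

  merge-at-≢ : ∀ u v w′ → w′ ≢ u → w′ ≢ v → ∀ w → ⟦ merge u v w ≟V w′ ⟧ ≡ ⟦ w ≟V w′ ⟧
  merge-at-≢ u v w′ w′≢u w′≢v w with w ≟V v
  ... | no _     = refl
  ... | yes refl = trans (⟦⟧-no (u ≟V w′) (w′≢u ∘ sym)) (sym (⟦⟧-no (w ≟V w′) (w′≢v ∘ sym)))

  record Cycle {N} (s t : Fin N → V) (p : ℤ) (x : Fin N → ℤ) : Set where
    field
      y         : Fin N → ℤ
      conserved : ∀ φ → net s t y φ ≡ 0ℤ
      support   : ∀ i → p ℤ∣.∣ x i → y i ≡ 0ℤ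
      bounded   : ∀ i → ℤ.∣ y i ∣ ≤ 1
      nonzero   : ∃[ i ] (0 < ℤ.∣ y i ∣)
      simple    : ∀ w → weight s t y w ≤ 2

  weight-suc : ∀ {N} (s t : Fin (suc N) → V) y w →
               weight s t y w ≡ ℤ.∣ y zero ∣ * (⟦ s zero ≟V w ⟧ + ⟦ t zero ≟V w ⟧) + weight (s ∘ suc) (t ∘ suc) (y ∘ suc) w
  weight-suc {N} s t y w = ∑Fin-suc N (λ i → ℤ.∣ y i ∣ * (⟦ s i ≟V w ⟧ + ⟦ t i ≟V w ⟧))

  loop : ∀ {N} (s t : Fin (suc N) → V) p x → s zero ≡ t zero → ¬ (p ℤ∣.∣ x zero) → Cycle s t p x
  loop {N} s t p x s≡t p∤x = record
    { y         = cons 1ℤ (λ _ → 0ℤ)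
    ; conserved = λ φ → trans (cong₂ (λ a b → 1ℤ ℤ.* (φ a ℤ.- φ (t zero)) ℤ.+ b) s≡t (zeros φ)) (lemma (φ (t zero)))
    ; support   = λ { zero p∣x → contradiction p∣x p∤x ; (suc i) _ → refl }
    ; bounded   = λ { zero → ≤-refl ; (suc i) → z≤n }
    ; nonzero   = zero , z<s
    ; simple    = λ w → subst (_≤ 2) (sym (trans (weight-suc s t (cons 1ℤ (λ _ → 0ℤ)) w) (cong (1 * (⟦ s zero ≟V w ⟧ + ⟦ t zero ≟V w ⟧) +_) (∑-zero (allFin N)))))
                    (subst (_≤ 2) (sym (trans (+-identityʳ _) (*-identityˡ _))) (+-mono-≤ (⟦⟧≤1 (s zero ≟V w)) (⟦⟧≤1 (t zero ≟V w))))
    }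
    where
    zeros : ∀ φ → net (s ∘ suc) (t ∘ suc) (λ _ → 0ℤ) φ ≡ 0ℤ
    zeros φ = net-*ˡ (s ∘ suc) (t ∘ suc) 0ℤ (λ _ → 0ℤ) φ
    lemma : ∀ a → 1ℤ ℤ.* (a ℤ.- a) ℤ.+ 0ℤ ≡ 0ℤ
    lemma = ℤ-Ring.solve-∀

  skip : ∀ {N} (s t : Fin (suc N) → V) p x → p ℤ∣.∣ x zero → Cycle (s ∘ suc) (t ∘ suc) p (x ∘ suc) → Cycle s t p x
  skip s t p x p∣x c = record
    { y         = cons 0ℤ y
    ; conserved = λ φ → trans (ℤₚ.+-identityˡ _) (conserved φ)
    ; support   = λ { zero _ → refl ; (suc i) → support i }
    ; bounded   = λ { zero → z≤n ; (suc i) → bounded i }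
    ; nonzero   = suc (proj₁ nonzero) , proj₂ nonzero
    ; simple    = λ w → subst (_≤ 2) (sym (weight-suc s t (cons 0ℤ y) w)) (simple w)
    }
    where open Cycle c

  uncontract : ∀ {N} (s t : Fin (suc N) → V) p x → s zero ≢ t zero → ¬ (p ℤ∣.∣ x zero) →
               let ρ = merge (s zero) (t zero) in Cycle (ρ ∘ s ∘ suc) (ρ ∘ t ∘ suc) p (x ∘ suc) → Cycle s t p x
  uncontract {N} s t p x u≢v p∤x c = record
    { y         = y′
    ; conserved = conserved′
    ; support   = λ { zero p∣x → contradiction p∣x p∤x ; (suc i) → support i }
    ; bounded   = λ { zero → ∣d∣≤1 ; (suc i) → bounded i }
    ; nonzero   = suc (proj₁ nonzero) , proj₂ nonzero
    ; simple    = simple′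
    }
    where
    open Cycle c
    u v : V
    u = s zero
    v = t zero
    ρ : V → V
    ρ = merge u v
    s₁ t₁ : Fin N → V
    s₁ = s ∘ suc
    t₁ = t ∘ suc
    d : ℤ
    d = net s₁ t₁ y (at v)
    y′ : Fin (suc N) → ℤ
    y′ = cons d y
    net-split : ∀ φ → net s₁ t₁ y φ ≡ net (ρ ∘ s₁) (ρ ∘ t₁) y φ ℤ.+ (φ v ℤ.- φ u) ℤ.* d
    net-split φ = begin
      net s₁ t₁ y φ
        ≡⟨ ∑ℤ-cong (λ i → trans (cong₂ (λ a b → y i ℤ.* (a ℤ.- b)) (merge-split u v (s₁ i) φ) (merge-split u v (t₁ i) φ))
                                 (lemma (y i) (φ (ρ (s₁ i))) (φ (ρ (t₁ i))) (φ v ℤ.- φ u) (at v (s₁ i)) (at v (t₁ i)))) ⟩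
      ∑ℤ (λ i → y i ℤ.* (φ (ρ (s₁ i)) ℤ.- φ (ρ (t₁ i))) ℤ.+ (φ v ℤ.- φ u) ℤ.* (y i ℤ.* (at v (s₁ i) ℤ.- at v (t₁ i))))
        ≡⟨ ∑ℤ-+ {N} _ _ ⟩
      net (ρ ∘ s₁) (ρ ∘ t₁) y φ ℤ.+ ∑ℤ (λ i → (φ v ℤ.- φ u) ℤ.* (y i ℤ.* (at v (s₁ i) ℤ.- at v (t₁ i))))
        ≡⟨ cong (ℤ._+_ (net (ρ ∘ s₁) (ρ ∘ t₁) y φ)) (∑ℤ-*ˡ {N} (φ v ℤ.- φ u) _) ⟩
      net (ρ ∘ s₁) (ρ ∘ t₁) y φ ℤ.+ (φ v ℤ.- φ u) ℤ.* d ∎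
      where
      open ≡-Reasoning
      lemma : ∀ y a b c e f → y ℤ.* ((a ℤ.+ c ℤ.* e) ℤ.- (b ℤ.+ c ℤ.* f)) ≡ y ℤ.* (a ℤ.- b) ℤ.+ c ℤ.* (y ℤ.* (e ℤ.- f))
      lemma = ℤ-Ring.solve-∀
    conserved′ : ∀ φ → net s t y′ φ ≡ 0ℤ
    conserved′ φ = trans (cong (ℤ._+_ (d ℤ.* (φ u ℤ.- φ v))) (trans (net-split φ) (cong (ℤ._+ (φ v ℤ.- φ u) ℤ.* d) (conserved φ))))
                         (lemma d (φ u) (φ v))
      where
      lemma : ∀ d a b → d ℤ.* (a ℤ.- b) ℤ.+ (0ℤ ℤ.+ (b ℤ.- a) ℤ.* d) ≡ 0ℤ
      lemma = ℤ-Ring.solve-∀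
    d+dᵤ≡0 : net s₁ t₁ y (at u) ℤ.+ d ≡ 0ℤ
    d+dᵤ≡0 = begin
      net s₁ t₁ y (at u) ℤ.+ d
        ≡⟨ ∑ℤ-+ {N} _ _ ⟨
      ∑ℤ (λ i → y i ℤ.* (at u (s₁ i) ℤ.- at u (t₁ i)) ℤ.+ y i ℤ.* (at v (s₁ i) ℤ.- at v (t₁ i)))
        ≡⟨ ∑ℤ-cong (λ i → trans (lemma (y i) (at u (s₁ i)) (at u (t₁ i)) (at v (s₁ i)) (at v (t₁ i)))
                                 (sym (cong₂ (λ a b → y i ℤ.* (a ℤ.- b)) (cong ℤ.+_ (merge-at-u u v u≢v (s₁ i))) (cong ℤ.+_ (merge-at-u u v u≢v (t₁ i)))))) ⟩
      net (ρ ∘ s₁) (ρ ∘ t₁) y (at u)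
        ≡⟨ conserved (at u) ⟩
      0ℤ ∎
      where
      open ≡-Reasoning
      lemma : ∀ y a b c e → y ℤ.* (a ℤ.- b) ℤ.+ y ℤ.* (c ℤ.- e) ≡ y ℤ.* ((a ℤ.+ c) ℤ.- (b ℤ.+ e))
      lemma = ℤ-Ring.solve-∀
    wᵤ wᵥ : ℕ
    wᵤ = weight s₁ t₁ y u
    wᵥ = weight s₁ t₁ y v
    wᵤ+wᵥ≤2 : wᵤ + wᵥ ≤ 2
    wᵤ+wᵥ≤2 = subst (_≤ 2) eq (simple u)
      where
      lemma : ∀ n a b c e → n * ((a + b) + (c + e)) ≡ n * (a + c) + n * (b + e)
      lemma = solve-∀
      eq : weight (ρ ∘ s₁) (ρ ∘ t₁) y u ≡ wᵤ + wᵥ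
      eq = trans (∑-cong (allFin N) λ i → trans (cong₂ (λ a b → ℤ.∣ y i ∣ * (a + b)) (merge-at-u u v u≢v (s₁ i)) (merge-at-u u v u≢v (t₁ i)))
                                                (lemma ℤ.∣ y i ∣ ⟦ s₁ i ≟V u ⟧ ⟦ s₁ i ≟V v ⟧ ⟦ t₁ i ≟V u ⟧ ⟦ t₁ i ≟V v ⟧))
                 (∑-+ (allFin N) _ _)
    ∣d∣≤wᵥ : ℤ.∣ d ∣ ≤ wᵥ
    ∣d∣≤wᵥ = ∣net-at∣≤weight s₁ t₁ y v
    ∣d∣≤wᵤ : ℤ.∣ d ∣ ≤ wᵤ
    ∣d∣≤wᵤ = subst (_≤ wᵤ) (sym (trans (cong ℤ.∣_∣ d≡-) (ℤₚ.∣-i∣≡∣i∣ (net s₁ t₁ y (at u))))) (∣net-at∣≤weight s₁ t₁ y u)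
      where
      d≡- : d ≡ ℤ.- net s₁ t₁ y (at u)
      d≡- = trans (lemma (net s₁ t₁ y (at u)) d) (trans (cong (ℤ._- net s₁ t₁ y (at u)) d+dᵤ≡0) (ℤₚ.+-identityˡ _))
        where
        lemma : ∀ a b → b ≡ (a ℤ.+ b) ℤ.- a
        lemma = ℤ-Ring.solve-∀
    ∣d∣≤1 : ℤ.∣ d ∣ ≤ 1
    ∣d∣≤1 with ℤ.∣ d ∣ ≤? 1
    ... | yes le = le
    ... | no ¬le = contradiction (≤-trans (+-mono-≤ (≰⇒> ¬le) (≰⇒> ¬le)) (≤-trans (+-mono-≤ ∣d∣≤wᵤ ∣d∣≤wᵥ) wᵤ+wᵥ≤2)) λ { (s≤s (s≤s ())) }
    simple′ : ∀ w → weight s t y′ w ≤ 2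
    simple′ w with w ≟V u | w ≟V v
    ... | yes refl | yes w≡v = contradiction w≡v u≢v
    ... | yes refl | no w≢v = begin
      weight s t y′ w                                   ≡⟨ weight-suc s t y′ w ⟩
      ℤ.∣ d ∣ * (⟦ u ≟V w ⟧ + ⟦ v ≟V w ⟧) + wᵤ          ≡⟨ cong₂ (λ a b → ℤ.∣ d ∣ * (a + b) + wᵤ) (⟦⟧-yes (u ≟V w) refl) (⟦⟧-no (v ≟V w) (w≢v ∘ sym)) ⟩
      ℤ.∣ d ∣ * 1 + wᵤ                                  ≡⟨ cong (_+ wᵤ) (*-identityʳ ℤ.∣ d ∣) ⟩
      ℤ.∣ d ∣ + wᵤ                                      ≤⟨ +-monoˡ-≤ wᵤ ∣d∣≤wᵥ ⟩
      wᵥ + wᵤ                                           ≡⟨ +-comm wᵥ wᵤ ⟩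
      wᵤ + wᵥ                                           ≤⟨ wᵤ+wᵥ≤2 ⟩
      2                                                 ∎
      where open ≤-Reasoning
    ... | no w≢u | yes refl = begin
      weight s t y′ w                                   ≡⟨ weight-suc s t y′ w ⟩
      ℤ.∣ d ∣ * (⟦ u ≟V w ⟧ + ⟦ v ≟V w ⟧) + wᵥ          ≡⟨ cong₂ (λ a b → ℤ.∣ d ∣ * (a + b) + wᵥ) (⟦⟧-no (u ≟V w) (w≢u ∘ sym)) (⟦⟧-yes (v ≟V w) refl) ⟩
      ℤ.∣ d ∣ * 1 + wᵥ                                  ≡⟨ cong (_+ wᵥ) (*-identityʳ ℤ.∣ d ∣) ⟩
      ℤ.∣ d ∣ + wᵥ                                      ≤⟨ +-monoˡ-≤ wᵥ ∣d∣≤wᵤ ⟩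
      wᵤ + wᵥ                                           ≤⟨ wᵤ+wᵥ≤2 ⟩
      2                                                 ∎
      where open ≤-Reasoning
    ... | no w≢u | no w≢v = begin
      weight s t y′ w                                   ≡⟨ weight-suc s t y′ w ⟩
      ℤ.∣ d ∣ * (⟦ u ≟V w ⟧ + ⟦ v ≟V w ⟧) + weight s₁ t₁ y w
        ≡⟨ cong₂ (λ a b → ℤ.∣ d ∣ * (a + b) + weight s₁ t₁ y w) (⟦⟧-no (u ≟V w) (w≢u ∘ sym)) (⟦⟧-no (v ≟V w) (w≢v ∘ sym)) ⟩
      ℤ.∣ d ∣ * 0 + weight s₁ t₁ y w                    ≡⟨ cong (_+ weight s₁ t₁ y w) (*-zeroʳ ℤ.∣ d ∣) ⟩
      weight s₁ t₁ y w
        ≡⟨ ∑-cong (allFin N) (λ i → cong₂ (λ a b → ℤ.∣ y i ∣ * (a + b)) (merge-at-≢ u v w w≢u w≢v (s₁ i)) (merge-at-≢ u v w w≢u w≢v (t₁ i))) ⟨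
      weight (ρ ∘ s₁) (ρ ∘ t₁) y w                      ≤⟨ simple w ⟩
      2                                                 ∎
      where open ≤-Reasoning

  -- Induction on the number of arcs: an arc that is not a loop and whose value is not divisible by p
  -- is contracted. Conservation is tested against all potentials φ, so contracting the arc
  -- amounts to restricting to the potentials that agree on its ends.
  cycle : ∀ {N} (s t : Fin N → V) p x → (∀ φ → p ℤ∣.∣ net s t x φ) → (∀ i → p ℤ∣.∣ x i) ⊎ Cycle s t p x
  cycle {zero}  s t p x _    = inj₁ λ ()
  cycle {suc N} s t p x p∣net with p ℤ∣.∣? x zero
  ... | yes p∣x = Sum.map (λ all → λ { zero → p∣x ; (suc i) → all i }) (skip s t p x p∣x)
                    (cycle (s ∘ suc) (t ∘ suc) p (x ∘ suc) λ φ → ℤ∣.∣m+n∣m⇒∣n (p∣net φ) (ℤ∣.∣m⇒∣m*n _ p∣x))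
  ... | no p∤x with s zero ≟V t zero
  ...   | yes s≡t = inj₂ (loop s t p x s≡t p∤x)
  ...   | no s≢t with cycle (ρ ∘ s ∘ suc) (ρ ∘ t ∘ suc) p (x ∘ suc) contracted
    where
    ρ : V → V
    ρ = merge (s zero) (t zero)
    vanish : ∀ φ → x zero ℤ.* (φ (ρ (s zero)) ℤ.- φ (ρ (t zero))) ≡ 0ℤ
    vanish φ = trans (cong₂ (λ a b → x zero ℤ.* (φ a ℤ.- φ b)) (merge-≢ _ _ _ s≢t) (merge-v _ _)) (lemma (x zero) (φ (s zero)))
      where
      lemma : ∀ a b → a ℤ.* (b ℤ.- b) ≡ 0ℤ
      lemma = ℤ-Ring.solve-∀
    contracted : ∀ φ → p ℤ∣.∣ net (ρ ∘ s ∘ suc) (ρ ∘ t ∘ suc) (x ∘ suc) φ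
    contracted φ = subst (p ℤ∣.∣_) (trans (cong (ℤ._+ net (ρ ∘ s ∘ suc) (ρ ∘ t ∘ suc) (x ∘ suc) φ) (vanish φ)) (ℤₚ.+-identityˡ _)) (p∣net (φ ∘ ρ))
  ...     | inj₂ c   = inj₂ (uncontract s t p x s≢t p∤x c)
  ...     | inj₁ all = contradiction (subst (p ℤ∣.∣_) eq (ℤ∣.∣m+n∣n⇒∣m (p∣net (at (s zero))) (∑ℤ-∣ {N} _ λ i → ℤ∣.∣m⇒∣m*n _ (all i)))) p∤x
    where
    eq : x zero ℤ.* (at (s zero) (s zero) ℤ.- at (s zero) (t zero)) ≡ x zero
    eq = trans (cong₂ (λ a b → x zero ℤ.* (ℤ.+ a ℤ.- ℤ.+ b)) (⟦⟧-yes (s zero ≟V s zero) refl) (⟦⟧-no (t zero ≟V s zero) (s≢t ∘ sym)))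
               (ℤₚ.*-identityʳ (x zero))

-- b is P⁻¹f rounded up or down; multiples of P are divided exactly.
Rounds : ℕ → ℕ → ℕ → Set
Rounds P f b = P * b < f + P × f < P * b + P

shift : ℕ → ℤ → ℕ
shift f y = ℤ.∣ ℤ.+ f ℤ.+ y ∣

-- The potential f (P ∸ f) is concave, so one of two opposite pushes decreases it.
gap : ℕ → ℕ → ℕ
gap P f = f * (P ∸ f)

record Push (P f : ℕ) (y : ℤ) : Set where
  field
    value    : ℤ.+ shift f y ≡ ℤ.+ f ℤ.+ y
    range    : shift f y ≤ P
    transfer : ∀ b → Rounds P (shift f y) b → Rounds P f b

rounds-pred : ∀ P f b → ¬ P ∣ f → Rounds P (suc f) b → Rounds P f b
rounds-pred P f b P∤f (lt₁ , lt₂) =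
  ≤∧≢⇒< (s≤s⁻¹ lt₁) (λ eq → P∤f (∣m+n∣m⇒∣n (subst (P ∣_) (trans eq (+-comm f P)) (m∣m*n b)) ∣ₚ.∣-refl)) , <-trans (n<1+n f) lt₂

rounds-suc : ∀ P f b → ¬ P ∣ suc f → Rounds P f b → Rounds P (suc f) b
rounds-suc P f b P∤f (lt₁ , lt₂) =
  <-trans lt₁ (n<1+n _) , ≤∧≢⇒< lt₂ (λ eq → P∤f (subst (P ∣_) (sym (trans eq (+-comm (P * b) P))) (∣ₚ.∣m∣n⇒∣m+n ∣ₚ.∣-refl (m∣m*n b))))

trit : ∀ y → ℤ.∣ y ∣ ≤ 1 → y ≡ 0ℤ ⊎ y ≡ 1ℤ ⊎ y ≡ ℤ.-1ℤ
trit (ℤ.+ 0)      _ = inj₁ refl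
trit (ℤ.+ 1)      _ = inj₂ (inj₁ refl)
trit -[1+ 0 ]     _ = inj₂ (inj₂ refl)
trit (ℤ.+ (suc (suc _))) (s≤s ())
trit -[1+ suc _ ] (s≤s ())

interior : ∀ {P f} → f ≤ P → ¬ P ∣ f → ∃[ a ] ∃[ b ] (f ≡ suc a × P ≡ suc a + suc b)
interior {f = zero}  f≤P P∤f = contradiction (_ ∣0) P∤f
interior {f = suc a} f≤P P∤f with m≤n⇒∃[o]m+o≡n f≤P
... | zero  , refl = contradiction (subst (_∣ suc a) (sym (+-identityʳ (suc a))) ∣ₚ.∣-refl) P∤f
... | suc b , refl = a , b , refl , refl

push : ∀ {P f} → f ≤ P → ∀ y → ℤ.∣ y ∣ ≤ 1 → (P ∣ f → y ≡ 0ℤ) → Push P f y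
push {P} {f} f≤P y ∣y∣≤1 support with trit y ∣y∣≤1
... | inj₁ refl = record
  { value    = refl
  ; range    = subst (_≤ P) (sym (+-identityʳ f)) f≤P
  ; transfer = λ b → subst (λ g → Rounds P g b) (+-identityʳ f)
  }
... | inj₂ (inj₁ refl) with interior f≤P (λ P∣f → case support P∣f of λ ())
...   | a , b , refl , refl = record
  { value    = refl
  ; range    = subst (_≤ suc a + suc b) (sym (+-comm (suc a) 1)) (subst (suc (suc a) ≤_) (sym (+-suc (suc a) b)) (m≤m+n (suc (suc a)) b))
  ; transfer = λ c → rounds-pred _ (suc a) c (λ P∣f → case support P∣f of λ ()) ∘ subst (λ g → Rounds (suc a + suc b) g c) (+-comm (suc a) 1)
  }
push {P} {f} f≤P y ∣y∣≤1 support | inj₂ (inj₂ refl) with interior f≤P (λ P∣f → case support P∣f of λ ())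
...   | a , b , refl , refl = record
  { value    = refl
  ; range    = ≤-trans (n≤1+n a) (m≤m+n (suc a) (suc b))
  ; transfer = λ c → rounds-suc _ a c (λ P∣f → case support P∣f of λ ())
  }

gap-neighbours : ∀ a b → let P = suc a + suc b in gap P (suc a + 1) + gap P a + 2 ≡ gap P (suc a) + gap P (suc a)
gap-neighbours a b = begin
  gap (suc a + suc b) (suc a + 1) + gap (suc a + suc b) a + 2
    ≡⟨ cong₂ (λ g h → (suc a + 1) * g + a * h + 2) (trans (cong (_∸ (suc a + 1)) (lemma₁ a b)) (m+n∸m≡n (suc a + 1) b))
                                                  (trans (cong (_∸ a) (lemma₂ a b)) (m+n∸m≡n a (suc (suc b)))) ⟩
  (suc a + 1) * b + a * suc (suc b) + 2
    ≡⟨ lemma₃ a b ⟩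
  suc a * suc b + suc a * suc b
    ≡⟨ cong (λ g → suc a * g + suc a * g) (m+n∸m≡n (suc a) (suc b)) ⟨
  gap (suc a + suc b) (suc a) + gap (suc a + suc b) (suc a) ∎
  where
  open ≡-Reasoning
  lemma₁ : ∀ a b → suc a + suc b ≡ (suc a + 1) + b
  lemma₁ = solve-∀
  lemma₂ : ∀ a b → suc a + suc b ≡ a + suc (suc b)
  lemma₂ = solve-∀
  lemma₃ : ∀ a b → (suc a + 1) * b + a * suc (suc b) + 2 ≡ suc a * suc b + suc a * suc b
  lemma₃ = solve-∀

gap-push : ∀ {P f} → f ≤ P → ∀ y → ℤ.∣ y ∣ ≤ 1 → (P ∣ f → y ≡ 0ℤ) →
           gap P (shift f y) + gap P (shift f (ℤ.- y)) + 2 * ℤ.∣ y ∣ ≡ gap P f + gap P f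
gap-push {P} {f} f≤P y ∣y∣≤1 support with trit y ∣y∣≤1
... | inj₁ refl = trans (+-identityʳ _) (cong₂ _+_ (cong (gap P) (+-identityʳ f)) (cong (gap P) (+-identityʳ f)))
... | inj₂ (inj₁ refl) with interior f≤P (λ P∣f → case support P∣f of λ ())
...   | a , b , refl , refl = gap-neighbours a b
gap-push {P} {f} f≤P y ∣y∣≤1 support | inj₂ (inj₂ refl) with interior f≤P (λ P∣f → case support P∣f of λ ())
...   | a , b , refl , refl = trans (cong (_+ 2) (+-comm (gap _ a) _)) (gap-neighbours a b)

module Rounding {V : Set} (_≟V_ : DecidableEquality V) where
  open Flow _≟V_

  Rounded : ∀ {N} → (Fin N → V) → (Fin N → V) → ℕ → (Fin N → ℕ) → Set
  Rounded {N} s t P f = Σ (Fin N → ℕ) λ b →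
    (∀ i → Rounds P (f i) (b i)) × (∀ φ → ℤ.+ P ℤ.* net s t (λ i → ℤ.+ b i) φ ≡ net s t (λ i → ℤ.+ f i) φ)

  private
    total : ∀ {N} → ℕ → (Fin N → ℕ) → ℕ
    total {N} P f = ∑ (allFin N) (λ i → gap P (f i))

  round-acc : ∀ {N} (s t : Fin N → V) P (f : Fin N → ℕ) → 0 < P → (∀ i → f i ≤ P) →
              (∀ φ → ℤ.+ P ℤ∣.∣ net s t (λ i → ℤ.+ f i) φ) → Acc _<_ (total P f) → Rounded s t P f
  round-acc {N} s t P f P>0 f≤P P∣net (acc rec) with cycle s t (ℤ.+ P) (λ i → ℤ.+ f i) P∣net
  ... | inj₁ all = (λ i → ∣ₚ._∣_.quotient (P∣f i)) , rounds ,
      λ φ → trans (sym (net-*ˡ s t (ℤ.+ P) _ φ)) (net-cong s t φ λ i → trans (sym (ℤₚ.pos-* P _)) (cong ℤ.+_ (P*q≡f i)))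
    where
    P∣f : ∀ i → P ∣ f i
    P∣f i = ℤ∣.∣⇒∣ᵤ (all i)
    P*q≡f : ∀ i → P * ∣ₚ._∣_.quotient (P∣f i) ≡ f i
    P*q≡f i = trans (*-comm P _) (sym (∣ₚ._∣_.equality (P∣f i)))
    rounds : ∀ i → Rounds P (f i) (∣ₚ._∣_.quotient (P∣f i))
    rounds i = subst (_< f i + P) (sym (P*q≡f i)) (m<m+n (f i) P>0) , subst (λ z → f i < z + P) (sym (P*q≡f i)) (m<m+n (f i) P>0)
  ... | inj₂ c = choose (total P f⁺ <? total P f) (total P f⁻ <? total P f)
    where
    open Cycle c
    support′ : ∀ i → P ∣ f i → y i ≡ 0ℤ
    support′ i P∣f = support i (ℤ∣.∣ᵤ⇒∣ P∣f)
    f⁺ f⁻ : Fin N → ℕ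
    f⁺ i = shift (f i) (y i)
    f⁻ i = shift (f i) (ℤ.- y i)
    push⁺ : ∀ i → Push P (f i) (y i)
    push⁺ i = push (f≤P i) (y i) (bounded i) (support′ i)
    push⁻ : ∀ i → Push P (f i) (ℤ.- y i)
    push⁻ i = push (f≤P i) (ℤ.- y i) (subst (_≤ 1) (sym (ℤₚ.∣-i∣≡∣i∣ (y i))) (bounded i)) λ P∣f → cong ℤ.-_ (support′ i P∣f)
    total-push : total P f⁺ + total P f⁻ + 2 * ∑ (allFin N) (λ i → ℤ.∣ y i ∣) ≡ total P f + total P f
    total-push = begin
      total P f⁺ + total P f⁻ + 2 * ∑ (allFin N) (λ i → ℤ.∣ y i ∣)
        ≡⟨ cong₂ _+_ (∑-+ (allFin N) _ _) (∑-*ˡ (allFin N) 2 _) ⟨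
      ∑ (allFin N) (λ i → gap P (f⁺ i) + gap P (f⁻ i)) + ∑ (allFin N) (λ i → 2 * ℤ.∣ y i ∣)
        ≡⟨ ∑-+ (allFin N) _ _ ⟨
      ∑ (allFin N) (λ i → gap P (f⁺ i) + gap P (f⁻ i) + 2 * ℤ.∣ y i ∣)
        ≡⟨ ∑-cong (allFin N) (λ i → gap-push (f≤P i) (y i) (bounded i) (support′ i)) ⟩
      ∑ (allFin N) (λ i → gap P (f i) + gap P (f i))
        ≡⟨ ∑-+ (allFin N) _ _ ⟩
      total P f + total P f ∎
      where open ≡-Reasoning
    recurse : (g : Fin N → ℕ) (z : Fin N → ℤ) → (∀ φ → net s t z φ ≡ 0ℤ) → (∀ i → ℤ.+ g i ≡ ℤ.+ f i ℤ.+ z i) →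
              (∀ i → g i ≤ P) → (∀ i b → Rounds P (g i) b → Rounds P (f i) b) → total P g < total P f → Rounded s t P f
    recurse g z net-z value range transfer lt with
      round-acc s t P g P>0 range (λ φ → subst (ℤ.+ P ℤ∣.∣_) (sym (same φ)) (P∣net φ)) (rec lt)
      where
      same : ∀ φ → net s t (λ i → ℤ.+ g i) φ ≡ net s t (λ i → ℤ.+ f i) φ
      same φ = trans (net-cong s t φ value) (trans (net-+ s t (λ i → ℤ.+ f i) z φ) (trans (cong (ℤ._+_ (net s t (λ i → ℤ.+ f i) φ)) (net-z φ)) (ℤₚ.+-identityʳ _)))
    ... | b , rounds , net-b = b , (λ i → transfer i (b i) (rounds i)) , λ φ → trans (net-b φ)
        (trans (net-cong s t φ value) (trans (net-+ s t (λ i → ℤ.+ f i) z φ) (trans (cong (ℤ._+_ (net s t (λ i → ℤ.+ f i) φ)) (net-z φ)) (ℤₚ.+-identityʳ _))))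
    choose : Dec (total P f⁺ < total P f) → Dec (total P f⁻ < total P f) → Rounded s t P f
    choose (yes lt) _ = recurse f⁺ y conserved (λ i → Push.value (push⁺ i)) (λ i → Push.range (push⁺ i)) (λ i → Push.transfer (push⁺ i)) lt
    choose (no _) (yes lt) = recurse f⁻ (λ i → ℤ.- y i) conserved⁻ (λ i → Push.value (push⁻ i)) (λ i → Push.range (push⁻ i)) (λ i → Push.transfer (push⁻ i)) lt
      where
      conserved⁻ : ∀ φ → net s t (λ i → ℤ.- y i) φ ≡ 0ℤ
      conserved⁻ φ = trans (net-cong s t φ λ i → sym (ℤₚ.-1*i≡-i (y i))) (trans (net-*ˡ s t ℤ.-1ℤ y φ) (cong (ℤ._*_ ℤ.-1ℤ) (conserved φ)))
    choose (no ¬lt⁺) (no ¬lt⁻) = contradiction total-push (>⇒≢ (begin-strict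
      total P f + total P f                                             ≤⟨ +-mono-≤ (≮⇒≥ ¬lt⁺) (≮⇒≥ ¬lt⁻) ⟩
      total P f⁺ + total P f⁻                                           <⟨ m<m+n _ (<-≤-trans z<s (*-monoʳ-≤ 2 (≤-trans (proj₂ nonzero) (term≤∑Fin (λ i → ℤ.∣ y i ∣) (proj₁ nonzero))))) ⟩
      total P f⁺ + total P f⁻ + 2 * ∑ (allFin N) (λ i → ℤ.∣ y i ∣)      ∎))
      where open ≤-Reasoning

  round : ∀ {N} (s t : Fin N → V) P (x : Fin N → ℕ) → 0 < P →
          (∀ φ → ℤ.+ P ℤ∣.∣ net s t (λ i → ℤ.+ x i) φ) → Rounded s t P x
  round {N} s t (suc P′) x P>0 P∣net = (λ i → q i + b i) , rounds′ , net′
    where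
    P : ℕ
    P = suc P′
    f q : Fin N → ℕ
    f i = x i % P
    q i = x i / P
    x≡ : ∀ i → ℤ.+ x i ≡ ℤ.+ f i ℤ.+ ℤ.+ P ℤ.* ℤ.+ q i
    x≡ i = trans (cong ℤ.+_ (trans (m≡m%n+[m/n]*n (x i) P) (cong (_+_ (f i)) (*-comm (q i) P))))
                 (cong (ℤ._+_ (ℤ.+ f i)) (ℤₚ.pos-* P (q i)))
    net-x : ∀ φ → net s t (λ i → ℤ.+ x i) φ ≡ net s t (λ i → ℤ.+ f i) φ ℤ.+ ℤ.+ P ℤ.* net s t (λ i → ℤ.+ q i) φ
    net-x φ = trans (net-cong s t φ x≡) (trans (net-+ s t (λ i → ℤ.+ f i) (λ i → ℤ.+ P ℤ.* ℤ.+ q i) φ)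
                (cong (ℤ._+_ (net s t (λ i → ℤ.+ f i) φ)) (net-*ˡ s t (ℤ.+ P) (λ i → ℤ.+ q i) φ)))
    rounded : Rounded s t P f
    rounded = round-acc s t P f P>0 (λ i → <⇒≤ (m%n<n (x i) P))
                (λ φ → ℤ∣.∣m+n∣n⇒∣m (subst (ℤ.+ P ℤ∣.∣_) (net-x φ) (P∣net φ)) (ℤ∣.∣m⇒∣m*n _ ℤ∣.∣-refl)) (<-wellFounded _)
    b : Fin N → ℕ
    b = proj₁ rounded
    rounds′ : ∀ i → Rounds P (x i) (q i + b i)
    rounds′ i with proj₁ (proj₂ rounded) i
    ... | lt₁ , lt₂ = subst₂ _<_ (eq₁ P (q i) (b i)) (trans (eq₂ P (q i) (f i)) (cong (_+ P) (sym x≡ℕ))) (+-monoʳ-< (P * q i) lt₁)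
                    , subst₂ _<_ (trans (+-comm (P * q i) (f i)) (sym x≡ℕ)) (eq₃ P (q i) (b i)) (+-monoʳ-< (P * q i) lt₂)
      where
      x≡ℕ : x i ≡ f i + P * q i
      x≡ℕ = trans (m≡m%n+[m/n]*n (x i) P) (cong (_+_ (f i)) (*-comm (q i) P))
      eq₁ : ∀ P q b → P * q + P * b ≡ P * (q + b)
      eq₁ = solve-∀
      eq₂ : ∀ P q f → P * q + (f + P) ≡ f + P * q + P
      eq₂ = solve-∀
      eq₃ : ∀ P q b → P * q + (P * b + P) ≡ P * (q + b) + P
      eq₃ = solve-∀
    net′ : ∀ φ → ℤ.+ P ℤ.* net s t (λ i → ℤ.+ (q i + b i)) φ ≡ net s t (λ i → ℤ.+ x i) φ
    net′ φ = begin
      ℤ.+ P ℤ.* net s t (λ i → ℤ.+ (q i + b i)) φ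
        ≡⟨ cong (ℤ._*_ (ℤ.+ P)) (net-+ s t (λ i → ℤ.+ q i) (λ i → ℤ.+ b i) φ) ⟩
      ℤ.+ P ℤ.* (net s t (λ i → ℤ.+ q i) φ ℤ.+ net s t (λ i → ℤ.+ b i) φ)
        ≡⟨ lemma (ℤ.+ P) (net s t (λ i → ℤ.+ q i) φ) (net s t (λ i → ℤ.+ b i) φ) ⟩
      ℤ.+ P ℤ.* net s t (λ i → ℤ.+ b i) φ ℤ.+ ℤ.+ P ℤ.* net s t (λ i → ℤ.+ q i) φ
        ≡⟨ cong (ℤ._+ ℤ.+ P ℤ.* net s t (λ i → ℤ.+ q i) φ) (proj₂ (proj₂ rounded) φ) ⟩
      net s t (λ i → ℤ.+ f i) φ ℤ.+ ℤ.+ P ℤ.* net s t (λ i → ℤ.+ q i) φ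
        ≡⟨ net-x φ ⟨
      net s t (λ i → ℤ.+ x i) φ ∎
      where
      open ≡-Reasoning
      lemma : ∀ p a b → p ℤ.* (a ℤ.+ b) ≡ p ℤ.* b ℤ.+ p ℤ.* a
      lemma = ℤ-Ring.solve-∀

∑ℤ-pos : ∀ {N} (f : Fin N → ℕ) → ∑ℤ (λ i → ℤ.+ f i) ≡ ℤ.+ ∑ (allFin N) f
∑ℤ-pos {zero}  f = refl
∑ℤ-pos {suc N} f = trans (cong (ℤ._+_ (ℤ.+ f zero)) (∑ℤ-pos (f ∘ suc))) (cong ℤ.+_ (sym (∑Fin-suc N f)))

∑-fibre : ∀ {A B : Set} (_≟B_ : DecidableEquality B) (ys : List B) → (∀ b → ∑ ys (λ y → ⟦ y ≟B b ⟧) ≡ 1) →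
          (xs : List A) (g : A → B) (h : A → ℕ) (ψ : B → ℕ) →
          ∑ ys (λ y → ∑ xs (λ x → ⟦ g x ≟B y ⟧ * h x) * ψ y) ≡ ∑ xs (λ x → h x * ψ (g x))
∑-fibre _≟B_ ys once xs g h ψ = begin
  ∑ ys (λ y → ∑ xs (λ x → ⟦ g x ≟B y ⟧ * h x) * ψ y)
    ≡⟨ ∑-cong ys (λ y → ∑-*ʳ xs (ψ y) _) ⟨
  ∑ ys (λ y → ∑ xs (λ x → ⟦ g x ≟B y ⟧ * h x * ψ y))
    ≡⟨ ∑-swap ys xs _ ⟩
  ∑ xs (λ x → ∑ ys (λ y → ⟦ g x ≟B y ⟧ * h x * ψ y))
    ≡⟨ ∑-cong xs (λ x → trans (∑-cong ys λ y → trans (*-assoc ⟦ g x ≟B y ⟧ (h x) (ψ y)) (cong (_* (h x * ψ y)) (⟦≟⟧-sym _≟B_ (g x) y)))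
                              (∑-⟦≟⟧ _≟B_ ys (g x) (once (g x)) (λ y → h x * ψ y))) ⟩
  ∑ xs (λ x → h x * ψ (g x)) ∎
  where open ≡-Reasoning

∑Fin-fibre : ∀ {A : Set} {n} (xs : List A) (g : A → Fin n) (h : A → ℕ) (ψ : Fin n → ℕ) →
             ∑ (allFin n) (λ y → ∑ xs (λ x → ⟦ g x Fin.≟ y ⟧ * h x) * ψ y) ≡ ∑ xs (λ x → h x * ψ (g x))
∑Fin-fibre {n = n} = ∑-fibre Fin._≟_ (allFin n) ∑Fin-once

∑Fin-↑ : ∀ a b (f : Fin (a + b) → ℕ) →
         ∑ (allFin (a + b)) f ≡ ∑ (allFin a) (λ i → f (i ↑ˡ b)) + ∑ (allFin b) (λ i → f (a ↑ʳ i))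
∑Fin-↑ zero    b f = refl
∑Fin-↑ (suc a) b f = begin
  ∑ (allFin (suc (a + b))) f
    ≡⟨ ∑Fin-suc (a + b) f ⟩
  f zero + ∑ (allFin (a + b)) (f ∘ suc)
    ≡⟨ cong (f zero +_) (∑Fin-↑ a b (f ∘ suc)) ⟩
  f zero + (∑ (allFin a) (λ i → f (suc i ↑ˡ b)) + ∑ (allFin b) (λ i → f (suc a ↑ʳ i)))
    ≡⟨ +-assoc (f zero) _ _ ⟨
  f zero + ∑ (allFin a) (λ i → f (suc i ↑ˡ b)) + ∑ (allFin b) (λ i → f (suc a ↑ʳ i))
    ≡⟨ cong (_+ ∑ (allFin b) (λ i → f (suc a ↑ʳ i))) (∑Fin-suc a (λ i → f (i ↑ˡ b))) ⟨
  ∑ (allFin (suc a)) (λ i → f (i ↑ˡ b)) + ∑ (allFin b) (λ i → f (suc a ↑ʳ i)) ∎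
  where open ≡-Reasoning

module ℕRounding {V : Set} (_≟V_ : DecidableEquality V) where
  open Flow _≟V_
  open Rounding _≟V_

  flux : ∀ {N} → (Fin N → V) → (Fin N → ℕ) → (V → ℕ) → ℕ
  flux {N} s x φ = ∑ (allFin N) (λ i → x i * φ (s i))

  net-pos : ∀ {N} (s t : Fin N → V) (x : Fin N → ℕ) (φ : V → ℕ) →
            net s t (λ i → ℤ.+ x i) (λ v → ℤ.+ φ v) ℤ.+ ℤ.+ flux t x φ ≡ ℤ.+ flux s x φ
  net-pos {N} s t x φ = begin
    net s t (λ i → ℤ.+ x i) (λ v → ℤ.+ φ v) ℤ.+ ℤ.+ flux t x φ
      ≡⟨ cong (ℤ._+_ (net s t (λ i → ℤ.+ x i) (λ v → ℤ.+ φ v))) (∑ℤ-pos {N} (λ i → x i * φ (t i))) ⟨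
    net s t (λ i → ℤ.+ x i) (λ v → ℤ.+ φ v) ℤ.+ ∑ℤ {N} (λ i → ℤ.+ (x i * φ (t i)))
      ≡⟨ ∑ℤ-+ {N} _ _ ⟨
    ∑ℤ {N} (λ i → ℤ.+ x i ℤ.* (ℤ.+ φ (s i) ℤ.- ℤ.+ φ (t i)) ℤ.+ ℤ.+ (x i * φ (t i)))
      ≡⟨ ∑ℤ-cong {N} (λ i → trans (cong (ℤ._+_ (ℤ.+ x i ℤ.* (ℤ.+ φ (s i) ℤ.- ℤ.+ φ (t i)))) (ℤₚ.pos-* (x i) (φ (t i))))
                          (trans (lemma (ℤ.+ x i) (ℤ.+ φ (s i)) (ℤ.+ φ (t i))) (sym (ℤₚ.pos-* (x i) (φ (s i)))))) ⟩
    ∑ℤ {N} (λ i → ℤ.+ (x i * φ (s i)))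
      ≡⟨ ∑ℤ-pos {N} (λ i → x i * φ (s i)) ⟩
    ℤ.+ flux s x φ ∎
    where
    open ≡-Reasoning
    lemma : ∀ x a b → x ℤ.* (a ℤ.- b) ℤ.+ x ℤ.* b ≡ x ℤ.* a
    lemma = ℤ-Ring.solve-∀

  pos neg : ℤ → ℕ
  pos (ℤ.+ n)  = n
  pos -[1+ n ] = 0
  neg (ℤ.+ n)  = 0
  neg -[1+ n ] = suc n

  pos-neg : ∀ i → i ≡ ℤ.+ pos i ℤ.- ℤ.+ neg i
  pos-neg (ℤ.+ n)  = sym (ℤₚ.+-identityʳ (ℤ.+ n))
  pos-neg -[1+ n ] = refl

  net-pos-neg : ∀ {N} (s t : Fin N → V) x φ →
                net s t x φ ≡ net s t x (λ v → ℤ.+ pos (φ v)) ℤ.+ ℤ.-1ℤ ℤ.* net s t x (λ v → ℤ.+ neg (φ v))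
  net-pos-neg {N} s t x φ = begin
    net s t x φ
      ≡⟨ ∑ℤ-cong {N} (λ i → trans (cong₂ (λ a b → x i ℤ.* (a ℤ.- b)) (pos-neg (φ (s i))) (pos-neg (φ (t i))))
                              (lemma (x i) (ℤ.+ pos (φ (s i))) (ℤ.+ neg (φ (s i))) (ℤ.+ pos (φ (t i))) (ℤ.+ neg (φ (t i))))) ⟩
    ∑ℤ {N} (λ i → x i ℤ.* (ℤ.+ pos (φ (s i)) ℤ.- ℤ.+ pos (φ (t i))) ℤ.+ ℤ.-1ℤ ℤ.* (x i ℤ.* (ℤ.+ neg (φ (s i)) ℤ.- ℤ.+ neg (φ (t i)))))
      ≡⟨ ∑ℤ-+ {N} _ _ ⟩
    net s t x (λ v → ℤ.+ pos (φ v)) ℤ.+ ∑ℤ {N} (λ i → ℤ.-1ℤ ℤ.* (x i ℤ.* (ℤ.+ neg (φ (s i)) ℤ.- ℤ.+ neg (φ (t i)))))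
      ≡⟨ cong (ℤ._+_ (net s t x (λ v → ℤ.+ pos (φ v)))) (∑ℤ-*ˡ {N} ℤ.-1ℤ _) ⟩
    net s t x (λ v → ℤ.+ pos (φ v)) ℤ.+ ℤ.-1ℤ ℤ.* net s t x (λ v → ℤ.+ neg (φ v)) ∎
    where
    open ≡-Reasoning
    lemma : ∀ x a b c d → x ℤ.* ((a ℤ.- b) ℤ.- (c ℤ.- d)) ≡ x ℤ.* (a ℤ.- c) ℤ.+ ℤ.-1ℤ ℤ.* (x ℤ.* (b ℤ.- d))
    lemma = ℤ-Ring.solve-∀

  roundℕ : ∀ {N} (s t : Fin N → V) P (x : Fin N → ℕ) → 0 < P →
           (∀ φ → ∃[ a ] ∃[ b ] (flux s x φ + P * a ≡ flux t x φ + P * b)) →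
           Σ (Fin N → ℕ) λ z → (∀ i → Rounds P (x i) (z i)) ×
                               (∀ φ → P * flux s z φ + flux t x φ ≡ P * flux t z φ + flux s x φ)
  roundℕ s t P x P>0 balanced = z , proj₁ (proj₂ rounded) , conserved
    where
    P∣net⁺ : ∀ φ → ℤ.+ P ℤ∣.∣ net s t (λ i → ℤ.+ x i) (λ v → ℤ.+ φ v)
    P∣net⁺ φ with balanced φ
    ... | a , b , eq = ℤ∣.divides (ℤ.+ b ℤ.- ℤ.+ a) (begin
      n                                      ≡⟨ lemma₁ n T (ℤ.+ P) (ℤ.+ a) ⟩
      (n ℤ.+ T ℤ.+ ℤ.+ P ℤ.* ℤ.+ a) ℤ.- T ℤ.- ℤ.+ P ℤ.* ℤ.+ a
        ≡⟨ cong (λ z → z ℤ.- T ℤ.- ℤ.+ P ℤ.* ℤ.+ a) (trans (cong₂ ℤ._+_ (net-pos s t x φ) (sym (ℤₚ.pos-* P a)))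
             (trans (cong ℤ.+_ eq) (cong (ℤ._+_ T) (ℤₚ.pos-* P b)))) ⟩
      (T ℤ.+ ℤ.+ P ℤ.* ℤ.+ b) ℤ.- T ℤ.- ℤ.+ P ℤ.* ℤ.+ a
        ≡⟨ lemma₂ T (ℤ.+ P) (ℤ.+ a) (ℤ.+ b) ⟩
      (ℤ.+ b ℤ.- ℤ.+ a) ℤ.* ℤ.+ P            ∎)
      where
      open ≡-Reasoning
      n T : ℤ
      n = net s t (λ i → ℤ.+ x i) (λ v → ℤ.+ φ v)
      T = ℤ.+ flux t x φ
      lemma₁ : ∀ n T p a → n ≡ (n ℤ.+ T ℤ.+ p ℤ.* a) ℤ.- T ℤ.- p ℤ.* a
      lemma₁ = ℤ-Ring.solve-∀
      lemma₂ : ∀ T p a b → (T ℤ.+ p ℤ.* b) ℤ.- T ℤ.- p ℤ.* a ≡ (b ℤ.- a) ℤ.* p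
      lemma₂ = ℤ-Ring.solve-∀
    rounded : Rounded s t P x
    rounded = round s t P x P>0 λ φ → subst (ℤ.+ P ℤ∣.∣_) (sym (net-pos-neg s t (λ i → ℤ.+ x i) φ))
      (ℤ∣.∣m∣n⇒∣m+n (P∣net⁺ (pos ∘ φ)) (ℤ∣.∣n⇒∣m*n ℤ.-1ℤ (P∣net⁺ (neg ∘ φ))))
    z : Fin _ → ℕ
    z = proj₁ rounded
    conserved : ∀ φ → P * flux s z φ + flux t x φ ≡ P * flux t z φ + flux s x φ
    conserved φ = ℤₚ.+-injective (begin
      ℤ.+ (P * flux s z φ) ℤ.+ Tx            ≡⟨ cong (ℤ._+ Tx) (trans (ℤₚ.pos-* P _) (cong (ℤ._*_ (ℤ.+ P)) (sym (net-pos s t z φ)))) ⟩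
      ℤ.+ P ℤ.* (nz ℤ.+ Tz) ℤ.+ Tx           ≡⟨ lemma (ℤ.+ P) nz Tz Tx ⟩
      ℤ.+ P ℤ.* Tz ℤ.+ (ℤ.+ P ℤ.* nz ℤ.+ Tx) ≡⟨ cong₂ ℤ._+_ (sym (ℤₚ.pos-* P _)) (trans (cong (ℤ._+ Tx) (proj₂ (proj₂ rounded) (λ v → ℤ.+ φ v))) (net-pos s t x φ)) ⟩
      ℤ.+ (P * flux t z φ) ℤ.+ ℤ.+ flux s x φ ∎)
      where
      open ≡-Reasoning
      nz Tz Tx : ℤ
      nz = net s t (λ i → ℤ.+ z i) (λ v → ℤ.+ φ v)
      Tz = ℤ.+ flux t z φ
      Tx = ℤ.+ flux t x φ
      lemma : ∀ p n a b → p ℤ.* (n ℤ.+ a) ℤ.+ b ≡ p ℤ.* a ℤ.+ (p ℤ.* n ℤ.+ b)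
      lemma = ℤ-Ring.solve-∀

record Selection {q M W k : ℕ} (X : Fin M → Subset q) (lab : Fin M → Fin W) (colL : Fin W → Fin k) (mark : Fin W → Bool)
                 (t : Fin M → ℕ) (P r : ℕ) (R : Subset q → ℕ) : Set where
  field
    z      : Fin M → ℕ
    near   : ∀ e → Rounds P (t e) (z e)
    rows   : ∀ S → ∑ (allFin M) (λ e → ⟦ X e ≟S S ⟧ * z e) ≡ R S
    cols   : ∀ j → ∑ (allFin M) (λ e → ⟦ colL (lab e) Fin.≟ j ⟧ * z e) ≡ r
    groups : ∀ C → Rounds P (∑ (allFin M) (λ e → ⟦ lab e Fin.≟ C ⟧ * t e)) (∑ (allFin M) (λ e → ⟦ lab e Fin.≟ C ⟧ * z e))
    marked : ∀ j → Rounds P (∑ (allFin M) (λ e → ⟦ colL (lab e) Fin.≟ j ⟧ * (𝟙 (mark (lab e)) * t e)))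
                            (∑ (allFin M) (λ e → ⟦ colL (lab e) Fin.≟ j ⟧ * (𝟙 (mark (lab e)) * z e)))

-- The flow network: every e is an arc from its row to its group; groups are joined to
-- their colour, the marked ones through one extra node per colour.
module Select {q M W k : ℕ} (X : Fin M → Subset q) (lab : Fin M → Fin W) (colL : Fin W → Fin k) (mark : Fin W → Bool)
              (t : Fin M → ℕ) (P r : ℕ) (R : Subset q → ℕ) where

  data Node : Set where
    row       : Subset q → Node
    group     : Fin W → Node
    hub       : Fin k → Node
    colour    : Fin k → Node

  _≟N_ : DecidableEquality Node
  row S    ≟N row T    = Dec.map′ (cong row) (λ { refl → refl }) (S ≟S T)
  row S    ≟N group _  = no λ ()
  row S    ≟N hub _    = no λ ()
  row S    ≟N colour _ = no λ ()
  group _  ≟N row _    = no λ ()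
  group C  ≟N group D  = Dec.map′ (cong group) (λ { refl → refl }) (C Fin.≟ D)
  group _  ≟N hub _    = no λ ()
  group _  ≟N colour _ = no λ ()
  hub _    ≟N row _    = no λ ()
  hub _    ≟N group _  = no λ ()
  hub i    ≟N hub j    = Dec.map′ (cong hub) (λ { refl → refl }) (i Fin.≟ j)
  hub _    ≟N colour _ = no λ ()
  colour _ ≟N row _    = no λ ()
  colour _ ≟N group _  = no λ ()
  colour _ ≟N hub _    = no λ ()
  colour i ≟N colour j = Dec.map′ (cong colour) (λ { refl → refl }) (i Fin.≟ j)

  open ℕRounding _≟N_

  col : Fin M → Fin k
  col e = colL (lab e)

  es : List (Fin M)
  es = allFin M

  D : (Fin M → ℕ) → Fin W → ℕ
  D x C = ∑ es (λ e → ⟦ lab e Fin.≟ C ⟧ * x e)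

  H : (Fin M → ℕ) → Fin k → ℕ
  H x j = ∑ es (λ e → ⟦ col e Fin.≟ j ⟧ * (𝟙 (mark (lab e)) * x e))

  parent : Fin W → Node
  parent C with mark C
  ... | true  = hub (colL C)
  ... | false = colour (colL C)

  arc : {A : Set} → (Fin M → A) → (Fin W → A) → (Fin k → A) → Fin (M + (W + k)) → A
  arc f g h i = [ f , (λ c → [ g , h ]′ (splitAt W c)) ]′ (splitAt M i)

  iM : Fin M → Fin (M + (W + k))
  iM e = e ↑ˡ (W + k)
  iW : Fin W → Fin (M + (W + k))
  iW C = M ↑ʳ (C ↑ˡ k)
  ik : Fin k → Fin (M + (W + k))
  ik j = M ↑ʳ (W ↑ʳ j)

  arc-M : ∀ {A : Set} (f : Fin M → A) g h e → arc f g h (iM e) ≡ f e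
  arc-M f g h e = cong [ f , (λ c → [ g , h ]′ (splitAt W c)) ]′ (Finₚ.splitAt-↑ˡ M e (W + k))
  arc-W : ∀ {A : Set} (f : Fin M → A) g h C → arc f g h (iW C) ≡ g C
  arc-W f g h C = trans (cong [ f , (λ c → [ g , h ]′ (splitAt W c)) ]′ (Finₚ.splitAt-↑ʳ M (W + k) (C ↑ˡ k))) (cong [ g , h ]′ (Finₚ.splitAt-↑ˡ W C k))
  arc-k : ∀ {A : Set} (f : Fin M → A) g h j → arc f g h (ik j) ≡ h j
  arc-k f g h j = trans (cong [ f , (λ c → [ g , h ]′ (splitAt W c)) ]′ (Finₚ.splitAt-↑ʳ M (W + k) (W ↑ʳ j))) (cong [ g , h ]′ (Finₚ.splitAt-↑ʳ W k j))

  flux-arc : ∀ (w : Fin (M + (W + k)) → ℕ) f g h φ (α : Fin M → ℕ) (β : Fin W → ℕ) (γ : Fin k → ℕ) →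
             (∀ e → φ (f e) ≡ α e) → (∀ C → φ (g C) ≡ β C) → (∀ j → φ (h j) ≡ γ j) →
             flux (arc f g h) w φ ≡ ∑ es (λ e → w (iM e) * α e) + (∑ (allFin W) (λ C → w (iW C) * β C) + ∑ (allFin k) (λ j → w (ik j) * γ j))
  flux-arc w f g h φ α β γ α≡ β≡ γ≡ = trans (∑Fin-↑ M (W + k) F) (cong₂ _+_
    (∑-cong es λ e → cong (w (iM e) *_) (trans (cong φ (arc-M f g h e)) (α≡ e)))
    (trans (∑Fin-↑ W k (λ c → F (M ↑ʳ c))) (cong₂ _+_
      (∑-cong (allFin W) λ C → cong (w (iW C) *_) (trans (cong φ (arc-W f g h C)) (β≡ C)))
      (∑-cong (allFin k) λ j → cong (w (ik j) *_) (trans (cong φ (arc-k f g h j)) (γ≡ j))))))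
    where
    F : Fin (M + (W + k)) → ℕ
    F i = w i * φ (arc f g h i)

  s′ t′ : Fin (M + (W + k)) → Node
  s′ = arc (row ∘ X) group hub
  t′ = arc (group ∘ lab) parent colour

  x : Fin (M + (W + k)) → ℕ
  x = arc t (D t) (H t)

  flux-x : ∀ f g h φ → flux (arc f g h) x φ ≡ ∑ es (λ e → t e * φ (f e)) + (∑ (allFin W) (λ C → D t C * φ (g C)) + ∑ (allFin k) (λ j → H t j * φ (h j)))
  flux-x f g h φ = trans (flux-arc x f g h φ (φ ∘ f) (φ ∘ g) (φ ∘ h) (λ _ → refl) (λ _ → refl) (λ _ → refl)) (cong₂ _+_
    (∑-cong es λ e → cong (_* φ (f e)) (arc-M t (D t) (H t) e)) (cong₂ _+_
    (∑-cong (allFin W) λ C → cong (_* φ (g C)) (arc-W t (D t) (H t) C))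
    (∑-cong (allFin k) λ j → cong (_* φ (h j)) (arc-k t (D t) (H t) j))))

  flux-D : ∀ y (ψ : Fin W → ℕ) → ∑ (allFin W) (λ C → D y C * ψ C) ≡ ∑ es (λ e → y e * ψ (lab e))
  flux-D y ψ = ∑Fin-fibre es lab y ψ

  flux-H : ∀ y (ψ : Fin k → ℕ) → ∑ (allFin k) (λ j → H y j * ψ j) ≡ ∑ es (λ e → 𝟙 (mark (lab e)) * y e * ψ (col e))
  flux-H y ψ = ∑Fin-fibre es col (λ e → 𝟙 (mark (lab e)) * y e) ψ

  flux-s : ∀ φ → flux s′ x φ ≡ ∑ es (λ e → t e * φ (row (X e)) + (t e * φ (group (lab e)) + 𝟙 (mark (lab e)) * t e * φ (hub (col e))))
  flux-s φ = trans (flux-x (row ∘ X) group hub φ)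
    (trans (cong (∑ es (λ e → t e * φ (row (X e))) +_) (trans (cong₂ _+_ (flux-D t (φ ∘ group)) (flux-H t (φ ∘ hub))) (sym (∑-+ es _ _))))
           (sym (∑-+ es _ _)))

  flux-t : ∀ φ → flux t′ x φ ≡ ∑ es (λ e → t e * φ (group (lab e)) + (t e * φ (parent (lab e)) + 𝟙 (mark (lab e)) * t e * φ (colour (col e))))
  flux-t φ = trans (flux-x (group ∘ lab) parent colour φ)
    (trans (cong (∑ es (λ e → t e * φ (group (lab e))) +_) (trans (cong₂ _+_ (flux-D t (φ ∘ parent)) (flux-H t (φ ∘ colour))) (sym (∑-+ es _ _))))
           (sym (∑-+ es _ _)))

  selection : 0 < P → (∀ S → ∑ es (λ e → ⟦ X e ≟S S ⟧ * t e) ≡ P * R S) → (∀ j → ∑ es (λ e → ⟦ col e Fin.≟ j ⟧ * t e) ≡ P * r) →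
              (y : Fin (M + (W + k)) → ℕ) → (∀ i → Rounds P (x i) (y i)) →
              (∀ φ → P * flux s′ y φ + flux t′ x φ ≡ P * flux t′ y φ + flux s′ x φ) → Selection X lab colL mark t P r R
  selection P>0 rows-t cols-t y rounds conserved = record
    { z      = z
    ; near   = λ e → subst (λ a → Rounds P a (z e)) (x≡t e) (rounds (iM e))
    ; rows   = λ S → *-cancelˡ-≡ _ _ P (trans (rows-z S) (rows-t S))
    ; cols   = λ j → *-cancelˡ-≡ _ _ P (trans (cols-z j) (cols-t j))
    ; groups = λ C → subst₂ (Rounds P) (x≡D C) (*-cancelˡ-≡ _ _ P (groups-z C)) (rounds (iW C))
    ; marked = λ j → subst₂ (Rounds P) (x≡H j) (*-cancelˡ-≡ _ _ P (marked-z j)) (rounds (ik j))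
    }
    where
    instance
      P≢0 : NonZero P
      P≢0 = >-nonZero P>0
    z : Fin M → ℕ
    z e = y (iM e)
    ∑*0 : ∀ {A : Set} (xs : List A) (f : A → ℕ) → ∑ xs (λ a → f a * 0) ≡ 0
    ∑*0 xs f = trans (∑-cong xs λ a → *-zeroʳ (f a)) (∑-zero xs)
    ∑-at : ∀ {n} (f : Fin n → ℕ) a → ∑ (allFin n) (λ i → f i * ⟦ i Fin.≟ a ⟧) ≡ f a
    ∑-at {n} f a = trans (∑-cong (allFin n) λ i → *-comm (f i) _) (∑Fin-⟦≟⟧ a f)
    x≡D : ∀ C → x (iW C) ≡ D t C
    x≡D C = arc-W t (D t) (H t) C
    x≡H : ∀ j → x (ik j) ≡ H t j
    x≡H j = arc-k t (D t) (H t) j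
    x≡t : ∀ e → x (iM e) ≡ t e
    x≡t e = arc-M t (D t) (H t) e

    rows-z : ∀ S → P * ∑ es (λ e → ⟦ X e ≟S S ⟧ * z e) ≡ ∑ es (λ e → ⟦ X e ≟S S ⟧ * t e)
    rows-z S = begin
      P * ∑ es (λ e → ⟦ X e ≟S S ⟧ * z e)    ≡⟨ cong (P *_) (∑-cong es λ e → *-comm ⟦ X e ≟S S ⟧ (z e)) ⟩
      P * ∑ es (λ e → z e * ⟦ X e ≟S S ⟧)    ≡⟨ cong (P *_) (out y) ⟨
      P * flux s′ y φ                        ≡⟨ +-identityʳ _ ⟨
      P * flux s′ y φ + 0                    ≡⟨ cong (P * flux s′ y φ +_) (into x) ⟨
      P * flux s′ y φ + flux t′ x φ          ≡⟨ conserved φ ⟩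
      P * flux t′ y φ + flux s′ x φ          ≡⟨ cong₂ _+_ (trans (cong (P *_) (into y)) (*-zeroʳ P)) (out x) ⟩
      ∑ es (λ e → x (iM e) * ⟦ X e ≟S S ⟧)   ≡⟨ ∑-cong es (λ e → trans (cong (_* ⟦ X e ≟S S ⟧) (x≡t e)) (*-comm (t e) _)) ⟩
      ∑ es (λ e → ⟦ X e ≟S S ⟧ * t e)        ∎
      where
      open ≡-Reasoning
      φ : Node → ℕ
      φ (row T) = ⟦ T ≟S S ⟧
      φ _       = 0
      φ-parent : ∀ C → φ (parent C) ≡ 0
      φ-parent C with mark C
      ... | true  = refl
      ... | false = refl
      out : ∀ w → flux s′ w φ ≡ ∑ es (λ e → w (iM e) * ⟦ X e ≟S S ⟧)
      out w = trans (flux-arc w (row ∘ X) group hub φ (λ e → ⟦ X e ≟S S ⟧) (λ _ → 0) (λ _ → 0) (λ _ → refl) (λ _ → refl) (λ _ → refl))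
        (trans (cong (∑ es (λ e → w (iM e) * ⟦ X e ≟S S ⟧) +_) (cong₂ _+_ (∑*0 (allFin W) (w ∘ iW)) (∑*0 (allFin k) (w ∘ ik)))) (+-identityʳ _))
      into : ∀ w → flux t′ w φ ≡ 0
      into w = trans (flux-arc w (group ∘ lab) parent colour φ (λ _ → 0) (λ _ → 0) (λ _ → 0) (λ _ → refl) φ-parent (λ _ → refl))
        (cong₂ _+_ (∑*0 es (w ∘ iM)) (cong₂ _+_ (∑*0 (allFin W) (w ∘ iW)) (∑*0 (allFin k) (w ∘ ik))))

    groups-z : ∀ C → P * y (iW C) ≡ P * D z C
    groups-z C = +-cancelʳ-≡ (D t C) _ _ (begin
      P * y (iW C) + D t C                   ≡⟨ cong₂ (λ a b → P * a + b) (out y) (trans (into x) (∑-cong es λ e → trans (*-comm (x (iM e)) _) (cong (⟦ lab e Fin.≟ C ⟧ *_) (x≡t e)))) ⟨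
      P * flux s′ y φ + flux t′ x φ          ≡⟨ conserved φ ⟩
      P * flux t′ y φ + flux s′ x φ          ≡⟨ cong₂ (λ a b → P * a + b) (trans (into y) (∑-cong es λ e → *-comm (z e) _)) (trans (out x) (x≡D C)) ⟩
      P * D z C + D t C                      ∎)
      where
      open ≡-Reasoning
      φ : Node → ℕ
      φ (group E) = ⟦ E Fin.≟ C ⟧
      φ _         = 0
      φ-parent : ∀ C → φ (parent C) ≡ 0
      φ-parent C with mark C
      ... | true  = refl
      ... | false = refl
      out : ∀ w → flux s′ w φ ≡ w (iW C)
      out w = trans (flux-arc w (row ∘ X) group hub φ (λ _ → 0) (λ E → ⟦ E Fin.≟ C ⟧) (λ _ → 0) (λ _ → refl) (λ _ → refl) (λ _ → refl))
        (trans (cong₂ _+_ (∑*0 es (w ∘ iM)) (cong₂ _+_ (∑-at (w ∘ iW) C) (∑*0 (allFin k) (w ∘ ik)))) (+-identityʳ _))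
      into : ∀ w → flux t′ w φ ≡ ∑ es (λ e → w (iM e) * ⟦ lab e Fin.≟ C ⟧)
      into w = trans (flux-arc w (group ∘ lab) parent colour φ (λ e → ⟦ lab e Fin.≟ C ⟧) (λ _ → 0) (λ _ → 0) (λ _ → refl) φ-parent (λ _ → refl))
        (trans (cong (∑ es (λ e → w (iM e) * ⟦ lab e Fin.≟ C ⟧) +_) (cong₂ _+_ (∑*0 (allFin W) (w ∘ iW)) (∑*0 (allFin k) (w ∘ ik)))) (+-identityʳ _))

    marked-z : ∀ j → P * y (ik j) ≡ P * H z j
    marked-z j = cancel (P * y (ik j)) (P * H z j) (H t j) (P * A y) (A x) (begin
      P * y (ik j) + (P * A y + (H t j + A x))  ≡⟨ regroup P (y (ik j)) (A y) (H t j + A x) ⟩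
      P * (A y + y (ik j)) + (H t j + A x)   ≡⟨ cong₂ (λ a b → P * a + b) (out y) (trans (into x) (cong (_+ A x) (∑-cong es λ e → trans (cong (_* (𝟙 (mark (lab e)) * ⟦ col e Fin.≟ j ⟧)) (x≡t e)) (perm (t e) (𝟙 (mark (lab e))) ⟦ col e Fin.≟ j ⟧)))) ⟨
      P * flux s′ y φ + flux t′ x φ          ≡⟨ conserved φ ⟩
      P * flux t′ y φ + flux s′ x φ          ≡⟨ cong₂ (λ a b → P * a + b) (trans (into y) (cong (_+ A y) (∑-cong es λ e → perm (z e) (𝟙 (mark (lab e))) ⟦ col e Fin.≟ j ⟧))) (trans (out x) (cong (A x +_) (x≡H j))) ⟩
      P * (H z j + A y) + (A x + H t j)      ≡⟨ regroup′ P (H z j) (A y) (A x) (H t j) ⟩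
      P * H z j + (P * A y + (H t j + A x))  ∎)
      where
      open ≡-Reasoning
      β : Fin W → ℕ
      β C = 𝟙 (mark C) * ⟦ colL C Fin.≟ j ⟧
      A : (Fin (M + (W + k)) → ℕ) → ℕ
      A w = ∑ (allFin W) (λ C → w (iW C) * β C)
      φ : Node → ℕ
      φ (row _)    = 0
      φ (group C)  = β C
      φ (hub i)    = ⟦ i Fin.≟ j ⟧
      φ (colour _) = 0
      perm : ∀ a b c → a * (b * c) ≡ c * (b * a)
      perm = solve-∀
      regroup : ∀ p y a h → p * y + (p * a + h) ≡ p * (a + y) + h
      regroup = solve-∀
      regroup′ : ∀ p h a x t → p * (h + a) + (x + t) ≡ p * h + (p * a + (t + x))
      regroup′ = solve-∀
      cancel : ∀ a b t c x → a + (c + (t + x)) ≡ b + (c + (t + x)) → a ≡ b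
      cancel a b t c x = +-cancelʳ-≡ (c + (t + x)) a b
      φ-parent : ∀ C → φ (parent C) ≡ β C
      φ-parent C with mark C
      ... | true  = sym (*-identityˡ _)
      ... | false = refl
      out : ∀ w → flux s′ w φ ≡ A w + w (ik j)
      out w = trans (flux-arc w (row ∘ X) group hub φ (λ _ → 0) β (λ i → ⟦ i Fin.≟ j ⟧) (λ _ → refl) (λ _ → refl) (λ _ → refl))
        (cong₂ _+_ (∑*0 es (w ∘ iM)) (cong (A w +_) (∑-at (w ∘ ik) j)))
      into : ∀ w → flux t′ w φ ≡ ∑ es (λ e → w (iM e) * (𝟙 (mark (lab e)) * ⟦ col e Fin.≟ j ⟧)) + A w
      into w = trans (flux-arc w (group ∘ lab) parent colour φ (λ e → 𝟙 (mark (lab e)) * ⟦ col e Fin.≟ j ⟧) β (λ _ → 0) (λ _ → refl) φ-parent (λ _ → refl))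
        (cong (∑ es (λ e → w (iM e) * (𝟙 (mark (lab e)) * ⟦ col e Fin.≟ j ⟧)) +_) (trans (cong (A w +_) (∑*0 (allFin k) (w ∘ ik))) (+-identityʳ _)))

    cols-z : ∀ j → P * ∑ es (λ e → ⟦ col e Fin.≟ j ⟧ * z e) ≡ ∑ es (λ e → ⟦ col e Fin.≟ j ⟧ * t e)
    cols-z j = sym (+-cancelʳ-≡ (P * B y + B x) _ _ (begin
      T t + (P * B y + B x)                  ≡⟨ regroup (T t) (P * B y) (B x) ⟩
      P * B y + (T t + B x)                  ≡⟨ cong₂ (λ a b → P * a + b) (out y) (trans (into x) (cong (_+ B x) (∑-cong es λ e → trans (cong (_* ⟦ col e Fin.≟ j ⟧) (x≡t e)) (*-comm (t e) _)))) ⟨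
      P * flux s′ y φ + flux t′ x φ          ≡⟨ conserved φ ⟩
      P * flux t′ y φ + flux s′ x φ          ≡⟨ cong₂ (λ a b → P * a + b) (trans (into y) (cong (_+ B y) (∑-cong es λ e → *-comm (z e) _))) (out x) ⟩
      P * (T z + B y) + B x                  ≡⟨ regroup′ P (T z) (B y) (B x) ⟩
      P * T z + (P * B y + B x)              ∎))
      where
      open ≡-Reasoning
      T : (Fin M → ℕ) → ℕ
      T w = ∑ es (λ e → ⟦ col e Fin.≟ j ⟧ * w e)
      B : (Fin (M + (W + k)) → ℕ) → ℕ
      B w = ∑ (allFin W) (λ C → w (iW C) * ⟦ colL C Fin.≟ j ⟧) + w (ik j)
      φ : Node → ℕ
      φ (row _)    = 0
      φ (group C)  = ⟦ colL C Fin.≟ j ⟧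
      φ (hub i)    = ⟦ i Fin.≟ j ⟧
      φ (colour i) = ⟦ i Fin.≟ j ⟧
      regroup : ∀ t b x → t + (b + x) ≡ b + (t + x)
      regroup = solve-∀
      regroup′ : ∀ p t b x → p * (t + b) + x ≡ p * t + (p * b + x)
      regroup′ = solve-∀
      φ-parent : ∀ C → φ (parent C) ≡ ⟦ colL C Fin.≟ j ⟧
      φ-parent C with mark C
      ... | true  = refl
      ... | false = refl
      out : ∀ w → flux s′ w φ ≡ B w
      out w = trans (flux-arc w (row ∘ X) group hub φ (λ _ → 0) (λ C → ⟦ colL C Fin.≟ j ⟧) (λ i → ⟦ i Fin.≟ j ⟧) (λ _ → refl) (λ _ → refl) (λ _ → refl))
        (cong₂ _+_ (∑*0 es (w ∘ iM)) (cong (∑ (allFin W) (λ C → w (iW C) * ⟦ colL C Fin.≟ j ⟧) +_) (∑-at (w ∘ ik) j)))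
      into : ∀ w → flux t′ w φ ≡ ∑ es (λ e → w (iM e) * ⟦ col e Fin.≟ j ⟧) + B w
      into w = trans (flux-arc w (group ∘ lab) parent colour φ (λ e → ⟦ col e Fin.≟ j ⟧) (λ C → ⟦ colL C Fin.≟ j ⟧) (λ i → ⟦ i Fin.≟ j ⟧) (λ _ → refl) φ-parent (λ _ → refl))
        (cong (∑ es (λ e → w (iM e) * ⟦ col e Fin.≟ j ⟧) +_) (cong (∑ (allFin W) (λ C → w (iW C) * ⟦ colL C Fin.≟ j ⟧) +_) (∑-at (w ∘ ik) j)))

  select : 0 < P → (∀ S → ∑ es (λ e → ⟦ X e ≟S S ⟧ * t e) ≡ P * R S) → (∀ j → ∑ es (λ e → ⟦ col e Fin.≟ j ⟧ * t e) ≡ P * r) →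
           Selection X lab colL mark t P r R
  select P>0 rows-t cols-t = selection P>0 rows-t cols-t (proj₁ rounded) (proj₁ (proj₂ rounded)) (proj₂ (proj₂ rounded))
    where
    ∑-row : ∀ (ψ : Subset q → ℕ) → ∑ es (λ e → t e * ψ (X e)) ≡ P * ∑ (allSubsets q) (λ S → R S * ψ S)
    ∑-row ψ = trans (sym (∑-fibre _≟S_ (allSubsets q) ∑Subsets-once es X t ψ))
      (trans (∑-cong (allSubsets q) λ S → trans (cong (_* ψ S) (rows-t S)) (*-assoc P (R S) (ψ S))) (∑-*ˡ (allSubsets q) P _))
    ∑-colour : ∀ (ψ : Fin k → ℕ) → ∑ es (λ e → t e * ψ (col e)) ≡ P * ∑ (allFin k) (λ j → r * ψ j)
    ∑-colour ψ = trans (sym (∑Fin-fibre es col t ψ))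
      (trans (∑-cong (allFin k) λ j → trans (cong (_* ψ j) (cols-t j)) (*-assoc P r (ψ j))) (∑-*ˡ (allFin k) P _))
    balanced : ∀ φ → ∃[ a ] ∃[ b ] (flux s′ x φ + P * a ≡ flux t′ x φ + P * b)
    balanced φ = ∑ (allFin k) (λ j → r * φ (colour j)) , ∑ (allSubsets q) (λ S → R S * φ (row S)) ,
      trans (cong₂ _+_ (flux-s φ) (sym (∑-colour (φ ∘ colour))))
        (trans (sym (∑-+ es _ _)) (trans (∑-cong es termwise) (trans (∑-+ es _ _) (cong₂ _+_ (sym (flux-t φ)) (∑-row (φ ∘ row))))))
      where
      termwise : ∀ e → t e * φ (row (X e)) + (t e * φ (group (lab e)) + 𝟙 (mark (lab e)) * t e * φ (hub (col e))) + t e * φ (colour (col e)) ≡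
                       t e * φ (group (lab e)) + (t e * φ (parent (lab e)) + 𝟙 (mark (lab e)) * t e * φ (colour (col e))) + t e * φ (row (X e))
      termwise e with mark (lab e)
      ... | true  = lemma (t e) (φ (row (X e))) (φ (group (lab e))) (φ (hub (col e))) (φ (colour (col e)))
        where
        lemma : ∀ t a b c d → t * a + (t * b + 1 * t * c) + t * d ≡ t * b + (t * c + 1 * t * d) + t * a
        lemma = solve-∀
      ... | false = lemma (t e) (φ (row (X e))) (φ (group (lab e))) (φ (hub (col e))) (φ (colour (col e)))
        where
        lemma : ∀ t a b c d → t * a + (t * b + 0 * t * c) + t * d ≡ t * b + (t * d + 0 * t * d) + t * a
        lemma = solve-∀
    rounded : Σ (Fin (M + (W + k)) → ℕ) λ y → (∀ i → Rounds P (x i) (y i)) × (∀ φ → P * flux s′ y φ + flux t′ x φ ≡ P * flux t′ y φ + flux s′ x φ)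
    rounded = roundℕ s′ t′ P x P>0 balanced

-- Binomial coefficients

-- Made abstract because the definition of Comb._C_ unfolds badly during unification.
abstract
  _choose_ : ℕ → ℕ → ℕ
  n choose k = n Comb.C k

  choose≡C : ∀ n k → n choose k ≡ n Comb.C k
  choose≡C n k = refl

  choose-pascal : ∀ n k → (n choose k) + (n choose suc k) ≡ suc n choose suc k
  choose-pascal = Comb.nCk+nC[k+1]≡[n+1]C[k+1]

  choose-zero : ∀ n → n choose 0 ≡ 1
  choose-zero n = trans (Comb.nCk≡nC[n∸k] {0} {n} z≤n) (Comb.nCn≡1 n)

  choose-one : ∀ n → n choose 1 ≡ n
  choose-one = Comb.nC1≡n

  choose-< : ∀ {n k} → n < k → n choose k ≡ 0
  choose-< = Comb.k>n⇒nCk≡0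

zero-choose-suc : ∀ k → 0 choose suc k ≡ 0
zero-choose-suc k = choose-< z<s

absorption : ∀ n k → suc k * (suc n choose suc k) ≡ suc n * (n choose k)
absorption zero zero    = cong (1 *_) (trans (choose-one 1) (sym (choose-zero 0)))
absorption zero (suc k) = trans (cong (suc (suc k) *_) (choose-< (s≤s z<s)))
                                (trans (*-zeroʳ (suc (suc k))) (sym (trans (*-identityˡ _) (zero-choose-suc k))))
absorption (suc n) zero = begin
  1 * (suc (suc n) choose 1)    ≡⟨ *-identityˡ _ ⟩
  suc (suc n) choose 1          ≡⟨ choose-one (suc (suc n)) ⟩
  suc (suc n)                   ≡⟨ *-identityʳ _ ⟨
  suc (suc n) * 1               ≡⟨ cong (suc (suc n) *_) (choose-zero (suc n)) ⟨
  suc (suc n) * (suc n choose 0) ∎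
  where open ≡-Reasoning
absorption (suc n) (suc k) = begin
  suc (suc k) * (suc (suc n) choose suc (suc k))
    ≡⟨ cong (suc (suc k) *_) (choose-pascal (suc n) (suc k)) ⟨
  suc (suc k) * (a + (suc n choose suc (suc k)))
    ≡⟨ lemma₁ k a (suc n choose suc (suc k)) ⟩
  a + suc k * a + suc (suc k) * (suc n choose suc (suc k))
    ≡⟨ cong₂ (λ x y → a + x + y) (absorption n k) (absorption n (suc k)) ⟩
  a + suc n * (n choose k) + suc n * (n choose suc k)
    ≡⟨ lemma₂ n a (n choose k) (n choose suc k) ⟩
  a + suc n * ((n choose k) + (n choose suc k))
    ≡⟨ cong (λ x → a + suc n * x) (choose-pascal n k) ⟩
  suc (suc n) * a ∎
  where
  open ≡-Reasoning
  a : ℕ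
  a = suc n choose suc k
  lemma₁ : ∀ k a b → suc (suc k) * (a + b) ≡ a + suc k * a + suc (suc k) * b
  lemma₁ = solve-∀
  lemma₂ : ∀ n a b c → a + suc n * b + suc n * c ≡ a + suc n * (b + c)
  lemma₂ = solve-∀

-- p choose (t - s), and 0 when s > t
binom : ℕ → ℕ → ℕ → ℕ
binom p t       zero    = p choose t
binom p zero    (suc s) = 0
binom p (suc t) (suc s) = binom p t s

binom-absorption : ∀ p t s → (suc t ∸ s) * binom (suc p) (suc t) s ≡ suc p * binom p t s
binom-absorption p t       zero          = absorption p t
binom-absorption p zero    (suc s)       = trans (cong (_* binom (suc p) 0 s) (0∸n≡0 s)) (sym (*-zeroʳ (suc p)))
binom-absorption p (suc t) (suc s)       = binom-absorption p t s

binom-pascal : ∀ p t s → binom (suc p) (suc t) s ≡ binom p t s + binom p (suc t) s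
binom-pascal p t       zero          = sym (choose-pascal p t)
binom-pascal p zero    (suc zero)    = trans (choose-zero (suc p)) (sym (choose-zero p))
binom-pascal p zero    (suc (suc s)) = refl
binom-pascal p (suc t) (suc s)       = binom-pascal p t s

binom>0 : ∀ p t s → 0 < binom p t s → s ≤ t × t ∸ s ≤ p
binom>0 p t zero lt = z≤n , ≮⇒≥ λ p<t → <⇒≢ lt (sym (choose-< p<t))
binom>0 p (suc t) (suc s) lt with binom>0 p t s lt
... | s≤t , le = s≤s s≤t , le

-- Amalgamated colourings

Node : ℕ → ℕ → ℕ → Set
Node M k q = Fin M ⊎ (Fin k × Fin q)

data Incident {M k q : ℕ} (X : Fin M → Subset q) (col : Fin M → Fin k) : Node M k q → Node M k q → Set where
  meets : ∀ {e v} → v ∈ X e → Incident X col (inj₁ e) (inj₂ (col e , v))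

Linked : {M k q : ℕ} → (Fin M → Subset q) → (Fin M → Fin k) → Node M k q → Node M k q → Set
Linked X col = EqClosure (Incident X col)

-- A colouring of the hypergraph obtained from the complete one on q + p vertices by identifying
-- p vertices to a single vertex α. The edge e contains α with multiplicity 4 ∸ ∣ X e ∣.
-- The labels group nodes that are connected without using α.
record State (l k r q p : ℕ) : Set where
  field
    M W  : ℕ
    X    : Fin M → Subset q
    lab  : Fin M → Fin W
    labV : Fin k → Fin q → Fin W
    colL : Fin W → Fin k

  col : Fin M → Fin k
  col e = colL (lab e)

  t : Fin M → ℕ
  t e = 4 ∸ ∣ X e ∣

  d : Fin W → ℕ
  d C = ∑ (allFin M) (λ e → ⟦ lab e Fin.≟ C ⟧ * t e)

  labN : Node M k q → Fin W
  labN = [ lab , (λ jv → labV (proj₁ jv) (proj₂ jv)) ]′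

  field
    mult     : ∀ S → ∑ (allFin M) (λ e → ⟦ X e ≟S S ⟧) ≡ l * binom p 4 ∣ S ∣
    degV     : ∀ j v → ∑ (allFin M) (λ e → ⟦ col e Fin.≟ j ⟧ * (X e ∋ v)) ≡ r
    degα     : ∀ j → ∑ (allFin M) (λ e → ⟦ col e Fin.≟ j ⟧ * t e) ≡ r * p
    colLV    : ∀ j v → colL (labV j v) ≡ j
    incident : ∀ e v → v ∈ X e → labV (col e) v ≡ lab e
    linked   : ∀ x y → labN x ≡ labN y → Linked X col x y
    hinge    : 0 < p → ∀ j v → 0 < d (labV j v)
    -- Nash-Williams' count: it leaves room to split α into p vertices without disconnecting.
    excess   : ∀ j → p ≤ suc (∑ (allFin W) (λ C → ⟦ colL C Fin.≟ j ⟧ * (d C ∸ 1)))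

  count : Subset q → Fin k → ℕ
  count S j = ∑ (allFin M) (λ e → ⟦ X e ≟S S ⟧ * ⟦ col e Fin.≟ j ⟧)

  valid : ∀ e → ∣ X e ∣ ≤ 4 × t e ≤ p
  valid e = binom>0 p 4 ∣ X e ∣ (proj₂ (m*n>0 l _ (subst (0 <_) (mult (X e))
    (<-≤-trans (subst (0 <_) (sym (⟦⟧-yes (X e ≟S X e) refl)) z<s) (term≤∑Fin (λ f → ⟦ X f ≟S X e ⟧) e)))))

bit : ℕ → Bool
bit zero    = false
bit (suc _) = true

𝟙-bit : ∀ {n} → n ≤ 1 → 𝟙 (bit n) ≡ n
𝟙-bit z≤n       = refl
𝟙-bit (s≤s z≤n) = refl

⟦bit≟true⟧ : ∀ {n} → n ≤ 1 → ⟦ bit n Boolₚ.≟ true ⟧ ≡ n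
⟦bit≟true⟧ z≤n       = refl
⟦bit≟true⟧ (s≤s z≤n) = refl

⟦bit≟false⟧+ : ∀ {n} → n ≤ 1 → ⟦ bit n Boolₚ.≟ false ⟧ + n ≡ 1
⟦bit≟false⟧+ z≤n       = refl
⟦bit≟false⟧+ (s≤s z≤n) = refl

∑-<⇒∃ : ∀ {A : Set} (xs : List A) (f g : A → ℕ) → ∑ xs f < ∑ xs g → ∃[ x ] (x ∈ₗ xs × f x < g x)
∑-<⇒∃ (x ∷ xs) f g lt with f x <? g x
... | yes fx<gx = x , here refl , fx<gx
... | no fx≮gx with ∑-<⇒∃ xs f g (+-cancelˡ-< (g x) _ _ (≤-<-trans (+-monoˡ-≤ (∑ xs f) (≮⇒≥ fx≮gx)) lt))
...   | y , y∈ , lt′ = y , there y∈ , lt′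

⟦≟1⟧*n+[n∸1]≤n : ∀ n → ⟦ n ≟ 1 ⟧ * n + (n ∸ 1) ≤ n
⟦≟1⟧*n+[n∸1]≤n 0             = z≤n
⟦≟1⟧*n+[n∸1]≤n 1             = ≤-refl
⟦≟1⟧*n+[n∸1]≤n (suc (suc n)) = n≤1+n (suc n)

⟦≟1⟧*n+[n∸1]<n : ∀ n → 1 < n → ⟦ n ≟ 1 ⟧ * n + (n ∸ 1) < n
⟦≟1⟧*n+[n∸1]<n (suc (suc n)) _ = ≤-refl
⟦≟1⟧*n+[n∸1]<n 1 (s≤s ())

R[_] : ∀ {q} → ℕ → ℕ → Subset q → ℕ
R[ l ] p S = l * binom p 3 ∣ S ∣

mark : ∀ {l k r q p} (s : State l k r q p) → Fin (State.W s) → Bool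
mark s C = does (State.d s C ≟ 1)

StepSelection : ∀ {l k r q p} → State l k r q (suc p) → Set
StepSelection {l} {k} {r} {q} {p} s = Selection (State.X s) (State.lab s) (State.colL s) (mark s) (State.t s) (suc p) r (R[ l ] p)

stepSelection : ∀ {l k r q p} (s : State l k r q (suc p)) → StepSelection s
stepSelection {l} {k} {r} {q} {p} s = Select.select X lab colL (mark s) t (suc p) r (R[ l ] p) z<s rows-t (λ j → trans (degα j) (*-comm r (suc p)))
  where
  open State s
  es : List (Fin M)
  es = allFin M
  rows-t : ∀ S → ∑ es (λ e → ⟦ X e ≟S S ⟧ * t e) ≡ suc p * (l * binom p 3 ∣ S ∣)
  rows-t S = begin
    ∑ es (λ e → ⟦ X e ≟S S ⟧ * t e)                 ≡⟨ ∑-cong es (λ e → ⟦≟⟧-subst _≟S_ (X e) S (λ T → 4 ∸ ∣ T ∣)) ⟩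
    ∑ es (λ e → ⟦ X e ≟S S ⟧ * (4 ∸ ∣ S ∣))         ≡⟨ ∑-*ʳ es (4 ∸ ∣ S ∣) (λ e → ⟦ X e ≟S S ⟧) ⟩
    ∑ es (λ e → ⟦ X e ≟S S ⟧) * (4 ∸ ∣ S ∣)         ≡⟨ cong (_* (4 ∸ ∣ S ∣)) (mult S) ⟩
    l * binom (suc p) 4 ∣ S ∣ * (4 ∸ ∣ S ∣)         ≡⟨ lemma l (binom (suc p) 4 ∣ S ∣) (4 ∸ ∣ S ∣) ⟩
    l * ((4 ∸ ∣ S ∣) * binom (suc p) 4 ∣ S ∣)       ≡⟨ cong (l *_) (binom-absorption p 3 ∣ S ∣) ⟩
    l * (suc p * binom p 3 ∣ S ∣)                   ≡⟨ lemma′ l (suc p) (binom p 3 ∣ S ∣) ⟩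
    suc p * (l * binom p 3 ∣ S ∣)                   ∎
    where
    open ≡-Reasoning
    lemma : ∀ a b c → a * b * c ≡ a * (c * b)
    lemma = solve-∀
    lemma′ : ∀ a b c → a * (b * c) ≡ b * (a * c)
    lemma′ = solve-∀

module Step {l k r q p : ℕ} (s : State l k r q (suc p)) (r>0 : 0 < r) (selection : StepSelection s) where
  open State s
  open Selection selection

  P : ℕ
  P = suc p

  es : List (Fin M)
  es = allFin M

  z≤1 : ∀ e → z e ≤ 1
  z≤1 e = s≤s⁻¹ (*-cancelˡ-< P (z e) 2 (begin-strict
    P * z e     <⟨ proj₁ (near e) ⟩
    t e + P     ≤⟨ +-monoˡ-≤ P (proj₂ (valid e)) ⟩
    P + P       ≡⟨ lemma P ⟩
    P * 2       ∎))
    where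
    open ≤-Reasoning
    lemma : ∀ a → a + a ≡ a * 2
    lemma = solve-∀

  z≤t : ∀ e → z e ≤ t e
  z≤t e = bound (t e) refl
    where
    bound : ∀ u → t e ≡ u → z e ≤ u
    bound (suc u) _  = ≤-trans (z≤1 e) (s≤s z≤n)
    bound zero    eq = s≤s⁻¹ (*-cancelˡ-< P (z e) 1 (subst (P * z e <_) (trans (cong (_+ P) eq) (sym (*-identityʳ P))) (proj₁ (near e))))

  X′ : Fin M → Subset (suc q)
  X′ e = bit (z e) ∷ X e

  t′ : Fin M → ℕ
  t′ e = 4 ∸ ∣ X′ e ∣

  t′+z≡t : ∀ e → t′ e + z e ≡ t e
  t′+z≡t e = lemma (z e) (z≤1 e) (z≤t e)
    where
    lemma : ∀ n → n ≤ 1 → n ≤ t e → (4 ∸ ∣ bit n ∷ X e ∣) + n ≡ t e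
    lemma 0 _ _ = +-identityʳ (t e)
    lemma 1 _ 1≤t = trans (cong (_+ 1) (sym (pred[m∸n]≡m∸[1+n] 4 ∣ X e ∣))) (trans (+-comm (pred (t e)) 1) (suc-pred (t e) {{>-nonZero 1≤t}}))
    lemma (suc (suc _)) (s≤s ()) _

  zG : Fin W → ℕ
  zG C = ∑ es (λ e → ⟦ lab e Fin.≟ C ⟧ * z e)

  δ : Fin W → ℕ
  δ C = ∑ es (λ e → ⟦ lab e Fin.≟ C ⟧ * t′ e)

  δ+zG≡d : ∀ C → δ C + zG C ≡ d C
  δ+zG≡d C = trans (sym (∑-+ es _ _)) (∑-cong es λ e → trans (sym (*-distribˡ-+ ⟦ lab e Fin.≟ C ⟧ (t′ e) (z e))) (cong (⟦ lab e Fin.≟ C ⟧ *_) (t′+z≡t e)))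

  Touched : Fin W → Set
  Touched C = 0 < zG C

  z⇒touched : ∀ e → 0 < z e → Touched (lab e)
  z⇒touched e z>0 = <-≤-trans (subst (0 <_) (sym (trans (cong (_* z e) (⟦⟧-yes (lab e Fin.≟ lab e) refl)) (*-identityˡ (z e)))) z>0)
                               (term≤∑Fin (λ f → ⟦ lab f Fin.≟ lab e ⟧ * z f) e)

  touched⇒z : ∀ C → Touched C → ∃[ e ] (lab e ≡ C × 0 < z e)
  touched⇒z C lt = e , ⟦⟧>0 (lab e Fin.≟ C) (proj₁ pos) , proj₂ pos
    where
    e : Fin M
    e = proj₁ (∑Fin>0 (λ e → ⟦ lab e Fin.≟ C ⟧ * z e) lt)
    pos : 0 < ⟦ lab e Fin.≟ C ⟧ × 0 < z e
    pos = m*n>0 ⟦ lab e Fin.≟ C ⟧ (z e) (proj₂ (∑Fin>0 (λ e → ⟦ lab e Fin.≟ C ⟧ * z e) lt))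

  abstract
    chosen : ∀ j → ∃[ e ] (col e ≡ j × 0 < z e)
    chosen j = e , ⟦⟧>0 (col e Fin.≟ j) (proj₁ pos) , proj₂ pos
      where
      cols>0 : 0 < ∑ es (λ e → ⟦ col e Fin.≟ j ⟧ * z e)
      cols>0 = subst (0 <_) (sym (cols j)) r>0
      e : Fin M
      e = proj₁ (∑Fin>0 (λ e → ⟦ col e Fin.≟ j ⟧ * z e) cols>0)
      pos : 0 < ⟦ col e Fin.≟ j ⟧ × 0 < z e
      pos = m*n>0 ⟦ col e Fin.≟ j ⟧ (z e) (proj₂ (∑Fin>0 (λ e → ⟦ col e Fin.≟ j ⟧ * z e) cols>0))

  rep : Fin k → Fin W
  rep j = lab (proj₁ (chosen j))

  colL-rep : ∀ j → colL (rep j) ≡ j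
  colL-rep j = proj₁ (proj₂ (chosen j))

  rep-touched : ∀ j → Touched (rep j)
  rep-touched j = z⇒touched (proj₁ (chosen j)) (proj₂ (proj₂ (chosen j)))

  touched? : ∀ C → Dec (Touched C)
  touched? C = 0 <? zG C

  μ : Fin W → Fin W
  μ C with touched? C
  ... | yes _ = rep (colL C)
  ... | no _  = C

  μ-touched : ∀ C → Touched C → μ C ≡ rep (colL C)
  μ-touched C τ with touched? C
  ... | yes _ = refl
  ... | no ¬τ = contradiction τ ¬τ

  μ-untouched : ∀ C → ¬ Touched C → μ C ≡ C
  μ-untouched C ¬τ with touched? C
  ... | yes τ = contradiction τ ¬τ
  ... | no _  = refl

  colL-μ : ∀ C → colL (μ C) ≡ colL C
  colL-μ C with touched? C
  ... | yes _ = colL-rep (colL C)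
  ... | no _  = refl

  lab′ : Fin M → Fin W
  lab′ e = μ (lab e)

  labV′ : Fin k → Fin (suc q) → Fin W
  labV′ j zero    = rep j
  labV′ j (suc v) = μ (labV j v)

  col′ : Fin M → Fin k
  col′ e = colL (lab′ e)

  col′≡col : ∀ e → col′ e ≡ col e
  col′≡col e = colL-μ (lab e)

  ⟦col′⟧ : ∀ e j → ⟦ col′ e Fin.≟ j ⟧ ≡ ⟦ col e Fin.≟ j ⟧
  ⟦col′⟧ e j = cong (λ c → ⟦ c Fin.≟ j ⟧) (col′≡col e)

  mult′ : ∀ S → ∑ es (λ e → ⟦ X′ e ≟S S ⟧) ≡ l * binom p 4 ∣ S ∣
  mult′ (true ∷ S) = trans (∑-cong es λ e → begin
      ⟦ X′ e ≟S (true ∷ S) ⟧                              ≡⟨ ∷-≟S (bit (z e)) true (X e) S ⟩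
      ⟦ bit (z e) Boolₚ.≟ true ⟧ * ⟦ X e ≟S S ⟧           ≡⟨ cong (_* ⟦ X e ≟S S ⟧) (⟦bit≟true⟧ (z≤1 e)) ⟩
      z e * ⟦ X e ≟S S ⟧                                  ≡⟨ *-comm (z e) _ ⟩
      ⟦ X e ≟S S ⟧ * z e                                  ∎) (rows S)
    where open ≡-Reasoning
  mult′ (false ∷ S) = +-cancelʳ-≡ (l * binom p 3 ∣ S ∣) _ _ (begin
      ∑ es (λ e → ⟦ X′ e ≟S (false ∷ S) ⟧) + l * binom p 3 ∣ S ∣
        ≡⟨ cong₂ _+_ (∑-cong es λ e → ∷-≟S (bit (z e)) false (X e) S) (sym (trans (∑-cong es λ e → *-comm (z e) _) (rows S))) ⟩
      ∑ es (λ e → ⟦ bit (z e) Boolₚ.≟ false ⟧ * ⟦ X e ≟S S ⟧) + ∑ es (λ e → z e * ⟦ X e ≟S S ⟧)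
        ≡⟨ ∑-+ es _ _ ⟨
      ∑ es (λ e → ⟦ bit (z e) Boolₚ.≟ false ⟧ * ⟦ X e ≟S S ⟧ + z e * ⟦ X e ≟S S ⟧)
        ≡⟨ ∑-cong es (λ e → trans (sym (*-distribʳ-+ ⟦ X e ≟S S ⟧ ⟦ bit (z e) Boolₚ.≟ false ⟧ (z e)))
                                  (trans (cong (_* ⟦ X e ≟S S ⟧) (⟦bit≟false⟧+ (z≤1 e))) (*-identityˡ _))) ⟩
      ∑ es (λ e → ⟦ X e ≟S S ⟧)
        ≡⟨ mult S ⟩
      l * binom P 4 ∣ S ∣
        ≡⟨ cong (l *_) (binom-pascal p 3 ∣ S ∣) ⟩
      l * (binom p 3 ∣ S ∣ + binom p 4 ∣ S ∣)
        ≡⟨ lemma l (binom p 3 ∣ S ∣) (binom p 4 ∣ S ∣) ⟩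
      l * binom p 4 ∣ S ∣ + l * binom p 3 ∣ S ∣ ∎)
    where
    open ≡-Reasoning
    lemma : ∀ a b c → a * (b + c) ≡ a * c + a * b
    lemma = solve-∀

  degV′ : ∀ j v → ∑ es (λ e → ⟦ col′ e Fin.≟ j ⟧ * (X′ e ∋ v)) ≡ r
  degV′ j zero    = trans (∑-cong es λ e → cong₂ _*_ (⟦col′⟧ e j) (𝟙-bit (z≤1 e))) (cols j)
  degV′ j (suc v) = trans (∑-cong es λ e → cong (_* (X e ∋ v)) (⟦col′⟧ e j)) (degV j v)

  degα′ : ∀ j → ∑ es (λ e → ⟦ col′ e Fin.≟ j ⟧ * t′ e) ≡ r * p
  degα′ j = +-cancelʳ-≡ r _ _ (begin
    ∑ es (λ e → ⟦ col′ e Fin.≟ j ⟧ * t′ e) + r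
      ≡⟨ cong₂ _+_ (∑-cong es λ e → cong (_* t′ e) (⟦col′⟧ e j)) (sym (cols j)) ⟩
    ∑ es (λ e → ⟦ col e Fin.≟ j ⟧ * t′ e) + ∑ es (λ e → ⟦ col e Fin.≟ j ⟧ * z e)
      ≡⟨ ∑-+ es _ _ ⟨
    ∑ es (λ e → ⟦ col e Fin.≟ j ⟧ * t′ e + ⟦ col e Fin.≟ j ⟧ * z e)
      ≡⟨ ∑-cong es (λ e → trans (sym (*-distribˡ-+ ⟦ col e Fin.≟ j ⟧ (t′ e) (z e))) (cong (⟦ col e Fin.≟ j ⟧ *_) (t′+z≡t e))) ⟩
    ∑ es (λ e → ⟦ col e Fin.≟ j ⟧ * t e)
      ≡⟨ trans (degα j) (trans (*-suc r p) (+-comm r (r * p))) ⟩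
    r * p + r ∎)
    where open ≡-Reasoning

  colLV′ : ∀ j v → colL (labV′ j v) ≡ j
  colLV′ j zero    = colL-rep j
  colLV′ j (suc v) = trans (colL-μ (labV j v)) (colLV j v)

  lift : Node M k q → Node M k (suc q)
  lift (inj₁ e)       = inj₁ e
  lift (inj₂ (j , v)) = inj₂ (j , suc v)

  β : Fin k → Node M k (suc q)
  β j = inj₂ (j , zero)

  Linked′ : Node M k (suc q) → Node M k (suc q) → Set
  Linked′ = Linked X′ col′

  link-sym : ∀ {x y} → Linked′ x y → Linked′ y x
  link-sym = EqClosure.symmetric (Incident X′ col′)

  link-trans : ∀ {x y w} → Linked′ x y → Linked′ y w → Linked′ x w
  link-trans = EqClosure.transitive (Incident X′ col′)

  meets′ : ∀ e v → v ∈ X′ e → Incident X′ col′ (inj₁ e) (inj₂ (col e , v))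
  meets′ e v v∈ = subst (λ c → Incident X′ col′ (inj₁ e) (inj₂ (c , v))) (col′≡col e) (meets v∈)

  lift-linked : ∀ {x y} → Linked X col x y → Linked′ (lift x) (lift y)
  lift-linked = EqClosure.gmap lift λ { (meets {e} {v} v∈) → meets′ e (suc v) (Data.Vec.there v∈) }

  β-linked : ∀ e → 0 < z e → Linked′ (inj₁ e) (β (col e))
  β-linked e z>0 = EqClosure.return (meets′ e zero (subst (λ b → zero ∈ (b ∷ X e)) (sym (bit-true (z e) z>0)) Data.Vec.here))
    where
    bit-true : ∀ n → 0 < n → bit n ≡ true
    bit-true (suc n) _ = refl

  touched-linked : ∀ x → Touched (labN x) → Linked′ (lift x) (β (colL (labN x)))
  touched-linked x τ = link-trans (lift-linked (linked x (inj₁ e) (sym eq))) (subst (λ C → Linked′ (inj₁ e) (β (colL C))) eq (β-linked e (proj₂ (proj₂ (touched⇒z (labN x) τ)))))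
    where
    e : Fin M
    e = proj₁ (touched⇒z (labN x) τ)
    eq : lab e ≡ labN x
    eq = proj₁ (proj₂ (touched⇒z (labN x) τ))

  labN′ : Node M k (suc q) → Fin W
  labN′ = [ lab′ , (λ jv → labV′ (proj₁ jv) (proj₂ jv)) ]′

  -- the label of a node before merging; β gets a touched one
  oldLabel : Node M k (suc q) → Fin W
  oldLabel (inj₁ e)           = lab e
  oldLabel (inj₂ (j , zero))  = rep j
  oldLabel (inj₂ (j , suc v)) = labV j v

  μ-rep : ∀ j → μ (rep j) ≡ rep j
  μ-rep j = trans (μ-touched (rep j) (rep-touched j)) (cong rep (colL-rep j))

  labN′≡μ : ∀ n → labN′ n ≡ μ (oldLabel n)
  labN′≡μ (inj₁ e)           = refl
  labN′≡μ (inj₂ (j , zero))  = sym (μ-rep j)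
  labN′≡μ (inj₂ (j , suc v)) = refl

  node-touched : ∀ n → Touched (oldLabel n) → Linked′ n (β (colL (oldLabel n)))
  node-touched (inj₁ e)           τ = touched-linked (inj₁ e) τ
  node-touched (inj₂ (j , zero))  τ = subst (λ i → Linked′ (β j) (β i)) (sym (colL-rep j)) (EqClosure.reflexive _)
  node-touched (inj₂ (j , suc v)) τ = touched-linked (inj₂ (j , v)) τ

  node-untouched : ∀ n → ¬ Touched (oldLabel n) → ∃[ x ] (n ≡ lift x × oldLabel n ≡ labN x)
  node-untouched (inj₁ e)           ¬τ = inj₁ e , refl , refl
  node-untouched (inj₂ (j , zero))  ¬τ = contradiction (rep-touched j) ¬τ
  node-untouched (inj₂ (j , suc v)) ¬τ = inj₂ (j , v) , refl , refl

  μ≡⇒touched : ∀ C D → Touched C → μ C ≡ μ D → Touched D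
  μ≡⇒touched C D τ eq with touched? D
  ... | yes τ′ = τ′
  ... | no _   = subst Touched (trans (sym (μ-touched C τ)) eq) (rep-touched (colL C))

  linked′ : ∀ x y → labN′ x ≡ labN′ y → Linked′ x y
  linked′ x y eq = by (touched? (oldLabel x)) (touched? (oldLabel y))
    where
    μ-eq : μ (oldLabel x) ≡ μ (oldLabel y)
    μ-eq = trans (sym (labN′≡μ x)) (trans eq (labN′≡μ y))
    by : Dec (Touched (oldLabel x)) → Dec (Touched (oldLabel y)) → Linked′ x y
    by (yes τ) (yes τ′) = link-trans (subst (λ j → Linked′ x (β j)) same (node-touched x τ)) (link-sym (node-touched y τ′))
      where
      same : colL (oldLabel x) ≡ colL (oldLabel y)
      same = trans (sym (colL-μ (oldLabel x))) (trans (cong colL μ-eq) (colL-μ (oldLabel y)))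
    by (yes τ) (no ¬τ) = contradiction (μ≡⇒touched _ _ τ μ-eq) ¬τ
    by (no ¬τ) (yes τ) = contradiction (μ≡⇒touched _ _ τ (sym μ-eq)) ¬τ
    by (no ¬τ) (no ¬τ′) with node-untouched x ¬τ | node-untouched y ¬τ′
    ... | x₀ , refl , eqx | y₀ , refl , eqy =
      lift-linked (linked x₀ y₀ (trans (sym eqx) (trans (sym (μ-untouched _ ¬τ)) (trans μ-eq (trans (μ-untouched _ ¬τ′) eqy)))))

  incident′ : ∀ e v → v ∈ X′ e → labV′ (col′ e) v ≡ lab′ e
  incident′ e zero    v∈ = trans (cong rep (col′≡col e)) (sym (μ-touched (lab e) (z⇒touched e (bit-true (z e) v∈))))
    where
    bit-true : ∀ n → zero ∈ (bit n ∷ X e) → 0 < n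
    bit-true (suc n) _ = z<s
  incident′ e (suc v) (Data.Vec.there v∈) = trans (cong (λ j → μ (labV j v)) (col′≡col e)) (cong μ (incident e v v∈))

  d′ : Fin W → ℕ
  d′ C = ∑ es (λ e → ⟦ lab′ e Fin.≟ C ⟧ * t′ e)

  d′-untouched : ∀ C → ¬ Touched C → d′ C ≡ d C
  d′-untouched C ¬τ = ∑-cong es λ e → by e (lab e Fin.≟ C)
    where
    by : ∀ e → Dec (lab e ≡ C) → ⟦ lab′ e Fin.≟ C ⟧ * t′ e ≡ ⟦ lab e Fin.≟ C ⟧ * t e
    by e (yes refl) = cong₂ _*_ (cong (λ D → ⟦ D Fin.≟ lab e ⟧) (μ-untouched _ ¬τ))
      (trans (sym (+-identityʳ (t′ e))) (trans (cong (t′ e +_) (sym (n≤0⇒n≡0 (≮⇒≥ λ z>0 → ¬τ (z⇒touched e z>0))))) (t′+z≡t e)))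
    by e (no l≢C) = trans (cong (_* t′ e) (⟦⟧-no (lab′ e Fin.≟ C) neq)) (sym (cong (_* t e) (⟦⟧-no (lab e Fin.≟ C) l≢C)))
      where
      neq : lab′ e ≢ C
      neq eq with touched? (lab e)
      ... | yes _ = ¬τ (subst Touched eq (rep-touched (colL (lab e))))
      ... | no _  = l≢C eq

  d′-rep : ∀ j → d′ (rep j) ≡ ∑ (allFin W) (λ C → δ C * (⟦ colL C Fin.≟ j ⟧ * ⟦ touched? C ⟧))
  d′-rep j = sym (trans (∑Fin-fibre es lab t′ (λ C → ⟦ colL C Fin.≟ j ⟧ * ⟦ touched? C ⟧)) (∑-cong es λ e → trans (*-comm (t′ e) _) (cong (_* t′ e) (by (lab e)))))
    where
    by : ∀ C → ⟦ colL C Fin.≟ j ⟧ * ⟦ touched? C ⟧ ≡ ⟦ μ C Fin.≟ rep j ⟧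
    by C = trans (sym (⟦⟧-× (colL C Fin.≟ j) (touched? C))) (⟦⟧-iff ((colL C Fin.≟ j) ×-dec touched? C) (μ C Fin.≟ rep j)
      (λ { (refl , τ) → μ-touched C τ })
      (λ eq → trans (sym (colL-μ C)) (trans (cong colL eq) (colL-rep j)) , μ≡⇒touched (rep j) C (rep-touched j) (trans (μ-rep j) (sym eq))))

  δ≤d′-rep : ∀ j C → colL C ≡ j → Touched C → δ C ≤ d′ (rep j)
  δ≤d′-rep j C eq τ = subst₂ _≤_ (trans (cong₂ (λ a b → δ C * (a * b)) (⟦⟧-yes (colL C Fin.≟ j) eq) (⟦⟧-yes (touched? C) τ)) (*-identityʳ (δ C)))
    (sym (d′-rep j)) (term≤∑Fin (λ C → δ C * (⟦ colL C Fin.≟ j ⟧ * ⟦ touched? C ⟧)) C)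

  d-total : ∀ j → ∑ (allFin W) (λ C → d C * ⟦ colL C Fin.≟ j ⟧) ≡ r * P
  d-total j = trans (∑Fin-fibre es lab t (λ C → ⟦ colL C Fin.≟ j ⟧)) (trans (∑-cong es λ e → *-comm (t e) _) (degα j))

  singles : Fin k → ℕ
  singles j = ∑ es (λ e → ⟦ col e Fin.≟ j ⟧ * (𝟙 (mark s (lab e)) * t e))

  singles-by-label : ∀ j → singles j ≡ ∑ (allFin W) (λ C → d C * (⟦ colL C Fin.≟ j ⟧ * ⟦ d C ≟ 1 ⟧))
  singles-by-label j = sym (trans (∑Fin-fibre es lab t (λ C → ⟦ colL C Fin.≟ j ⟧ * ⟦ d C ≟ 1 ⟧))
    (∑-cong es λ e → lemma (t e) ⟦ col e Fin.≟ j ⟧ ⟦ d (lab e) ≟ 1 ⟧))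
    where
    lemma : ∀ a b c → a * (b * c) ≡ b * (c * a)
    lemma = solve-∀

  excessOf : (Fin W → ℕ) → Fin k → ℕ
  excessOf f j = ∑ (allFin W) (λ C → ⟦ colL C Fin.≟ j ⟧ * (f C ∸ 1))

  singles-bound : 0 < p → ∀ j → singles j + P ≤ r * P
  singles-bound p>0 j = begin
    singles j + suc p                 ≡⟨ +-suc (singles j) p ⟩
    suc (singles j + p)               ≤⟨ s≤s (+-monoʳ-≤ (singles j) (s≤s⁻¹ (excess j))) ⟩
    suc (singles j + excessOf d j)    ≤⟨ strictly ⟩
    r * P                             ∎
    where
    open ≤-Reasoning
    F : Fin W → ℕ
    F C = d C * (⟦ colL C Fin.≟ j ⟧ * ⟦ d C ≟ 1 ⟧) + ⟦ colL C Fin.≟ j ⟧ * (d C ∸ 1)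
    factor : ∀ C → F C ≡ ⟦ colL C Fin.≟ j ⟧ * (⟦ d C ≟ 1 ⟧ * d C + (d C ∸ 1))
    factor C = lemma (d C) ⟦ colL C Fin.≟ j ⟧ ⟦ d C ≟ 1 ⟧ (d C ∸ 1)
      where
      lemma : ∀ d a b e → d * (a * b) + a * e ≡ a * (b * d + e)
      lemma = solve-∀
    big : ∃[ C ] (0 < ⟦ colL C Fin.≟ j ⟧ * (d C ∸ 1))
    big = ∑Fin>0 (λ C → ⟦ colL C Fin.≟ j ⟧ * (d C ∸ 1)) (<-≤-trans p>0 (s≤s⁻¹ (excess j)))
    C₀ : Fin W
    C₀ = proj₁ big
    C₀-col : 0 < ⟦ colL C₀ Fin.≟ j ⟧ × 0 < d C₀ ∸ 1
    C₀-col = m*n>0 _ _ (proj₂ big)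
    F≤ : ∀ C → F C ≤ d C * ⟦ colL C Fin.≟ j ⟧
    F≤ C = subst₂ _≤_ (sym (factor C)) (*-comm ⟦ colL C Fin.≟ j ⟧ (d C)) (*-monoʳ-≤ ⟦ colL C Fin.≟ j ⟧ (⟦≟1⟧*n+[n∸1]≤n (d C)))
    F< : F C₀ < d C₀ * ⟦ colL C₀ Fin.≟ j ⟧
    F< = subst₂ _<_ (sym (factor C₀)) (*-comm ⟦ colL C₀ Fin.≟ j ⟧ (d C₀))
      (*-monoʳ-< ⟦ colL C₀ Fin.≟ j ⟧ {{>-nonZero (proj₁ C₀-col)}} (⟦≟1⟧*n+[n∸1]<n (d C₀) (≰⇒> λ d≤1 → <⇒≢ (proj₂ C₀-col) (sym (m≤n⇒m∸n≡0 d≤1)))))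
    strictly : suc (singles j + excessOf d j) ≤ r * P
    strictly = subst₂ _<_ (trans (∑-+ (allFin W) _ _) (cong (_+ excessOf d j) (sym (singles-by-label j)))) (d-total j) (∑-mono-<∈ F≤ (∈ₗ.∈-allFin C₀) F<)

  zG<d : 0 < p → ∀ C → 1 < d C → zG C < d C
  zG<d p>0 C d>1 = ≰⇒> λ d≤z → <-irrefl refl (begin-strict
    p * d C + d C       ≡⟨ +-comm (p * d C) (d C) ⟩
    P * d C             ≤⟨ *-monoʳ-≤ P d≤z ⟩
    P * zG C            <⟨ proj₁ (groups C) ⟩
    d C + suc p         ≤⟨ +-monoʳ-≤ (d C) (+-mono-≤ p>0 (≤-refl {p})) ⟩
    d C + (p + p)       ≡⟨ cong (d C +_) (lemma p) ⟩
    d C + p * 2         ≤⟨ +-monoʳ-≤ (d C) (*-monoʳ-≤ p d>1) ⟩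
    d C + p * d C       ≡⟨ +-comm (d C) (p * d C) ⟩
    p * d C + d C       ∎)
    where
    open ≤-Reasoning
    lemma : ∀ a → a + a ≡ a * 2
    lemma = solve-∀

  -- As few of the selected edges belong to groups with a single hinge, β stays attached to α.
  d′-rep>0 : 0 < p → ∀ j → 0 < d′ (rep j)
  d′-rep>0 p>0 j = <-≤-trans δ>0 (δ≤d′-rep j (lab e) col-e (z⇒touched e z>0))
    where
    zS : ℕ
    zS = ∑ es (λ e → ⟦ col e Fin.≟ j ⟧ * (𝟙 (mark s (lab e)) * z e))
    few : zS < r
    few = *-cancelˡ-< P zS r (<-≤-trans (proj₁ (marked j)) (subst (singles j + P ≤_) (*-comm r P) (singles-bound p>0 j)))
    found : ∃[ e ] (e ∈ₗ es × ⟦ col e Fin.≟ j ⟧ * (𝟙 (mark s (lab e)) * z e) < ⟦ col e Fin.≟ j ⟧ * z e)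
    found = ∑-<⇒∃ es _ _ (subst (zS <_) (sym (cols j)) few)
    e : Fin M
    e = proj₁ found
    lt : ⟦ col e Fin.≟ j ⟧ * (⟦ d (lab e) ≟ 1 ⟧ * z e) < ⟦ col e Fin.≟ j ⟧ * z e
    lt = proj₂ (proj₂ found)
    pos : 0 < ⟦ col e Fin.≟ j ⟧ × 0 < z e
    pos = m*n>0 ⟦ col e Fin.≟ j ⟧ (z e) (≤-<-trans z≤n lt)
    col-e : col e ≡ j
    col-e = ⟦⟧>0 (col e Fin.≟ j) (proj₁ pos)
    z>0 : 0 < z e
    z>0 = proj₂ pos
    d≢1 : d (lab e) ≢ 1
    d≢1 eq = <-irrefl (cong (⟦ col e Fin.≟ j ⟧ *_) (trans (cong (_* z e) (⟦⟧-yes (d (lab e) ≟ 1) eq)) (*-identityˡ (z e)))) lt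
    d≥t : t e ≤ d (lab e)
    d≥t = subst (_≤ d (lab e)) (trans (cong (_* t e) (⟦⟧-yes (lab e Fin.≟ lab e) refl)) (*-identityˡ (t e))) (term≤∑Fin (λ f → ⟦ lab f Fin.≟ lab e ⟧ * t f) e)
    d>1 : 1 < d (lab e)
    d>1 = ≤∧≢⇒< (≤-trans z>0 (≤-trans (z≤t e) d≥t)) (d≢1 ∘ sym)
    δ>0 : 0 < δ (lab e)
    δ>0 = ≰⇒> λ δ≤0 → <-irrefl (trans (cong (_+ zG (lab e)) (sym (n≤0⇒n≡0 δ≤0))) (δ+zG≡d (lab e))) (zG<d p>0 (lab e) d>1)

  hinge′ : 0 < p → ∀ j v → 0 < d′ (labV′ j v)
  hinge′ p>0 j zero    = d′-rep>0 p>0 j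
  hinge′ p>0 j (suc v) with touched? (labV j v)
  ... | yes _ = d′-rep>0 p>0 (colL (labV j v))
  ... | no ¬τ = subst (0 <_) (sym (d′-untouched _ ¬τ)) (hinge z<s j v)

  untouchedExcess : Fin k → ℕ
  untouchedExcess j = ∑ (allFin W) (λ C → ⟦ colL C Fin.≟ j ⟧ * (⟦ ¬? (touched? C) ⟧ * (d C ∸ 1)))

  excess′-split : ∀ j → untouchedExcess j + (d′ (rep j) ∸ 1) ≤ excessOf d′ j
  excess′-split j = subst (_≤ excessOf d′ j) (trans (∑-+ (allFin W) _ _) (cong (untouchedExcess j +_) (∑Fin-⟦≟⟧ (rep j) (λ _ → d′ (rep j) ∸ 1))))
    (∑-mono (allFin W) λ C → by C (C Fin.≟ rep j) (touched? C))
    where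
    by : ∀ C → Dec (C ≡ rep j) → Dec (Touched C) →
         ⟦ colL C Fin.≟ j ⟧ * (⟦ ¬? (touched? C) ⟧ * (d C ∸ 1)) + ⟦ C Fin.≟ rep j ⟧ * (d′ (rep j) ∸ 1) ≤ ⟦ colL C Fin.≟ j ⟧ * (d′ C ∸ 1)
    by C (yes refl) _ = ≤-reflexive (cong₂ _+_
      (trans (cong (λ b → ⟦ colL C Fin.≟ j ⟧ * (b * (d C ∸ 1))) (⟦⟧-no (¬? (touched? C)) λ ¬τ → ¬τ (rep-touched j))) (*-zeroʳ ⟦ colL C Fin.≟ j ⟧))
      (cong (_* (d′ C ∸ 1)) (trans (⟦⟧-yes (C Fin.≟ rep j) refl) (sym (⟦⟧-yes (colL C Fin.≟ j) (colL-rep j))))))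
    by C (no C≢) (yes τ) = ≤-trans (≤-reflexive (cong₂ _+_
      (trans (cong (λ b → ⟦ colL C Fin.≟ j ⟧ * (b * (d C ∸ 1))) (⟦⟧-no (¬? (touched? C)) λ ¬τ → ¬τ τ)) (*-zeroʳ ⟦ colL C Fin.≟ j ⟧))
      (cong (_* (d′ (rep j) ∸ 1)) (⟦⟧-no (C Fin.≟ rep j) C≢)))) z≤n
    by C (no C≢) (no ¬τ) = ≤-reflexive (trans (cong₂ _+_
      (cong (⟦ colL C Fin.≟ j ⟧ *_) (trans (cong (_* (d C ∸ 1)) (⟦⟧-yes (¬? (touched? C)) ¬τ)) (trans (*-identityˡ (d C ∸ 1)) (cong (_∸ 1) (sym (d′-untouched C ¬τ))))))
      (cong (_* (d′ (rep j) ∸ 1)) (⟦⟧-no (C Fin.≟ rep j) C≢))) (+-identityʳ _))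

  n≤1+[n∸1] : ∀ n → n ≤ suc (n ∸ 1)
  n≤1+[n∸1] zero    = z≤n
  n≤1+[n∸1] (suc n) = ≤-refl

  p≤δ : ∀ C → 1 < zG C → p ≤ δ C
  p≤δ C z>1 = ≤-trans (m≤m*n p (pred (zG C)) {{>-nonZero w>0}}) (+-cancelʳ-≤ (zG C + P) _ _ (begin
    p * w + (zG C + P)          ≡⟨ cong (λ n → p * w + (n + P)) zG≡ ⟩
    p * w + (suc w + P)         ≡⟨ lemma p w ⟩
    suc (P * suc w)             ≡⟨ cong (λ n → suc (P * n)) zG≡ ⟨
    suc (P * zG C)              ≤⟨ proj₁ (groups C) ⟩
    d C + P                     ≡⟨ cong (_+ P) (δ+zG≡d C) ⟨
    δ C + zG C + P              ≡⟨ +-assoc (δ C) (zG C) P ⟩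
    δ C + (zG C + P)            ∎))
    where
    open ≤-Reasoning
    w : ℕ
    w = pred (zG C)
    w>0 : 0 < w
    w>0 = pred-mono-≤ z>1
    zG≡ : zG C ≡ suc w
    zG≡ = sym (suc-pred (zG C) {{>-nonZero (<-trans z<s z>1)}})
    lemma : ∀ p w → p * w + (suc w + suc p) ≡ suc (suc p * suc w)
    lemma = solve-∀

  excess′ : ∀ j → p ≤ suc (excessOf d′ j)
  excess′ j = by (Finₚ.any? λ C → (colL C Fin.≟ j) ×-dec (1 <? zG C))
    where
    open ≤-Reasoning
    by : Dec (∃[ C ] (colL C ≡ j × 1 < zG C)) → p ≤ suc (excessOf d′ j)
    by (yes (C , eq , z>1)) = begin
      p                           ≤⟨ p≤δ C z>1 ⟩
      δ C                         ≤⟨ δ≤d′-rep j C eq (<-trans z<s z>1) ⟩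
      d′ (rep j)                  ≤⟨ n≤1+[n∸1] (d′ (rep j)) ⟩
      suc (d′ (rep j) ∸ 1)        ≤⟨ s≤s (≤-trans (m≤n+m _ (untouchedExcess j)) (excess′-split j)) ⟩
      suc (excessOf d′ j)         ∎
    by (no small) = begin
      p                           ≤⟨ s≤s⁻¹ (excess j) ⟩
      excessOf d j                ≤⟨ ∑-mono (allFin W) bound ⟩
      ∑ (allFin W) (λ C → ⟦ colL C Fin.≟ j ⟧ * (⟦ ¬? (touched? C) ⟧ * (d C ∸ 1)) + δ C * (⟦ colL C Fin.≟ j ⟧ * ⟦ touched? C ⟧))
                                  ≡⟨ ∑-+ (allFin W) _ _ ⟩
      untouchedExcess j + ∑ (allFin W) (λ C → δ C * (⟦ colL C Fin.≟ j ⟧ * ⟦ touched? C ⟧))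
                                  ≡⟨ cong (untouchedExcess j +_) (d′-rep j) ⟨
      untouchedExcess j + d′ (rep j)
                                  ≤⟨ +-monoʳ-≤ (untouchedExcess j) (n≤1+[n∸1] (d′ (rep j))) ⟩
      untouchedExcess j + suc (d′ (rep j) ∸ 1)
                                  ≡⟨ +-suc (untouchedExcess j) _ ⟩
      suc (untouchedExcess j + (d′ (rep j) ∸ 1))
                                  ≤⟨ s≤s (excess′-split j) ⟩
      suc (excessOf d′ j)         ∎
      where
      cases : ∀ C (c? : Dec (colL C ≡ j)) (τ? : Dec (Touched C)) →
              ⟦ c? ⟧ * (d C ∸ 1) ≤ ⟦ c? ⟧ * (⟦ ¬? τ? ⟧ * (d C ∸ 1)) + δ C * (⟦ c? ⟧ * ⟦ τ? ⟧)
      cases C (no _)   _       = z≤n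
      cases C (yes _)  (no _)  = ≤-trans (≤-reflexive (cong (_+ 0) (sym (+-identityʳ (d C ∸ 1))))) (m≤m+n _ _)
      cases C (yes eq) (yes _) = ≤-trans (≤-reflexive (+-identityʳ _)) (subst (d C ∸ 1 ≤_) (sym (*-identityʳ (δ C)))
        (m≤n+o⇒m∸n≤o (d C) 1 (subst (_≤ 1 + δ C) (trans (+-comm (zG C) (δ C)) (δ+zG≡d C)) (+-monoˡ-≤ (δ C) (≮⇒≥ λ z>1 → small (C , eq , z>1))))))
      bound : ∀ C → ⟦ colL C Fin.≟ j ⟧ * (d C ∸ 1) ≤ ⟦ colL C Fin.≟ j ⟧ * (⟦ ¬? (touched? C) ⟧ * (d C ∸ 1)) + δ C * (⟦ colL C Fin.≟ j ⟧ * ⟦ touched? C ⟧)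
      bound C = cases C (colL C Fin.≟ j) (touched? C)

  next : State l k r (suc q) p
  next = record
    { M = M ; W = W ; X = X′ ; lab = lab′ ; labV = labV′ ; colL = colL
    ; mult = mult′ ; degV = degV′ ; degα = degα′ ; colLV = colLV′ ; incident = incident′
    ; linked = linked′ ; hinge = hinge′ ; excess = excess′ }

  next-count : ∀ S j → ∣ S ∣ ≡ 4 → State.count next (false ∷ S) j ≡ count S j
  next-count S j size = ∑-cong es λ e → cong₂ _*_ (trans (∷-≟S (bit (z e)) false (X e) S) (by e (X e ≟S S))) (⟦col′⟧ e j)
    where
    by : ∀ e (S? : Dec (X e ≡ S)) → ⟦ bit (z e) Boolₚ.≟ false ⟧ * ⟦ S? ⟧ ≡ ⟦ S? ⟧
    by e (no _)     = *-zeroʳ ⟦ bit (z e) Boolₚ.≟ false ⟧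
    by e (yes refl) = trans (*-identityʳ _) (cong (λ n → ⟦ bit n Boolₚ.≟ false ⟧) (n≤0⇒n≡0 (≤-trans (z≤t e) (≤-reflexive (m≤n⇒m∸n≡0 (≤-reflexive (sym size)))))))

  single-label : p ≡ 0 → ∀ j v → labV′ j v ≡ rep j
  single-label p≡0 j zero    = refl
  single-label p≡0 j (suc v) = trans (μ-touched (labV j v) touched) (cong rep (colLV j v))
    where
    touched : Touched (labV j v)
    touched = <-≤-trans (hinge z<s j v) (s≤s⁻¹ (subst (d (labV j v) <_)
      (trans (cong (λ p → suc p * zG (labV j v) + suc p) p≡0) (trans (cong (_+ 1) (*-identityˡ (zG (labV j v)))) (+-comm (zG (labV j v)) 1)))
      (proj₂ (groups (labV j v)))))

hits : ∀ {N l k} → Colouring N l k → Subset N → Fin k → ℕ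
hits {l = l} c S j = ∑ (allFin l) (λ i → ⟦ c S i Fin.≟ j ⟧)

deg≡∑ : ∀ {N l k} h (c : Colouring N l k) j v →
        deg h c j v ≡ ∑ (allSubsets N) (λ S → ⟦ ∣ S ∣ ≟ h ⟧ * ((S ∋ v) * hits c S j))
deg≡∑ {N} {l} h c j v =
  trans (length-filter _ (edges N h l))
 (trans (∑-cartesianProduct (filter (λ S → ∣ S ∣ ≟ h) (allSubsets N)) (allFin l) _)
 (trans (∑-filter (λ S → ∣ S ∣ ≟ h) (allSubsets N) _)
        (∑-cong (allSubsets N) λ S → cong (⟦ ∣ S ∣ ≟ h ⟧ *_)
          (trans (∑-cong (allFin l) λ i → trans (⟦⟧-× (v Subsetₚ.∈? S) (c S i Fin.≟ j)) (cong (_* ⟦ c S i Fin.≟ j ⟧) (∋≡⟦∈?⟧ S v)))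
                 (∑-*ˡ (allFin l) (S ∋ v) _)))))

∣++∣ : ∀ {m n} (S : Subset m) (T : Subset n) → ∣ S Vec.++ T ∣ ≡ ∣ S ∣ + ∣ T ∣
∣++∣ []          T = refl
∣++∣ (true ∷ S)  T = cong suc (∣++∣ S T)
∣++∣ (false ∷ S) T = ∣++∣ S T

take-++ : ∀ {m n} {A : Set} (xs : Vec.Vec A m) (ys : Vec.Vec A n) → Vec.take m (xs Vec.++ ys) ≡ xs
take-++ {m} xs ys = Vecₚ.++-injectiveˡ (Vec.take m (xs Vec.++ ys)) xs (Vecₚ.take++drop≡id m (xs Vec.++ ys))

drop-++ : ∀ {m n} {A : Set} (xs : Vec.Vec A m) (ys : Vec.Vec A n) → Vec.drop m (xs Vec.++ ys) ≡ ys
drop-++ {m} xs ys = Vecₚ.++-injectiveʳ (Vec.take m (xs Vec.++ ys)) xs (Vecₚ.take++drop≡id m (xs Vec.++ ys))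

-- State lists the vertices split off from α before the m original ones, Agrees after them.
swapHalves : ∀ m d → Subset (m + d) → Subset (d + m)
swapHalves m d S = Vec.drop m S Vec.++ Vec.take m S

swapHalves-involutive : ∀ m d S → swapHalves d m (swapHalves m d S) ≡ S
swapHalves-involutive m d S = trans (cong₂ Vec._++_ (drop-++ (Vec.drop m S) (Vec.take m S)) (take-++ (Vec.drop m S) (Vec.take m S))) (Vecₚ.take++drop≡id m S)

∣swapHalves∣ : ∀ m d S → ∣ swapHalves m d S ∣ ≡ ∣ S ∣
∣swapHalves∣ m d S = begin
  ∣ Vec.drop m S Vec.++ Vec.take m S ∣     ≡⟨ ∣++∣ (Vec.drop m S) (Vec.take m S) ⟩
  ∣ Vec.drop m S ∣ + ∣ Vec.take m S ∣      ≡⟨ +-comm ∣ Vec.drop m S ∣ _ ⟩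
  ∣ Vec.take m S ∣ + ∣ Vec.drop m S ∣      ≡⟨ ∣++∣ (Vec.take m S) (Vec.drop m S) ⟨
  ∣ Vec.take m S Vec.++ Vec.drop m S ∣     ≡⟨ cong ∣_∣ (Vecₚ.take++drop≡id m S) ⟩
  ∣ S ∣                                    ∎
  where open ≡-Reasoning

swapVertex : ∀ m d → Fin (m + d) → Fin (d + m)
swapVertex m d v = [ d ↑ʳ_ , _↑ˡ m ]′ (splitAt m v)

swapVertex-involutive : ∀ m d v → swapVertex d m (swapVertex m d v) ≡ v
swapVertex-involutive m d v with splitAt m v in eq
... | inj₁ i = trans (cong [ m ↑ʳ_ , _↑ˡ d ]′ (Finₚ.splitAt-↑ʳ d m i)) (Finₚ.splitAt⁻¹-↑ˡ eq)
... | inj₂ i = trans (cong [ m ↑ʳ_ , _↑ˡ d ]′ (Finₚ.splitAt-↑ˡ d i m)) (Finₚ.splitAt⁻¹-↑ʳ eq)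

lookup-swap : ∀ m d (S : Subset (m + d)) v → lookup (swapHalves m d S) (swapVertex m d v) ≡ lookup S v
lookup-swap m d S v with splitAt m v in eq
... | inj₁ i = trans (Vecₚ.lookup-++ʳ (Vec.drop m S) (Vec.take m S) i)
  (trans (sym (Vecₚ.lookup-++ˡ (Vec.take m S) (Vec.drop m S) i)) (cong₂ lookup (Vecₚ.take++drop≡id m S) (Finₚ.splitAt⁻¹-↑ˡ eq)))
... | inj₂ i = trans (Vecₚ.lookup-++ˡ (Vec.drop m S) (Vec.take m S) i)
  (trans (sym (Vecₚ.lookup-++ʳ (Vec.take m S) (Vec.drop m S) i)) (cong₂ lookup (Vecₚ.take++drop≡id m S) (Finₚ.splitAt⁻¹-↑ʳ eq)))

liftSubset≡++ : ∀ m d (S : Subset m) → liftSubset m (m + d) S ≡ S Vec.++ Vec.replicate d false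
liftSubset≡++ m d S = trans (sym (Vecₚ.tabulate∘lookup _)) (trans (Vecₚ.tabulate-cong pointwise) (Vecₚ.tabulate∘lookup _))
  where
  from : ∀ {A : Set} (x : A) {y} → x ≡ y → x ≡ y
  from x eq = eq
  pointwise : ∀ v → lookup (liftSubset m (m + d) S) v ≡ lookup (S Vec.++ Vec.replicate d false) v
  pointwise v with toℕ v <? m | from (lookup (liftSubset m (m + d) S) v) (Vecₚ.lookup∘tabulate _ v)
  ... | yes v<m | eq = trans eq (sym (Vecₚ.lookup-++-< S (Vec.replicate d false) v v<m))
  ... | no v≮m  | eq = trans eq (sym (trans (Vecₚ.lookup-++-≥ S (Vec.replicate d false) v (≮⇒≥ v≮m)) (Vecₚ.lookup-replicate {n = d} _ false)))

distribute : ∀ {M k} l (a : Fin M → ℕ) (col : Fin M → Fin k) → ∑ (allFin M) a ≡ l →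
             Σ (Fin l → Fin k) λ g → ∀ j → ∑ (allFin l) (λ i → ⟦ g i Fin.≟ j ⟧) ≡ ∑ (allFin M) (λ e → a e * ⟦ col e Fin.≟ j ⟧)
distribute {zero}  _ a col refl = (λ ()) , λ j → refl
distribute {suc M} l a col eq with distribute (∑ (allFin M) (a ∘ suc)) (a ∘ suc) (col ∘ suc) refl
... | g , g-count with trans (sym (∑Fin-suc M a)) eq
...   | refl = h , λ j → begin
    ∑ (allFin (a zero + n)) (λ i → ⟦ h i Fin.≟ j ⟧)
      ≡⟨ ∑Fin-↑ (a zero) n (λ i → ⟦ h i Fin.≟ j ⟧) ⟩
    ∑ (allFin (a zero)) (λ i → ⟦ h (i ↑ˡ n) Fin.≟ j ⟧) + ∑ (allFin n) (λ i → ⟦ h (a zero ↑ʳ i) Fin.≟ j ⟧)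
      ≡⟨ cong₂ _+_ (∑-cong (allFin (a zero)) λ i → cong (λ x → ⟦ [ (λ _ → col zero) , g ]′ x Fin.≟ j ⟧) (Finₚ.splitAt-↑ˡ (a zero) i n))
                   (∑-cong (allFin n) λ i → cong (λ x → ⟦ [ (λ _ → col zero) , g ]′ x Fin.≟ j ⟧) (Finₚ.splitAt-↑ʳ (a zero) n i)) ⟩
    ∑ (allFin (a zero)) (λ _ → ⟦ col zero Fin.≟ j ⟧) + ∑ (allFin n) (λ i → ⟦ g i Fin.≟ j ⟧)
      ≡⟨ cong₂ _+_ (∑Fin-const (a zero) ⟦ col zero Fin.≟ j ⟧) (g-count j) ⟩
    a zero * ⟦ col zero Fin.≟ j ⟧ + ∑ (allFin M) (λ e → a (suc e) * ⟦ col (suc e) Fin.≟ j ⟧)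
      ≡⟨ ∑Fin-suc M (λ e → a e * ⟦ col e Fin.≟ j ⟧) ⟨
    ∑ (allFin (suc M)) (λ e → a e * ⟦ col e Fin.≟ j ⟧) ∎
  where
  open ≡-Reasoning
  n : ℕ
  n = ∑ (allFin M) (a ∘ suc)
  h : Fin (a zero + n) → Fin _
  h i = [ (λ _ → col zero) , g ]′ (splitAt (a zero) i)

splitOff : ∀ {l k r m d} → 0 < r → (s₀ : State l k r m d) → ∀ i p → i + p ≡ d →
           Σ (State l k r (i + m) p) λ s →
             (∀ S j → ∣ S ∣ ≡ 4 → State.count s (Vec.replicate i false Vec.++ S) j ≡ State.count s₀ S j) ×
             (0 < i → p ≡ 0 → ∀ j u v → State.labV s j u ≡ State.labV s j v)
splitOff r>0 s₀ zero    p refl = s₀ , (λ _ _ _ → refl) , λ ()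
splitOff {l} {k} {r} {m} r>0 s₀ (suc i) p eq = next ,
  (λ S j size → trans (next-count (Vec.replicate i false Vec.++ S) j (trans (∣++∣ (Vec.replicate i false) S) (trans (cong (_+ ∣ S ∣) (Subsetₚ.∣⊥∣≡0 i)) size)))
                      (proj₁ (proj₂ before) S j size)) ,
  (λ _ p≡0 j u v → trans (single-label p≡0 j u) (sym (single-label p≡0 j v)))
  where
  before : Σ (State l k r (i + m) (suc p)) λ s →
             (∀ S j → ∣ S ∣ ≡ 4 → State.count s (Vec.replicate i false Vec.++ S) j ≡ State.count s₀ S j) ×
             (0 < i → suc p ≡ 0 → ∀ j u v → State.labV s j u ≡ State.labV s j v)
  before = splitOff r>0 s₀ i (suc p) (trans (+-suc i p) eq)
  open Step (proj₁ before) r>0 (stepSelection (proj₁ before))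

reach-trans : ∀ {N l k h} {c : Colouring N l k} {j u v w} → Reach h c j u v → Reach h c j v w → Reach h c j u w
reach-trans here                        b = b
reach-trans (step S i size eq u∈ w∈ a) b = step S i size eq u∈ w∈ (reach-trans a b)

module Final {l k r m d : ℕ} (c : Colouring m l k) (s : State l k r (d + m) 0)
             (count-c : ∀ S j → ∣ S ∣ ≡ 4 → State.count s (Vec.replicate d false Vec.++ S) j ≡ hits c S j)
             (one-label : ∀ j u v → State.labV s j u ≡ State.labV s j v) where
  open State s hiding (d; t)

  es : List (Fin M)
  es = allFin M

  ∣X∣≡4 : ∀ e → ∣ X e ∣ ≡ 4
  ∣X∣≡4 e = ≤-antisym (proj₁ (valid e)) (m∸n≡0⇒m≤n (n≤0⇒n≡0 (proj₂ (valid e))))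

  spread : ∀ S → ∣ S ∣ ≡ 4 → Σ (Fin l → Fin k) λ g → ∀ j → ∑ (allFin l) (λ i → ⟦ g i Fin.≟ j ⟧) ≡ count S j
  spread S size = distribute l (λ e → ⟦ X e ≟S S ⟧) col (trans (mult S) (trans (cong (λ a → l * binom 0 4 a) size) (trans (cong (l *_) (choose-zero 0)) (*-identityʳ l))))

  pick : ∀ S → Dec (∣ S ∣ ≡ 4) → Fin l → Fin k
  pick S (yes size) i = proj₁ (spread S size) i
  pick S (no _)     i = c (Vec.replicate m false) i

  F : Colouring (m + d) l k
  F S i with Vec.drop m S ≟S Vec.replicate d false
  ... | yes _ = c (Vec.take m S) i
  ... | no _  = pick (swapHalves m d S) (∣ swapHalves m d S ∣ ≟ 4) i

  hits-F : ∀ S j → ∣ S ∣ ≡ 4 → hits F S j ≡ count (swapHalves m d S) j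
  hits-F S j size with Vec.drop m S ≟S Vec.replicate d false
  ... | yes eq = sym (trans (cong (λ T → count (T Vec.++ Vec.take m S) j) eq) (count-c (Vec.take m S) j size′))
    where
    size′ : ∣ Vec.take m S ∣ ≡ 4
    size′ = begin
      ∣ Vec.take m S ∣                             ≡⟨ cong (_+ ∣ Vec.take m S ∣) (trans (cong ∣_∣ eq) (Subsetₚ.∣⊥∣≡0 d)) ⟨
      ∣ Vec.drop m S ∣ + ∣ Vec.take m S ∣          ≡⟨ ∣++∣ (Vec.drop m S) (Vec.take m S) ⟨
      ∣ swapHalves m d S ∣                         ≡⟨ ∣swapHalves∣ m d S ⟩
      ∣ S ∣                                        ≡⟨ size ⟩
      4                                            ∎
      where open ≡-Reasoning
  ... | no _ with ∣ swapHalves m d S ∣ ≟ 4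
  ...   | yes size′ = proj₂ (spread (swapHalves m d S) size′) j
  ...   | no ≢4     = contradiction (trans (∣swapHalves∣ m d S) size) ≢4

  agrees : Agrees 4 F c
  agrees S _ i rewrite liftSubset≡++ m d S with Vec.drop m (S Vec.++ Vec.replicate d false) ≟S Vec.replicate d false
  ... | yes _ = cong (λ T → c T i) (take-++ S (Vec.replicate d false))
  ... | no ≢  = contradiction (drop-++ S (Vec.replicate d false)) ≢

  ∋-swap : ∀ S v → swapHalves m d S ∋ swapVertex m d v ≡ S ∋ v
  ∋-swap S v = cong 𝟙 (lookup-swap m d S v)

  edge : Fin M → Subset (m + d)
  edge e = swapHalves d m (X e)

  edge-∋ : ∀ e v → edge e ∋ v ≡ X e ∋ swapVertex m d v
  edge-∋ e v = trans (sym (∋-swap (edge e) v)) (cong (_∋ swapVertex m d v) (swapHalves-involutive d m (X e)))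

  ∣edge∣≡4 : ∀ e → ∣ edge e ∣ ≡ 4
  ∣edge∣≡4 e = trans (∣swapHalves∣ d m (X e)) (∣X∣≡4 e)

  regular : ∀ j v → deg 4 F j v ≡ r
  regular j v = begin
    deg 4 F j v
      ≡⟨ deg≡∑ 4 F j v ⟩
    ∑ (allSubsets (m + d)) (λ S → ⟦ ∣ S ∣ ≟ 4 ⟧ * ((S ∋ v) * hits F S j))
      ≡⟨ ∑-cong (allSubsets (m + d)) (λ S → trans (⟦⟧-*-cong (∣ S ∣ ≟ 4) λ size → cong ((S ∋ v) *_) (hits-F S j size)) (expand S)) ⟩
    ∑ (allSubsets (m + d)) (λ S → ∑ es (λ e → ⟦ S ≟S edge e ⟧ * (⟦ ∣ S ∣ ≟ 4 ⟧ * ((S ∋ v) * ⟦ col e Fin.≟ j ⟧))))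
      ≡⟨ ∑-swap (allSubsets (m + d)) es _ ⟩
    ∑ es (λ e → ∑ (allSubsets (m + d)) (λ S → ⟦ S ≟S edge e ⟧ * (⟦ ∣ S ∣ ≟ 4 ⟧ * ((S ∋ v) * ⟦ col e Fin.≟ j ⟧))))
      ≡⟨ ∑-cong es (λ e → ∑Subsets-⟦≟⟧ (edge e) (λ S → ⟦ ∣ S ∣ ≟ 4 ⟧ * ((S ∋ v) * ⟦ col e Fin.≟ j ⟧))) ⟩
    ∑ es (λ e → ⟦ ∣ edge e ∣ ≟ 4 ⟧ * ((edge e ∋ v) * ⟦ col e Fin.≟ j ⟧))
      ≡⟨ ∑-cong es (λ e → trans (cong (_* ((edge e ∋ v) * ⟦ col e Fin.≟ j ⟧)) (⟦⟧-yes (∣ edge e ∣ ≟ 4) (∣edge∣≡4 e)))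
                         (trans (*-identityˡ _) (trans (*-comm (edge e ∋ v) _) (cong (⟦ col e Fin.≟ j ⟧ *_) (edge-∋ e v))))) ⟩
    ∑ es (λ e → ⟦ col e Fin.≟ j ⟧ * (X e ∋ swapVertex m d v))
      ≡⟨ degV j (swapVertex m d v) ⟩
    r ∎
    where
    open ≡-Reasoning
    lemma : ∀ a b c d → a * (b * (c * d)) ≡ c * (a * (b * d))
    lemma = solve-∀
    ⟦X≟swap⟧ : ∀ S e → ⟦ X e ≟S swapHalves m d S ⟧ ≡ ⟦ S ≟S edge e ⟧
    ⟦X≟swap⟧ S e = ⟦⟧-iff (X e ≟S swapHalves m d S) (S ≟S edge e)
      (λ eq → sym (trans (cong (swapHalves d m) eq) (swapHalves-involutive m d S)))
      (λ eq → sym (trans (cong (swapHalves m d) eq) (swapHalves-involutive d m (X e))))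
    expand : ∀ S → ⟦ ∣ S ∣ ≟ 4 ⟧ * ((S ∋ v) * count (swapHalves m d S) j) ≡
             ∑ es (λ e → ⟦ S ≟S edge e ⟧ * (⟦ ∣ S ∣ ≟ 4 ⟧ * ((S ∋ v) * ⟦ col e Fin.≟ j ⟧)))
    expand S = begin
      ⟦ ∣ S ∣ ≟ 4 ⟧ * ((S ∋ v) * count (swapHalves m d S) j)
        ≡⟨ cong (⟦ ∣ S ∣ ≟ 4 ⟧ *_) (∑-*ˡ es (S ∋ v) _) ⟨
      ⟦ ∣ S ∣ ≟ 4 ⟧ * ∑ es (λ e → (S ∋ v) * (⟦ X e ≟S swapHalves m d S ⟧ * ⟦ col e Fin.≟ j ⟧))
        ≡⟨ ∑-*ˡ es ⟦ ∣ S ∣ ≟ 4 ⟧ _ ⟨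
      ∑ es (λ e → ⟦ ∣ S ∣ ≟ 4 ⟧ * ((S ∋ v) * (⟦ X e ≟S swapHalves m d S ⟧ * ⟦ col e Fin.≟ j ⟧)))
        ≡⟨ ∑-cong es (λ e → trans (lemma ⟦ ∣ S ∣ ≟ 4 ⟧ (S ∋ v) ⟦ X e ≟S swapHalves m d S ⟧ ⟦ col e Fin.≟ j ⟧)
                                  (cong (_* (⟦ ∣ S ∣ ≟ 4 ⟧ * ((S ∋ v) * ⟦ col e Fin.≟ j ⟧))) (⟦X≟swap⟧ S e))) ⟩
      ∑ es (λ e → ⟦ S ≟S edge e ⟧ * (⟦ ∣ S ∣ ≟ 4 ⟧ * ((S ∋ v) * ⟦ col e Fin.≟ j ⟧))) ∎

  copy : ∀ e → ∃[ i ] (F (edge e) i ≡ col e)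
  copy e = i , ⟦⟧>0 (F (edge e) i Fin.≟ col e) (proj₂ found)
    where
    count>0 : 0 < count (X e) (col e)
    count>0 = <-≤-trans (subst (0 <_) (sym (cong₂ _*_ (⟦⟧-yes (X e ≟S X e) refl) (⟦⟧-yes (col e Fin.≟ col e) refl))) z<s)
                        (term≤∑Fin (λ f → ⟦ X f ≟S X e ⟧ * ⟦ col f Fin.≟ col e ⟧) e)
    found : ∃[ i ] (0 < ⟦ F (edge e) i Fin.≟ col e ⟧)
    found = ∑Fin>0 (λ i → ⟦ F (edge e) i Fin.≟ col e ⟧)
      (subst (0 <_) (sym (trans (hits-F (edge e) (col e) (∣edge∣≡4 e)) (cong (λ T → count T (col e)) (swapHalves-involutive d m (X e))))) count>0)
    i : Fin l
    i = proj₁ found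

  Carries : Node M k (d + m) → Fin k → Fin (m + d) → Set
  Carries (inj₁ e)       j v = col e ≡ j × swapVertex m d v ∈ X e
  Carries (inj₂ (i , w)) j v = i ≡ j × swapVertex m d v ≡ w

  Joined : Node M k (d + m) → Node M k (d + m) → Set
  Joined x y = ∀ {i j u v} → Carries x i u → Carries y j v → i ≡ j × Reach 4 F j u v

  reach-edge : ∀ e {u v} → swapVertex m d u ∈ X e → swapVertex m d v ∈ X e → Reach 4 F (col e) u v
  reach-edge e u∈ v∈ = step (edge e) (proj₁ (copy e)) (∣edge∣≡4 e) (proj₂ (copy e)) (transport u∈) (transport v∈) here
    where
    transport : ∀ {u} → swapVertex m d u ∈ X e → u ∈ edge e
    transport {u} u∈ = ∋>0⇒∈ (edge e) u (subst (0 <_) (sym (trans (edge-∋ e u) (∈⇒∋≡1 (X e) u∈))) z<s)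

  swapVertex-injective : ∀ {u v} → swapVertex m d u ≡ swapVertex m d v → u ≡ v
  swapVertex-injective {u} {v} eq = trans (sym (swapVertex-involutive m d u)) (trans (cong (swapVertex d m) eq) (swapVertex-involutive m d v))

  joined-refl : ∀ x → Joined x x
  joined-refl (inj₁ e)       (refl , u∈) (refl , v∈) = refl , reach-edge e u∈ v∈
  joined-refl (inj₂ (i , w)) {u = u} (refl , eq) (refl , eq′) = refl , subst (Reach 4 F i u) (swapVertex-injective (trans eq (sym eq′))) here

  joined : ∀ {x y} → Linked X col x y → Joined x y
  joined {x} ε = joined-refl x
  joined (fwd (meets {e} {w} w∈) ◅ rest) {u = u} {v} (refl , u∈) cy =
    proj₁ later , reach-trans (subst (λ j → Reach 4 F j u _) (proj₁ later) (reach-edge e u∈ (subst (_∈ X e) (sym σw) w∈))) (proj₂ later)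
    where
    σw : swapVertex m d (swapVertex d m w) ≡ w
    σw = swapVertex-involutive d m w
    later : col e ≡ _ × Reach 4 F _ (swapVertex d m w) v
    later = joined rest (refl , σw) cy
  joined (bwd (meets w∈) ◅ rest) (refl , refl) cy = joined rest (refl , w∈) cy

  connected : ∀ j u v → Reach 4 F j u v
  connected j u v = proj₂ (joined (linked (inj₂ (j , swapVertex m d u)) (inj₂ (j , swapVertex m d v)) (one-label j _ _)) (refl , refl) (refl , refl))

  extends : Extends (m + d) 4 r c
  extends = F , (regular , connected) , agrees

-- Counting subsets

⟦suc≟suc⟧ : ∀ a b → ⟦ suc a ≟ suc b ⟧ ≡ ⟦ a ≟ b ⟧
⟦suc≟suc⟧ a b = ⟦⟧-iff (suc a ≟ suc b) (a ≟ b) suc-injective (cong suc)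

∑-size : ∀ m h → ∑ (allSubsets m) (λ S → ⟦ ∣ S ∣ ≟ h ⟧) ≡ m choose h
∑-size zero    zero    = sym (choose-zero 0)
∑-size zero    (suc h) = sym (zero-choose-suc h)
∑-size (suc m) zero    = trans (∑Subsets-suc m _) (trans (cong₂ _+_ (∑-zero (allSubsets m)) (∑-size m 0)) (trans (choose-zero m) (sym (choose-zero (suc m)))))
∑-size (suc m) (suc h) = trans (∑Subsets-suc m _) (trans (cong₂ _+_ (trans (∑-cong (allSubsets m) λ S → ⟦suc≟suc⟧ ∣ S ∣ h) (∑-size m h)) (∑-size m (suc h))) (choose-pascal m h))

∑-size-∋ : ∀ m h (v : Fin (suc m)) → ∑ (allSubsets (suc m)) (λ S → ⟦ ∣ S ∣ ≟ suc h ⟧ * (S ∋ v)) ≡ m choose h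
∑-size-∋ m h zero = trans (∑Subsets-suc m _) (trans (cong₂ _+_
  (trans (∑-cong (allSubsets m) λ S → trans (*-identityʳ _) (⟦suc≟suc⟧ ∣ S ∣ h)) (∑-size m h))
  (trans (∑-cong (allSubsets m) λ S → *-zeroʳ ⟦ ∣ S ∣ ≟ suc h ⟧) (∑-zero (allSubsets m)))) (+-identityʳ _))
∑-size-∋ (suc m) zero (suc v) = trans (∑Subsets-suc (suc m) _) (trans (cong₂ _+_
  (trans (∑-cong (allSubsets (suc m)) λ S → trans (cong (_* (S ∋ v)) (⟦suc≟suc⟧ ∣ S ∣ 0)) (empty S)) (∑-zero (allSubsets (suc m))))
  (∑-size-∋ m 0 v)) (trans (choose-zero m) (sym (choose-zero (suc m)))))
  where
  empty : ∀ S → ⟦ ∣ S ∣ ≟ 0 ⟧ * (S ∋ v) ≡ 0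
  empty S = trans (⟦⟧-*-cong (∣ S ∣ ≟ 0) {b = 0} λ eq → ∑≡0⇒term≡0 (S ∋_) (trans (∑∋≡∣∣ S) eq) (∈ₗ.∈-allFin v)) (*-zeroʳ ⟦ ∣ S ∣ ≟ 0 ⟧)
∑-size-∋ (suc m) (suc h) (suc v) = trans (∑Subsets-suc (suc m) _) (trans (cong₂ _+_
  (trans (∑-cong (allSubsets (suc m)) λ S → cong (_* (S ∋ v)) (⟦suc≟suc⟧ ∣ S ∣ (suc h))) (∑-size-∋ m h v)) (∑-size-∋ m (suc h) v)) (choose-pascal m h))

∑-binom : ∀ m d t → ∑ (allSubsets m) (λ S → binom d t ∣ S ∣) ≡ (m + d) choose t
∑-binom zero    d t       = +-identityʳ _
∑-binom (suc m) d zero    = trans (∑Subsets-suc m _) (trans (cong₂ _+_ (∑-zero (allSubsets m)) (∑-binom m d 0)) (trans (choose-zero (m + d)) (sym (choose-zero (suc m + d)))))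
∑-binom (suc m) d (suc t) = trans (∑Subsets-suc m _) (trans (cong₂ _+_ (∑-binom m d t) (∑-binom m d (suc t))) (choose-pascal (m + d) t))

∑-binom-∋ : ∀ m d t (v : Fin (suc m)) → ∑ (allSubsets (suc m)) (λ S → binom d (suc t) ∣ S ∣ * (S ∋ v)) ≡ (m + d) choose t
∑-binom-∋ m d t zero = trans (∑Subsets-suc m _) (trans (cong₂ _+_
  (trans (∑-cong (allSubsets m) λ S → *-identityʳ _) (∑-binom m d t))
  (trans (∑-cong (allSubsets m) λ S → *-zeroʳ (binom d (suc t) ∣ S ∣)) (∑-zero (allSubsets m)))) (+-identityʳ _))
∑-binom-∋ (suc m) d zero (suc v) = trans (∑Subsets-suc (suc m) _) (trans (cong₂ _+_
  (trans (∑-cong (allSubsets (suc m)) empty) (∑-zero (allSubsets (suc m))))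
  (∑-binom-∋ m d 0 v)) (trans (choose-zero (m + d)) (sym (choose-zero (suc m + d)))))
  where
  empty : ∀ S → binom d 0 ∣ S ∣ * (S ∋ v) ≡ 0
  empty S with ∣ S ∣ in eq
  ... | suc _ = refl
  ... | zero  = trans (cong ((d choose 0) *_) (∑≡0⇒term≡0 (S ∋_) (trans (∑∋≡∣∣ S) eq) (∈ₗ.∈-allFin v))) (*-zeroʳ (d choose 0))
∑-binom-∋ (suc m) d (suc t) (suc v) = trans (∑Subsets-suc (suc m) _) (trans (cong₂ _+_ (∑-binom-∋ m d t v) (∑-binom-∋ m d (suc t) v)) (choose-pascal (m + d) t))

⁅⁆∋ : ∀ {m} (v w : Fin m) → Subset.⁅ v ⁆ ∋ w ≡ ⟦ v Fin.≟ w ⟧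
⁅⁆∋ zero    zero    = refl
⁅⁆∋ zero    (suc w) = cong 𝟙 (Vecₚ.lookup-replicate w false)
⁅⁆∋ (suc v) zero    = refl
⁅⁆∋ (suc v) (suc w) = trans (⁅⁆∋ v w) (⟦⟧-iff (v Fin.≟ w) (suc v Fin.≟ suc w) (cong suc) Finₚ.suc-injective)

∣S∣≡0⇒S≡⊥ : ∀ {m} (S : Subset m) → ∣ S ∣ ≡ 0 → S ≡ Subset.⊥
∣S∣≡0⇒S≡⊥ []          _  = refl
∣S∣≡0⇒S≡⊥ (false ∷ S) eq = cong (false ∷_) (∣S∣≡0⇒S≡⊥ S eq)

∣S∣≡1⇒S≡⁅⁆ : ∀ {m} (S : Subset m) → ∣ S ∣ ≡ 1 → ∃[ v ] (S ≡ Subset.⁅ v ⁆)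
∣S∣≡1⇒S≡⁅⁆ (true ∷ S)  eq = zero , cong (true ∷_) (∣S∣≡0⇒S≡⊥ S (suc-injective eq))
∣S∣≡1⇒S≡⁅⁆ (false ∷ S) eq with ∣S∣≡1⇒S≡⁅⁆ S eq
... | v , refl = suc v , refl

∑Subsets-cancel : ∀ {m} (f g : Subset m → ℕ) S → ∑ (allSubsets m) f ≡ ∑ (allSubsets m) g → (∀ T → T ≢ S → f T ≡ g T) → f S ≡ g S
∑Subsets-cancel {m} f g S eq off = +-cancelˡ-≡ (∑ (allSubsets m) f) (f S) (g S) (begin
  ∑ (allSubsets m) f + f S                                       ≡⟨ cong₂ _+_ eq (sym (∑Subsets-⟦≟⟧ S f)) ⟩
  ∑ (allSubsets m) g + ∑ (allSubsets m) (λ T → ⟦ T ≟S S ⟧ * f T) ≡⟨ ∑-+ (allSubsets m) _ _ ⟨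
  ∑ (allSubsets m) (λ T → g T + ⟦ T ≟S S ⟧ * f T)                ≡⟨ ∑-cong (allSubsets m) (λ T → termwise T (T ≟S S)) ⟩
  ∑ (allSubsets m) (λ T → f T + ⟦ T ≟S S ⟧ * g T)                ≡⟨ ∑-+ (allSubsets m) _ _ ⟩
  ∑ (allSubsets m) f + ∑ (allSubsets m) (λ T → ⟦ T ≟S S ⟧ * g T) ≡⟨ cong (∑ (allSubsets m) f +_) (∑Subsets-⟦≟⟧ S g) ⟩
  ∑ (allSubsets m) f + g S                                       ∎)
  where
  open ≡-Reasoning
  swap : ∀ a b → a + (b + 0) ≡ b + (a + 0)
  swap = solve-∀
  termwise : ∀ T (T? : Dec (T ≡ S)) → g T + ⟦ T? ⟧ * f T ≡ f T + ⟦ T? ⟧ * g T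
  termwise T (yes refl) = swap (g T) (f T)
  termwise T (no T≢S)   = cong (_+ 0) (sym (off T T≢S))

-- Greedy colouring

load : ∀ {m k} → List (Subset m × Fin k) → Fin k → Fin m → ℕ
load xs j v = ∑ xs (λ x → ⟦ proj₂ x Fin.≟ j ⟧ * (proj₁ x ∋ v))

∑-load : ∀ {m k} (xs : List (Subset m × Fin k)) v → ∑ (allFin k) (λ j → load xs j v) ≡ ∑ xs (λ x → proj₁ x ∋ v)
∑-load {k = k} xs v = trans (∑-swap (allFin k) xs _) (∑-cong xs λ x → trans (∑-cong (allFin k) λ j → cong (_* (proj₁ x ∋ v)) (⟦≟⟧-sym Fin._≟_ (proj₂ x) j)) (∑Fin-⟦≟⟧ (proj₂ x) (λ _ → proj₁ x ∋ v)))

freeColour : ∀ {m k} (L : Fin k → Fin m → ℕ) (S : Subset m) r →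
             ∑ (allFin m) (λ v → (S ∋ v) * ∑ (allFin k) (λ j → L j v)) < k * r → ∃[ j ] (∀ v → v ∈ S → L j v < r)
freeColour {m} {k} L S r lt = proj₁ found , λ v v∈S → ≤-<-trans
  (subst (_≤ ∑ (allFin m) (λ v → (S ∋ v) * L (proj₁ found) v)) (trans (cong (_* L (proj₁ found) v) (∈⇒∋≡1 S v∈S)) (*-identityˡ _)) (term≤∑Fin (λ v → (S ∋ v) * L (proj₁ found) v) v)) (proj₂ (proj₂ found))
  where
  found : ∃[ j ] (j ∈ₗ allFin k × ∑ (allFin m) (λ v → (S ∋ v) * L j v) < r)
  found = ∑-<⇒∃ (allFin k) (λ j → ∑ (allFin m) (λ v → (S ∋ v) * L j v)) (λ _ → r)
    (subst₂ _<_ (trans (∑-cong (allFin m) λ v → sym (∑-*ˡ (allFin k) (S ∋ v) _)) (∑-swap (allFin m) (allFin k) _)) (sym (∑Fin-const k r)) lt)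

greedy : ∀ {m k r} (xs : List (Subset m × Fin k)) (Ss : List (Subset m)) → (∀ j v → load xs j v ≤ r) →
         (∀ S → S ∈ₗ Ss → 0 < ∣ S ∣ × ∑ (allFin m) (λ v → (S ∋ v) * (∑ xs (λ x → proj₁ x ∋ v) + ∑ Ss (_∋ v))) ≤ k * r) →
         ∃[ ys ] (map proj₁ ys ≡ Ss × (∀ j v → load (ys ++ xs) j v ≤ r))
greedy xs []       load≤r room = [] , refl , load≤r
greedy {m} {k} {r} xs (S ∷ Ss) load≤r room = (S , j₀) ∷ ys , cong (S ∷_) shape , bound
  where
  rest : ∃[ ys ] (map proj₁ ys ≡ Ss × (∀ j v → load (ys ++ xs) j v ≤ r))
  rest = greedy xs Ss load≤r λ T T∈ → proj₁ (room T (there T∈)) ,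
    ≤-trans (∑-mono (allFin m) λ v → *-monoʳ-≤ (T ∋ v) (+-monoʳ-≤ (∑ xs (λ x → proj₁ x ∋ v)) (m≤n+m (∑ Ss (_∋ v)) (S ∋ v)))) (proj₂ (room T (there T∈)))
  ys : List (Subset m × Fin k)
  ys = proj₁ rest
  shape : map proj₁ ys ≡ Ss
  shape = proj₁ (proj₂ rest)
  ∑-ys : ∀ v → ∑ (ys ++ xs) (λ x → proj₁ x ∋ v) ≡ ∑ xs (λ x → proj₁ x ∋ v) + ∑ Ss (_∋ v)
  ∑-ys v = trans (∑-++ ys xs _) (trans (+-comm (∑ ys _) _) (cong (∑ xs (λ x → proj₁ x ∋ v) +_) (trans (sym (∑-map proj₁ ys (_∋ v))) (cong (λ Ts → ∑ Ts (_∋ v)) shape))))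
  S∋² : ∀ v → (S ∋ v) * (S ∋ v) ≡ S ∋ v
  S∋² v with lookup S v
  ... | true  = refl
  ... | false = refl
  crowded : ∑ (allFin m) (λ v → (S ∋ v) * ∑ (allFin k) (λ j → load (ys ++ xs) j v)) < k * r
  crowded = begin-strict
    ∑ (allFin m) (λ v → (S ∋ v) * ∑ (allFin k) (λ j → load (ys ++ xs) j v))
      ≡⟨ ∑-cong (allFin m) (λ v → cong ((S ∋ v) *_) (trans (∑-load (ys ++ xs) v) (∑-ys v))) ⟩
    ∑ (allFin m) (λ v → (S ∋ v) * (∑ xs (λ x → proj₁ x ∋ v) + ∑ Ss (_∋ v)))
      <⟨ m<n+m _ (proj₁ (room S (here refl))) ⟩
    ∣ S ∣ + ∑ (allFin m) (λ v → (S ∋ v) * (∑ xs (λ x → proj₁ x ∋ v) + ∑ Ss (_∋ v)))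
      ≡⟨ cong (_+ ∑ (allFin m) (λ v → (S ∋ v) * (∑ xs (λ x → proj₁ x ∋ v) + ∑ Ss (_∋ v)))) (trans (sym (∑∋≡∣∣ S)) (∑-cong (allFin m) λ v → sym (S∋² v))) ⟩
    ∑ (allFin m) (λ v → (S ∋ v) * (S ∋ v)) + ∑ (allFin m) (λ v → (S ∋ v) * (∑ xs (λ x → proj₁ x ∋ v) + ∑ Ss (_∋ v)))
      ≡⟨ ∑-+ (allFin m) _ _ ⟨
    ∑ (allFin m) (λ v → (S ∋ v) * (S ∋ v) + (S ∋ v) * (∑ xs (λ x → proj₁ x ∋ v) + ∑ Ss (_∋ v)))
      ≡⟨ ∑-cong (allFin m) (λ v → lemma (S ∋ v) (∑ xs (λ x → proj₁ x ∋ v)) (∑ Ss (_∋ v))) ⟩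
    ∑ (allFin m) (λ v → (S ∋ v) * (∑ xs (λ x → proj₁ x ∋ v) + ((S ∋ v) + ∑ Ss (_∋ v))))
      ≤⟨ proj₂ (room S (here refl)) ⟩
    k * r ∎
    where
    open ≤-Reasoning
    lemma : ∀ a b c → a * a + a * (b + c) ≡ a * (b + (a + c))
    lemma = solve-∀
  free : ∃[ j ] (∀ v → v ∈ S → load (ys ++ xs) j v < r)
  free = freeColour (load (ys ++ xs)) S r crowded
  j₀ : Fin k
  j₀ = proj₁ free
  bound : ∀ j v → ⟦ j₀ Fin.≟ j ⟧ * (S ∋ v) + load (ys ++ xs) j v ≤ r
  bound j v with j₀ Fin.≟ j | v Subsetₚ.∈? S
  ... | no _     | _        = proj₂ (proj₂ rest) j v
  ... | yes refl | yes v∈S  = subst (λ a → 1 * a + load (ys ++ xs) j v ≤ r) (sym (∈⇒∋≡1 S v∈S)) (proj₂ free v v∈S)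
  ... | yes refl | no v∉S   = subst (λ a → 1 * a + load (ys ++ xs) j v ≤ r) (sym (n≤0⇒n≡0 (≮⇒≥ λ lt → v∉S (∋>0⇒∈ S v lt)))) (proj₂ (proj₂ rest) j v)

unionFind : ∀ {A : Set} {R : A → A → Set} (_≟A_ : DecidableEquality A) (ps : List (∃[ a ] ∃[ b ] R a b)) →
            Σ (A → A) λ find → (∀ {a b Rab} → (a , b , Rab) ∈ₗ ps → find a ≡ find b) × (∀ x → EqClosure R x (find x))
unionFind {R = R} _≟A_ [] = id , (λ ()) , λ x → ε
unionFind {A} {R} _≟A_ ((a , b , Rab) ∷ ps) = find′ , same , related
  where
  rest : Σ (A → A) λ find → (∀ {a b Rab} → (a , b , Rab) ∈ₗ ps → find a ≡ find b) × (∀ x → EqClosure R x (find x))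
  rest = unionFind _≟A_ ps
  find : A → A
  find = proj₁ rest
  redirect : A → A
  redirect x with x ≟A find b
  ... | yes _ = find a
  ... | no _  = x
  find′ : A → A
  find′ x = redirect (find x)
  same : ∀ {a′ b′ Rab′} → (a′ , b′ , Rab′) ∈ₗ ((a , b , Rab) ∷ ps) → find′ a′ ≡ find′ b′
  same (there p∈)  = cong redirect (proj₁ (proj₂ rest) p∈)
  same (here refl) with find a ≟A find b | find b ≟A find b
  ... | yes eq | yes _ = refl
  ... | no _   | yes _ = refl
  ... | _      | no ≢  = contradiction refl ≢
  related : ∀ x → EqClosure R x (find′ x)
  related x with find x ≟A find b
  ... | no _   = proj₂ (proj₂ rest) x
  ... | yes eq = EqClosure.transitive R (subst (EqClosure R x) eq (proj₂ (proj₂ rest) x))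
    (EqClosure.transitive R (EqClosure.symmetric R (proj₂ (proj₂ rest) b)) (bwd Rab ◅ proj₂ (proj₂ rest) a))

-- The edges of the initial amalgamated colouring

base : ∀ {m l k} → Colouring m l k → List (Subset m × Fin k)
base {m} {l} c = map (λ x → proj₁ x , c (proj₁ x) (proj₂ x)) (edges m 4 l)

∑-base : ∀ {m l k} (c : Colouring m l k) F →
         ∑ (base c) F ≡ ∑ (allSubsets m) (λ S → ⟦ ∣ S ∣ ≟ 4 ⟧ * ∑ (allFin l) (λ i → F (S , c S i)))
∑-base {m} {l} c F = trans (∑-map _ (edges m 4 l) F)
  (trans (∑-cartesianProduct (filter (λ S → ∣ S ∣ ≟ 4) (allSubsets m)) (allFin l) _) (∑-filter (λ S → ∣ S ∣ ≟ 4) (allSubsets m) _))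

load-base : ∀ {m l k} (c : Colouring m l k) j v → load (base c) j v ≡ deg 4 c j v
load-base {m} {l} c j v = trans (∑-base c (λ x → ⟦ proj₂ x Fin.≟ j ⟧ * (proj₁ x ∋ v)))
  (trans (∑-cong (allSubsets m) λ S → cong (⟦ ∣ S ∣ ≟ 4 ⟧ *_) (trans (∑-*ʳ (allFin l) (S ∋ v) _) (*-comm _ (S ∋ v)))) (sym (deg≡∑ 4 c j v)))

record Amalgam {m l k : ℕ} (r d : ℕ) (c : Colouring m l k) : Set where
  field
    xs others : List (Subset m × Fin k)
    split     : xs ≡ others ++ base c
    small     : ∀ {x} → x ∈ₗ others → ∣ proj₁ x ∣ ≢ 4
    mult      : ∀ S → ∑ xs (λ x → ⟦ proj₁ x ≟S S ⟧) ≡ l * binom d 4 ∣ S ∣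
    loads     : ∀ j v → load xs j v ≡ r
    hinges    : ∀ j → ∑ xs (λ x → ⟦ proj₂ x Fin.≟ j ⟧ * (4 ∸ ∣ proj₁ x ∣)) ≡ r * d

module Build {m′ d l k r g : ℕ} (c : Colouring (suc m′) l k) (partial : ∀ j v → deg 4 c j v ≤ r)
             (kr≡ : k * r ≡ l * ((m′ + d) choose 3)) (4g≡ : 4 * g ≡ r * (suc m′ + d)) (3m≤d : 3 * suc m′ ≤ d) where

  m : ℕ
  m = suc m′

  w : Subset m → ℕ
  w S = l * binom d 4 ∣ S ∣

  -- the number of edges of size suc h at a vertex
  K : ℕ → ℕ
  K h = l * binom d 4 (suc h) * (m′ choose h)

  sized : ℕ → (Subset m → ℕ) → ℕ
  sized h f = ∑ (allSubsets m) (λ S → ⟦ ∣ S ∣ ≟ h ⟧ * (w S * f S))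

  sized-zero : ∀ h f → (∀ S → ∣ S ∣ ≡ h → f S ≡ 0) → sized h f ≡ 0
  sized-zero h f f≡0 = trans (∑-cong (allSubsets m) λ S → trans (⟦⟧-*-cong (∣ S ∣ ≟ h) λ eq → trans (cong (w S *_) (f≡0 S eq)) (*-zeroʳ (w S))) (*-zeroʳ ⟦ ∣ S ∣ ≟ h ⟧)) (∑-zero (allSubsets m))

  sized-at : ∀ h S → sized h (λ T → ⟦ T ≟S S ⟧) ≡ ⟦ ∣ S ∣ ≟ h ⟧ * w S
  sized-at h S = trans (∑-cong (allSubsets m) λ T → lemma ⟦ ∣ T ∣ ≟ h ⟧ (w T) ⟦ T ≟S S ⟧) (∑Subsets-⟦≟⟧ S (λ T → ⟦ ∣ T ∣ ≟ h ⟧ * w T))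
    where
    lemma : ∀ a b c → a * (b * c) ≡ c * (a * b)
    lemma = solve-∀

  sized-∋ : ∀ h v → sized (suc h) (_∋ v) ≡ K h
  sized-∋ h v = trans (∑-cong (allSubsets m) λ S → trans (⟦⟧-*-cong (∣ S ∣ ≟ suc h) λ eq → cong (λ a → l * binom d 4 a * (S ∋ v)) eq) (lemma ⟦ ∣ S ∣ ≟ suc h ⟧ (l * binom d 4 (suc h)) (S ∋ v)))
    (trans (∑-*ˡ (allSubsets m) (l * binom d 4 (suc h)) _) (cong (l * binom d 4 (suc h) *_) (∑-size-∋ m′ h v)))
    where
    lemma : ∀ a b c → a * (b * c) ≡ b * (a * c)
    lemma = solve-∀

  slots : ℕ → List (Subset m)
  slots h = concatMap (λ S → replicate (w S) S) (filter (λ S → ∣ S ∣ ≟ h) (allSubsets m))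

  ∑-slots : ∀ h f → ∑ (slots h) f ≡ sized h f
  ∑-slots h f = trans (∑-concatMap (λ S → replicate (w S) S) (filter (λ S → ∣ S ∣ ≟ h) (allSubsets m)) f)
    (trans (∑-filter (λ S → ∣ S ∣ ≟ h) (allSubsets m) _) (∑-cong (allSubsets m) λ S → cong (⟦ ∣ S ∣ ≟ h ⟧ *_) (∑-replicate (w S) S f)))

  slots-size : ∀ {h S} → S ∈ₗ slots h → ∣ S ∣ ≡ h
  slots-size {h} {S} S∈ = Dec.decidable-stable (∣ S ∣ ≟ h) λ ≢h →
    contradiction (trans (sym (⟦⟧-yes (¬? (∣ S ∣ ≟ h)) ≢h)) (∑≡0⇒term≡0 (λ S → ⟦ ¬? (∣ S ∣ ≟ h) ⟧)
      (trans (∑-slots h (λ S → ⟦ ¬? (∣ S ∣ ≟ h) ⟧)) (sized-zero h _ λ T eq → ⟦⟧-no (¬? (∣ T ∣ ≟ h)) λ ne → ne eq)) S∈)) λ ()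

  ∑-shaped : ∀ h (ys : List (Subset m × Fin k)) → map proj₁ ys ≡ slots h → ∀ f → ∑ ys (f ∘ proj₁) ≡ sized h f
  ∑-shaped h ys shape f = trans (sym (∑-map proj₁ ys f)) (trans (cong (λ Ss → ∑ Ss f) shape) (∑-slots h f))

  ∑-base-shape : ∀ f → ∑ (base c) (f ∘ proj₁) ≡ sized 4 f
  ∑-base-shape f = trans (∑-base c (f ∘ proj₁)) (∑-cong (allSubsets m) λ S → ⟦⟧-*-cong (∣ S ∣ ≟ 4) λ eq →
    trans (∑Fin-const l (f S)) (cong (_* f S) (sym (trans (cong (λ a → l * binom d 4 a) eq) (trans (cong (l *_) (choose-zero d)) (*-identityʳ l))))))

  Greedy : ℕ → List (Subset m × Fin k) → Set
  Greedy h zs = ∃[ ys ] (map proj₁ ys ≡ slots h × (∀ j v → load (ys ++ zs) j v ≤ r))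

  extend : ∀ h zs D → (∀ j v → load zs j v ≤ r) → (∀ v → ∑ zs (λ x → proj₁ x ∋ v) + sized (suc h) (_∋ v) ≡ D) → suc h * D ≤ k * r → Greedy (suc h) zs
  extend h zs D bounded D≡ room = greedy zs (slots (suc h)) bounded λ S S∈ → subst (0 <_) (sym (slots-size S∈)) z<s , (begin
    ∑ (allFin m) (λ v → (S ∋ v) * (∑ zs (λ x → proj₁ x ∋ v) + ∑ (slots (suc h)) (_∋ v)))
      ≡⟨ ∑-cong (allFin m) (λ v → cong ((S ∋ v) *_) (trans (cong (∑ zs (λ x → proj₁ x ∋ v) +_) (∑-slots (suc h) (_∋ v))) (D≡ v))) ⟩
    ∑ (allFin m) (λ v → (S ∋ v) * D)
      ≡⟨ ∑-*ʳ (allFin m) D (S ∋_) ⟩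
    ∑ (allFin m) (S ∋_) * D
      ≡⟨ cong (_* D) (trans (∑∋≡∣∣ S) (slots-size S∈)) ⟩
    suc h * D
      ≤⟨ room ⟩
    k * r ∎)
    where open ≤-Reasoning

  triples : 3 * (K 3 + K 2) ≤ k * r → Greedy 3 (base c)
  triples = extend 2 (base c) (K 3 + K 2) (λ j v → subst (_≤ r) (sym (load-base c j v)) (partial j v))
    (λ v → cong₂ _+_ (trans (∑-base-shape (_∋ v)) (sized-∋ 3 v)) (sized-∋ 2 v))

  pairs : ((ys , _) : Greedy 3 (base c)) → 2 * (K 3 + K 2 + K 1) ≤ k * r → Greedy 2 (ys ++ base c)
  pairs (ys , shape , bounded) = extend 1 (ys ++ base c) (K 3 + K 2 + K 1) bounded
    (λ v → cong₂ _+_ (trans (∑-++ ys (base c) _) (trans (cong₂ _+_ (trans (∑-shaped 3 ys shape (_∋ v)) (sized-∋ 2 v)) (trans (∑-base-shape (_∋ v)) (sized-∋ 3 v))) (+-comm (K 2) (K 3)))) (sized-∋ 1 v))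

  module Complete (three : Greedy 3 (base c)) (two : Greedy 2 (proj₁ three ++ base c)) where

    greedyEdges core : List (Subset m × Fin k)
    greedyEdges = proj₁ two ++ proj₁ three
    core        = greedyEdges ++ base c

    core≡ : core ≡ proj₁ two ++ (proj₁ three ++ base c)
    core≡ = Listₚ.++-assoc (proj₁ two) (proj₁ three) (base c)

    ∑-greedy : ∀ f → ∑ greedyEdges (f ∘ proj₁) ≡ sized 2 f + sized 3 f
    ∑-greedy f = trans (∑-++ (proj₁ two) (proj₁ three) _) (cong₂ _+_ (∑-shaped 2 (proj₁ two) (proj₁ (proj₂ two)) f) (∑-shaped 3 (proj₁ three) (proj₁ (proj₂ three)) f))

    ∑-core : ∀ f → ∑ core (f ∘ proj₁) ≡ sized 2 f + sized 3 f + sized 4 f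
    ∑-core f = trans (∑-++ greedyEdges (base c) _) (cong₂ _+_ (∑-greedy f) (∑-base-shape f))

    deficit : Fin k → Fin m → ℕ
    deficit j v = r ∸ load core j v

    singles : List (Subset m × Fin k)
    singles = concatMap (λ v → concatMap (λ j → replicate (deficit j v) (Subset.⁅ v ⁆ , j)) (allFin k)) (allFin m)

    ∑-singles : ∀ F → ∑ singles F ≡ ∑ (allFin m) (λ v → ∑ (allFin k) (λ j → deficit j v * F (Subset.⁅ v ⁆ , j)))
    ∑-singles F = trans (∑-concatMap (λ v → concatMap (λ j → replicate (deficit j v) (Subset.⁅ v ⁆ , j)) (allFin k)) (allFin m) F) (∑-cong (allFin m) λ v →
      trans (∑-concatMap (λ j → replicate (deficit j v) (Subset.⁅ v ⁆ , j)) (allFin k) F) (∑-cong (allFin k) λ j → ∑-replicate (deficit j v) (Subset.⁅ v ⁆ , j) F))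

    ∑-singles-zero : ∀ f → (∀ S → ∣ S ∣ ≡ 1 → f S ≡ 0) → ∑ singles (f ∘ proj₁) ≡ 0
    ∑-singles-zero f f≡0 = trans (∑-singles (f ∘ proj₁)) (trans (∑-cong (allFin m) λ v → trans (∑-cong (allFin k) λ j →
      trans (cong (deficit j v *_) (f≡0 Subset.⁅ v ⁆ (Subsetₚ.∣⁅x⁆∣≡1 v))) (*-zeroʳ (deficit j v))) (∑-zero (allFin k))) (∑-zero (allFin m)))

    load-singles : ∀ j v → load singles j v ≡ deficit j v
    load-singles j v = begin
      load singles j v
        ≡⟨ ∑-singles (λ x → ⟦ proj₂ x Fin.≟ j ⟧ * (proj₁ x ∋ v)) ⟩
      ∑ (allFin m) (λ u → ∑ (allFin k) (λ i → deficit i u * (⟦ i Fin.≟ j ⟧ * (Subset.⁅ u ⁆ ∋ v))))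
        ≡⟨ ∑-cong (allFin m) (λ u → trans (∑-cong (allFin k) λ i → trans (cong (λ a → deficit i u * (⟦ i Fin.≟ j ⟧ * a)) (⁅⁆∋ u v)) (lemma (deficit i u) ⟦ i Fin.≟ j ⟧ ⟦ u Fin.≟ v ⟧))
                                          (trans (∑-*ˡ (allFin k) ⟦ u Fin.≟ v ⟧ _) (cong (⟦ u Fin.≟ v ⟧ *_) (∑Fin-⟦≟⟧ j (λ i → deficit i u))))) ⟩
      ∑ (allFin m) (λ u → ⟦ u Fin.≟ v ⟧ * deficit j u)
        ≡⟨ ∑Fin-⟦≟⟧ v (deficit j) ⟩
      deficit j v ∎
      where
      open ≡-Reasoning
      lemma : ∀ a b c → a * (b * c) ≡ c * (b * a)
      lemma = solve-∀

    filled : List (Subset m × Fin k)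
    filled = singles ++ core

    load-filled : ∀ j v → load filled j v ≡ r
    load-filled j v = trans (∑-++ singles core _) (trans (cong (_+ load core j v) (load-singles j v))
      (m∸n+n≡m (subst (λ zs → load zs j v ≤ r) (sym core≡) (proj₂ (proj₂ two) j v))))

    filled-nonempty : ∀ {x} → x ∈ₗ filled → 0 < ∣ proj₁ x ∣
    filled-nonempty {x} x∈ = n≢0⇒n>0 λ eq → contradiction
      (trans (sym (⟦⟧-yes (∣ proj₁ x ∣ ≟ 0) eq)) (∑≡0⇒term≡0 (λ x → ⟦ ∣ proj₁ x ∣ ≟ 0 ⟧) total x∈)) λ ()
      where
      empty : ∀ h (S : Subset m) → ∣ S ∣ ≡ suc h → ⟦ ∣ S ∣ ≟ 0 ⟧ ≡ 0
      empty h S eq = ⟦⟧-no (∣ S ∣ ≟ 0) λ eq′ → 1+n≢0 (trans (sym eq) eq′)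
      f : Subset m → ℕ
      f S = ⟦ ∣ S ∣ ≟ 0 ⟧
      total : ∑ filled (f ∘ proj₁) ≡ 0
      total = trans (∑-++ singles core _) (cong₂ _+_ (∑-singles-zero f (empty 0))
        (trans (∑-core f) (cong₂ _+_ (cong₂ _+_ (sized-zero 2 f (empty 1)) (sized-zero 3 f (empty 2))) (sized-zero 4 f (empty 3)))))

    used : Fin k → ℕ
    used j = ∑ filled (λ x → ⟦ proj₂ x Fin.≟ j ⟧)

    size-sum : ∀ (zs : List (Subset m × Fin k)) j → ∑ zs (λ x → ⟦ proj₂ x Fin.≟ j ⟧ * ∣ proj₁ x ∣) ≡ ∑ (allFin m) (λ v → load zs j v)
    size-sum zs j = sym (trans (∑-swap (allFin m) zs _) (∑-cong zs λ x → trans (∑-*ˡ (allFin m) ⟦ proj₂ x Fin.≟ j ⟧ (proj₁ x ∋_)) (cong (⟦ proj₂ x Fin.≟ j ⟧ *_) (∑∋≡∣∣ (proj₁ x)))))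

    used≤g : ∀ j → used j ≤ g
    used≤g j = *-cancelˡ-≤ 4 (begin
      4 * used j                 ≤⟨ *-monoʳ-≤ 4 (∑-mono∈ filled λ x x∈ → m≤m*n ⟦ proj₂ x Fin.≟ j ⟧ ∣ proj₁ x ∣ {{>-nonZero (filled-nonempty x∈)}}) ⟩
      4 * ∑ filled (λ x → ⟦ proj₂ x Fin.≟ j ⟧ * ∣ proj₁ x ∣)
                                 ≡⟨ cong (4 *_) (trans (size-sum filled j) (trans (∑-cong (allFin m) (load-filled j)) (∑Fin-const m r))) ⟩
      4 * (m * r)                ≡⟨ lemma m r ⟩
      r * (m + 3 * m)            ≤⟨ *-monoʳ-≤ r (+-monoʳ-≤ m 3m≤d) ⟩
      r * (m + d)                ≡⟨ 4g≡ ⟨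
      4 * g                      ∎)
      where
      open ≤-Reasoning
      lemma : ∀ m r → 4 * (m * r) ≡ r * (m + 3 * m)
      lemma = solve-∀

    pures : List (Subset m × Fin k)
    pures = concatMap (λ j → replicate (g ∸ used j) (Subset.⊥ , j)) (allFin k)

    ∑-pures : ∀ F → ∑ pures F ≡ ∑ (allFin k) (λ j → (g ∸ used j) * F (Subset.⊥ , j))
    ∑-pures F = trans (∑-concatMap (λ j → replicate (g ∸ used j) (Subset.⊥ , j)) (allFin k) F) (∑-cong (allFin k) λ j → ∑-replicate (g ∸ used j) (Subset.⊥ , j) F)

    ∑-pures-zero : ∀ F → (∀ j → F (Subset.⊥ , j) ≡ 0) → ∑ pures F ≡ 0
    ∑-pures-zero F F≡0 = trans (∑-pures F) (trans (∑-cong (allFin k) λ j → trans (cong ((g ∸ used j) *_) (F≡0 j)) (*-zeroʳ (g ∸ used j))) (∑-zero (allFin k)))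

    xs : List (Subset m × Fin k)
    xs = pures ++ filled

    ∑-xs : ∀ F → ∑ xs F ≡ ∑ pures F + (∑ singles F + ∑ core F)
    ∑-xs F = trans (∑-++ pures filled F) (cong (∑ pures F +_) (∑-++ singles core F))

    ⊥∋ : ∀ v → Subset.⊥ {m} ∋ v ≡ 0
    ⊥∋ v = cong 𝟙 (Vecₚ.lookup-replicate v false)

    load-xs : ∀ j v → load xs j v ≡ r
    load-xs j v = trans (∑-++ pures filled _) (trans (cong (_+ load filled j v)
      (∑-pures-zero _ λ i → trans (cong (⟦ i Fin.≟ j ⟧ *_) (⊥∋ v)) (*-zeroʳ ⟦ i Fin.≟ j ⟧))) (load-filled j v))

    total-xs : ∀ j → ∑ xs (λ x → ⟦ proj₂ x Fin.≟ j ⟧) ≡ g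
    total-xs j = trans (∑-++ pures filled _) (trans (cong (_+ used j) (trans (∑-pures _)
      (trans (∑-cong (allFin k) λ i → *-comm (g ∸ used i) _) (∑Fin-⟦≟⟧ j (λ i → g ∸ used i))))) (m∸n+n≡m (used≤g j)))

    cnt : Subset m → ℕ
    cnt S = ∑ xs (λ x → ⟦ proj₁ x ≟S S ⟧)

    ≟S-no : ∀ (T S : Subset m) → ∣ T ∣ ≢ ∣ S ∣ → ⟦ T ≟S S ⟧ ≡ 0
    ≟S-no T S ne = ⟦⟧-no (T ≟S S) λ eq → ne (cong ∣_∣ eq)

    only-234 : ∀ a → 2 ≤ a → let b = l * binom d 4 a in ⟦ a ≟ 2 ⟧ * b + ⟦ a ≟ 3 ⟧ * b + ⟦ a ≟ 4 ⟧ * b ≡ b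
    only-234 0 ()
    only-234 1 (s≤s ())
    only-234 2 _ = trans (+-identityʳ _) (trans (+-identityʳ _) (*-identityˡ _))
    only-234 3 _ = trans (+-identityʳ _) (*-identityˡ _)
    only-234 4 _ = *-identityˡ _
    only-234 (suc (suc (suc (suc (suc a))))) _ = sym (*-zeroʳ l)

    cnt≥2 : ∀ S → 2 ≤ ∣ S ∣ → cnt S ≡ w S
    cnt≥2 S 2≤ = trans (∑-xs (λ x → ⟦ proj₁ x ≟S S ⟧)) (trans (cong₂ _+_
      (∑-pures-zero (λ x → ⟦ proj₁ x ≟S S ⟧) λ j → ≟S-no Subset.⊥ S λ eq → <⇒≢ (<-≤-trans z<s 2≤) (trans (sym (Subsetₚ.∣⊥∣≡0 m)) eq))
      (cong (_+ ∑ core (λ x → ⟦ proj₁ x ≟S S ⟧)) (∑-singles-zero (λ T → ⟦ T ≟S S ⟧) λ T eq → ≟S-no T S λ eq′ → <⇒≢ 2≤ (trans (sym eq) eq′))))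
      (trans (∑-core (λ T → ⟦ T ≟S S ⟧)) (trans (cong₂ _+_ (cong₂ _+_ (sized-at 2 S) (sized-at 3 S)) (sized-at 4 S)) (only-234 ∣ S ∣ 2≤))))

    ∑-cnt : ∀ f → ∑ (allSubsets m) (λ S → cnt S * f S) ≡ ∑ xs (f ∘ proj₁)
    ∑-cnt f = trans (∑-cong (allSubsets m) λ S → cong (_* f S) (∑-cong xs λ x → sym (*-identityʳ _)))
      (trans (∑-fibre _≟S_ (allSubsets m) ∑Subsets-once xs proj₁ (λ _ → 1) f) (∑-cong xs λ x → *-identityˡ _))

    cnt-⁅⁆ : ∀ v → cnt Subset.⁅ v ⁆ ≡ w Subset.⁅ v ⁆
    cnt-⁅⁆ v = *-cancelʳ-≡ _ _ (Subset.⁅ v ⁆ ∋ v) {{>-nonZero (subst (0 <_) (sym v∈v) z<s)}}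
      (∑Subsets-cancel (λ S → cnt S * (S ∋ v)) (λ S → w S * (S ∋ v)) Subset.⁅ v ⁆ totals λ T T≢ → off T T≢ ∣ T ∣ refl)
      where
      v∈v : Subset.⁅ v ⁆ ∋ v ≡ 1
      v∈v = trans (⁅⁆∋ v v) (⟦⟧-yes (v Fin.≟ v) refl)
      totals : ∑ (allSubsets m) (λ S → cnt S * (S ∋ v)) ≡ ∑ (allSubsets m) (λ S → w S * (S ∋ v))
      totals = begin
        ∑ (allSubsets m) (λ S → cnt S * (S ∋ v))        ≡⟨ ∑-cnt (_∋ v) ⟩
        ∑ xs (λ x → proj₁ x ∋ v)                        ≡⟨ ∑-load xs v ⟨
        ∑ (allFin k) (λ j → load xs j v)                ≡⟨ ∑-cong (allFin k) (λ j → load-xs j v) ⟩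
        ∑ (allFin k) (λ _ → r)                          ≡⟨ ∑Fin-const k r ⟩
        k * r                                           ≡⟨ kr≡ ⟩
        l * ((m′ + d) choose 3)                         ≡⟨ cong (l *_) (∑-binom-∋ m′ d 3 v) ⟨
        l * ∑ (allSubsets m) (λ S → binom d 4 ∣ S ∣ * (S ∋ v)) ≡⟨ ∑-*ˡ (allSubsets m) l _ ⟨
        ∑ (allSubsets m) (λ S → l * (binom d 4 ∣ S ∣ * (S ∋ v))) ≡⟨ ∑-cong (allSubsets m) (λ S → *-assoc l _ _) ⟨
        ∑ (allSubsets m) (λ S → w S * (S ∋ v))          ∎
        where open ≡-Reasoning
      absent : ∀ T → T ∋ v ≡ 0 → cnt T * (T ∋ v) ≡ w T * (T ∋ v)
      absent T eq = trans (cong (cnt T *_) eq) (trans (trans (*-zeroʳ (cnt T)) (sym (*-zeroʳ (w T)))) (cong (w T *_) (sym eq)))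
      off : ∀ T → T ≢ Subset.⁅ v ⁆ → ∀ a → ∣ T ∣ ≡ a → cnt T * (T ∋ v) ≡ w T * (T ∋ v)
      off T T≢ 0 eq = absent T (trans (cong (_∋ v) (∣S∣≡0⇒S≡⊥ T eq)) (⊥∋ v))
      off T T≢ 1 eq with ∣S∣≡1⇒S≡⁅⁆ T eq
      ... | u , refl = absent T (trans (⁅⁆∋ u v) (⟦⟧-no (u Fin.≟ v) λ { refl → T≢ refl }))
      off T T≢ (suc (suc a)) eq = cong (_* (T ∋ v)) (cnt≥2 T (subst (2 ≤_) (sym eq) (s≤s (s≤s z≤n))))

    cnt≥1 : ∀ S a → ∣ S ∣ ≡ suc a → cnt S ≡ w S
    cnt≥1 S (suc a) eq = cnt≥2 S (subst (2 ≤_) (sym eq) (s≤s (s≤s z≤n)))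
    cnt≥1 S zero    eq with ∣S∣≡1⇒S≡⁅⁆ S eq
    ... | v , refl = cnt-⁅⁆ v

    kg≡ : k * g ≡ l * ((m + d) choose 4)
    kg≡ = *-cancelˡ-≡ _ _ 4 (begin
      4 * (k * g)                                ≡⟨ lemma₁ k g ⟩
      k * (4 * g)                                ≡⟨ cong (k *_) 4g≡ ⟩
      k * (r * (m + d))                          ≡⟨ *-assoc k r (m + d) ⟨
      k * r * (m + d)                            ≡⟨ cong (_* (m + d)) kr≡ ⟩
      l * ((m′ + d) choose 3) * (m + d)          ≡⟨ lemma₂ l ((m′ + d) choose 3) (m + d) ⟩
      l * ((m + d) * ((m′ + d) choose 3))        ≡⟨ cong (l *_) (absorption (m′ + d) 3) ⟨
      l * (4 * ((m + d) choose 4))               ≡⟨ lemma₁ l ((m + d) choose 4) ⟨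
      4 * (l * ((m + d) choose 4))               ∎)
      where
      open ≡-Reasoning
      lemma₁ : ∀ a b → 4 * (a * b) ≡ a * (4 * b)
      lemma₁ = solve-∀
      lemma₂ : ∀ a b c → a * b * c ≡ a * (c * b)
      lemma₂ = solve-∀

    cnt-⊥ : cnt Subset.⊥ ≡ w Subset.⊥
    cnt-⊥ = ∑Subsets-cancel cnt w Subset.⊥ totals λ T T≢ → off T T≢ ∣ T ∣ refl
      where
      totals : ∑ (allSubsets m) cnt ≡ ∑ (allSubsets m) w
      totals = begin
        ∑ (allSubsets m) cnt                            ≡⟨ ∑-cong (allSubsets m) (λ S → *-identityʳ (cnt S)) ⟨
        ∑ (allSubsets m) (λ S → cnt S * 1)              ≡⟨ ∑-cnt (λ _ → 1) ⟩
        ∑ xs (λ _ → 1)                                  ≡⟨ ∑-cong xs (λ x → ∑Fin-once (proj₂ x)) ⟨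
        ∑ xs (λ x → ∑ (allFin k) (λ j → ⟦ j Fin.≟ proj₂ x ⟧)) ≡⟨ ∑-swap xs (allFin k) _ ⟩
        ∑ (allFin k) (λ j → ∑ xs (λ x → ⟦ j Fin.≟ proj₂ x ⟧)) ≡⟨ ∑-cong (allFin k) (λ j → trans (∑-cong xs λ x → ⟦≟⟧-sym Fin._≟_ j (proj₂ x)) (total-xs j)) ⟩
        ∑ (allFin k) (λ _ → g)                          ≡⟨ ∑Fin-const k g ⟩
        k * g                                           ≡⟨ kg≡ ⟩
        l * ((m + d) choose 4)                          ≡⟨ cong (l *_) (∑-binom m d 4) ⟨
        l * ∑ (allSubsets m) (λ S → binom d 4 ∣ S ∣)    ≡⟨ ∑-*ˡ (allSubsets m) l _ ⟨
        ∑ (allSubsets m) w                              ∎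
        where open ≡-Reasoning
      off : ∀ T → T ≢ Subset.⊥ → ∀ a → ∣ T ∣ ≡ a → cnt T ≡ w T
      off T T≢ zero    eq = contradiction (∣S∣≡0⇒S≡⊥ T eq) T≢
      off T T≢ (suc a) eq = cnt≥1 T a eq

    cnt≡w : ∀ S → cnt S ≡ w S
    cnt≡w S = by ∣ S ∣ refl
      where
      by : ∀ a → ∣ S ∣ ≡ a → cnt S ≡ w S
      by (suc a) eq = cnt≥1 S a eq
      by zero    eq = subst (λ T → cnt T ≡ w T) (sym (∣S∣≡0⇒S≡⊥ S eq)) cnt-⊥

    size≤4 : ∀ {x} → x ∈ₗ xs → ∣ proj₁ x ∣ ≤ 4
    size≤4 {x} x∈ = proj₁ (binom>0 d 4 ∣ proj₁ x ∣ (proj₂ (m*n>0 l _ (subst (0 <_) (cnt≡w (proj₁ x))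
      (<-≤-trans (subst (0 <_) (sym (⟦⟧-yes (proj₁ x ≟S proj₁ x) refl)) z<s) (term≤∑ (λ y → ⟦ proj₁ y ≟S proj₁ x ⟧) x∈))))))

    hinges-xs : ∀ j → ∑ xs (λ x → ⟦ proj₂ x Fin.≟ j ⟧ * (4 ∸ ∣ proj₁ x ∣)) ≡ r * d
    hinges-xs j = +-cancelʳ-≡ (m * r) _ _ (begin
      ∑ xs (λ x → ⟦ proj₂ x Fin.≟ j ⟧ * (4 ∸ ∣ proj₁ x ∣)) + m * r
        ≡⟨ cong (∑ xs (λ x → ⟦ proj₂ x Fin.≟ j ⟧ * (4 ∸ ∣ proj₁ x ∣)) +_) (sym (trans (size-sum xs j) (trans (∑-cong (allFin m) (load-xs j)) (∑Fin-const m r)))) ⟩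
      ∑ xs (λ x → ⟦ proj₂ x Fin.≟ j ⟧ * (4 ∸ ∣ proj₁ x ∣)) + ∑ xs (λ x → ⟦ proj₂ x Fin.≟ j ⟧ * ∣ proj₁ x ∣)
        ≡⟨ ∑-+ xs _ _ ⟨
      ∑ xs (λ x → ⟦ proj₂ x Fin.≟ j ⟧ * (4 ∸ ∣ proj₁ x ∣) + ⟦ proj₂ x Fin.≟ j ⟧ * ∣ proj₁ x ∣)
        ≡⟨ ∑-cong∈ xs (λ x x∈ → trans (sym (*-distribˡ-+ ⟦ proj₂ x Fin.≟ j ⟧ _ _)) (cong (⟦ proj₂ x Fin.≟ j ⟧ *_) (m∸n+n≡m (size≤4 x∈)))) ⟩
      ∑ xs (λ x → ⟦ proj₂ x Fin.≟ j ⟧ * 4)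
        ≡⟨ trans (∑-*ʳ xs 4 _) (cong (_* 4) (total-xs j)) ⟩
      g * 4
        ≡⟨ trans (*-comm g 4) 4g≡ ⟩
      r * (m + d)
        ≡⟨ lemma r m d ⟩
      r * d + m * r ∎)
      where
      open ≡-Reasoning
      lemma : ∀ r m d → r * (m + d) ≡ r * d + m * r
      lemma = solve-∀

    amalgam : Amalgam r d c
    amalgam = record
      { xs = xs ; others = pures ++ (singles ++ greedyEdges)
      ; split = trans (cong (pures ++_) (sym (Listₚ.++-assoc singles greedyEdges (base c)))) (sym (Listₚ.++-assoc pures (singles ++ greedyEdges) (base c)))
      ; small = small ; mult = cnt≡w ; loads = load-xs ; hinges = hinges-xs }
      where
      f : Subset m → ℕ
      f S = ⟦ ∣ S ∣ ≟ 4 ⟧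
      f-no : ∀ a (S : Subset m) → a ≢ 4 → ∣ S ∣ ≡ a → f S ≡ 0
      f-no a S a≢4 eq = ⟦⟧-no (∣ S ∣ ≟ 4) λ eq′ → a≢4 (trans (sym eq) eq′)
      none : ∑ (pures ++ (singles ++ greedyEdges)) (f ∘ proj₁) ≡ 0
      none = trans (∑-++ pures (singles ++ greedyEdges) _) (cong₂ _+_ (∑-pures-zero (f ∘ proj₁) λ j → f-no 0 Subset.⊥ (λ ()) (Subsetₚ.∣⊥∣≡0 m))
        (trans (∑-++ singles greedyEdges _) (cong₂ _+_ (∑-singles-zero f λ S → f-no 1 S λ ())
          (trans (∑-greedy f) (cong₂ _+_ (sized-zero 2 f λ S → f-no 2 S λ ()) (sized-zero 3 f λ S → f-no 3 S λ ()))))))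
      small : ∀ {x} → x ∈ₗ (pures ++ (singles ++ greedyEdges)) → ∣ proj₁ x ∣ ≢ 4
      small {x} x∈ eq = contradiction (trans (sym (⟦⟧-yes (∣ proj₁ x ∣ ≟ 4) eq)) (∑≡0⇒term≡0 (f ∘ proj₁) none x∈)) λ ()

  build : 3 * (K 3 + K 2) ≤ k * r → 2 * (K 3 + K 2 + K 1) ≤ k * r → Amalgam r d c
  build room₃ room₂ = Complete.amalgam (triples room₃) (pairs (triples room₃) room₂)

-- The initial state

module Initial {m d l k r : ℕ} (c : Colouring m l k) (A : Amalgam r d c) (norep : NoRegularComponent 4 r c)
               (wide : 4 * m + 4 * d ≤ 3 * (r * d) + 4) where
  open Amalgam A

  M : ℕ
  M = length xs

  es : List (Fin M)
  es = allFin M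

  X : Fin M → Subset m
  X e = proj₁ (List.lookup xs e)

  colour : Fin M → Fin k
  colour e = proj₂ (List.lookup xs e)

  R : Node M k m → Node M k m → Set
  R = Incident X colour

  incidencesAt : ∀ e v → Dec (v ∈ X e) → List (∃[ x ] ∃[ y ] R x y)
  incidencesAt e v (yes v∈) = (inj₁ e , inj₂ (colour e , v) , meets v∈) ∷ []
  incidencesAt e v (no _)   = []

  incidences : List (∃[ x ] ∃[ y ] R x y)
  incidences = concatMap (λ e → concatMap (λ v → incidencesAt e v (v Subsetₚ.∈? X e)) (allFin m)) es

  incidence∈ : ∀ e v → v ∈ X e → ∃[ p ] ((inj₁ e , inj₂ (colour e , v) , p) ∈ₗ incidences)
  incidence∈ e v v∈ = proj₁ found , ∈ₗ.∈-concatMap⁺ (λ e → concatMap (λ v → incidencesAt e v (v Subsetₚ.∈? X e)) (allFin m))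
    (lose (∈ₗ.∈-allFin e) (∈ₗ.∈-concatMap⁺ (λ v → incidencesAt e v (v Subsetₚ.∈? X e)) (lose (∈ₗ.∈-allFin v) (proj₂ found))))
    where
    locate : (v∈? : Dec (v ∈ X e)) → ∃[ p ] ((inj₁ e , inj₂ (colour e , v) , p) ∈ₗ incidencesAt e v v∈?)
    locate (yes v∈′) = meets v∈′ , here refl
    locate (no v∉)   = contradiction v∈ v∉
    found : ∃[ p ] ((inj₁ e , inj₂ (colour e , v) , p) ∈ₗ incidencesAt e v (v Subsetₚ.∈? X e))
    found = locate (v Subsetₚ.∈? X e)

  _≟N_ : DecidableEquality (Node M k m)
  _≟N_ = ⊎ₚ.≡-dec Fin._≟_ (×ₚ.≡-dec Fin._≟_ Fin._≟_)

  components : Σ (Node M k m → Node M k m) λ find → (∀ {a b Rab} → (a , b , Rab) ∈ₗ incidences → find a ≡ find b) × (∀ x → EqClosure R x (find x))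
  components = unionFind _≟N_ incidences

  find : Node M k m → Node M k m
  find = proj₁ components

  find-incident : ∀ e v → v ∈ X e → find (inj₁ e) ≡ find (inj₂ (colour e , v))
  find-incident e v v∈ = proj₁ (proj₂ components) (proj₂ (incidence∈ e v v∈))

  find-related : ∀ x → EqClosure R x (find x)
  find-related = proj₂ (proj₂ components)

  W : ℕ
  W = M + k * m

  encode : Node M k m → Fin W
  encode = [ _↑ˡ (k * m) , (λ jv → M ↑ʳ Fin.combine (proj₁ jv) (proj₂ jv)) ]′

  decode : Fin W → Node M k m
  decode C = Sum.map₂ (Fin.remQuot m) (splitAt M C)

  decode-encode : ∀ x → decode (encode x) ≡ x
  decode-encode (inj₁ e)       = cong (Sum.map₂ (Fin.remQuot m)) (Finₚ.splitAt-↑ˡ M e (k * m))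
  decode-encode (inj₂ (j , v)) = trans (cong (Sum.map₂ (Fin.remQuot m)) (Finₚ.splitAt-↑ʳ M (k * m) (Fin.combine j v))) (cong inj₂ (Finₚ.remQuot-combine j v))

  encode-injective : ∀ {x y} → encode x ≡ encode y → x ≡ y
  encode-injective {x} {y} eq = trans (sym (decode-encode x)) (trans (cong decode eq) (decode-encode y))

  nodeColour : Node M k m → Fin k
  nodeColour = [ colour , proj₁ ]′

  nodeColour-linked : ∀ {x y} → EqClosure R x y → nodeColour x ≡ nodeColour y
  nodeColour-linked ε                     = refl
  nodeColour-linked (fwd (meets _) ◅ rest) = nodeColour-linked rest
  nodeColour-linked (bwd (meets _) ◅ rest) = nodeColour-linked rest

  label : Node M k m → Fin W
  label x = encode (find x)

  colL : Fin W → Fin k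
  colL C = nodeColour (decode C)

  colL-label : ∀ x → colL (label x) ≡ nodeColour x
  colL-label x = trans (cong nodeColour (decode-encode (find x))) (sym (nodeColour-linked (find-related x)))

  lab : Fin M → Fin W
  lab e = label (inj₁ e)

  labV : Fin k → Fin m → Fin W
  labV j v = label (inj₂ (j , v))

  col : Fin M → Fin k
  col e = colL (lab e)

  col≡ : ∀ e → col e ≡ colour e
  col≡ e = colL-label (inj₁ e)

  t : Fin M → ℕ
  t e = 4 ∸ ∣ X e ∣

  hingesOf : Fin W → ℕ
  hingesOf C = ∑ es (λ e → ⟦ lab e Fin.≟ C ⟧ * t e)

  incident : ∀ e v → v ∈ X e → labV (col e) v ≡ lab e
  incident e v v∈ = trans (cong (λ j → labV j v) (col≡ e)) (cong encode (sym (find-incident e v v∈)))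

  label-linked : ∀ x y → label x ≡ label y → Linked X col x y
  label-linked x y eq = EqClosure.map recolour (EqClosure.transitive R (subst (EqClosure R x) (encode-injective eq) (find-related x)) (EqClosure.symmetric R (find-related y)))
    where
    recolour : ∀ {x y} → R x y → Incident X col x y
    recolour (meets {e} {v} v∈) = subst (λ j → Incident X col (inj₁ e) (inj₂ (j , v))) (col≡ e) (meets v∈)

  index : ∀ {x} → x ∈ₗ xs → ∃[ e ] (List.lookup xs e ≡ x)
  index x∈ = Any.index x∈ , sym (Anyₚ.lookup-index x∈)

  size≤4 : ∀ e → ∣ X e ∣ ≤ 4
  size≤4 e = proj₁ (binom>0 d 4 ∣ X e ∣ (proj₂ (m*n>0 l _ (subst (0 <_) (mult (X e))
    (<-≤-trans (subst (0 <_) (sym (⟦⟧-yes (X e ≟S X e) refl)) z<s) (term≤∑ {xs = xs} (λ y → ⟦ proj₁ y ≟S X e ⟧) (∈ₗ.∈-lookup {xs = xs} e)))))))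

  reach-label : ∀ {j u v} → Reach 4 c j u v → labV j u ≡ labV j v
  reach-label here = refl
  reach-label (step {u = u} {w} S i size refl u∈ w∈ rest) = trans (trans (at u∈) (sym (at w∈))) (reach-label rest)
    where
    member : (S , c S i) ∈ₗ xs
    member = subst ((S , c S i) ∈ₗ_) (sym split) (∈ₗ.∈-++⁺ʳ others
      (∈ₗ.∈-map⁺ _ (∈ₗ.∈-cartesianProduct⁺ (∈ₗ.∈-filter⁺ (λ S → ∣ S ∣ ≟ 4) (∈-allSubsets S) size) (∈ₗ.∈-allFin i))))
    e : Fin M
    e = proj₁ (index member)
    at : ∀ {v} → v ∈ S → labV (c S i) v ≡ lab e
    at {v} v∈ = trans (cong (λ j → label (inj₂ (j , v))) (sym (cong proj₂ (proj₂ (index member)))))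
      (cong encode (sym (find-incident e v (subst (v ∈_) (sym (cong proj₁ (proj₂ (index member)))) v∈))))

  hinge : ∀ j v → 0 < hingesOf (labV j v)
  hinge j v = n≢0⇒n>0 λ none → norep j v λ w reach → regular none w (reach-label reach)
    where
    regular : hingesOf (labV j v) ≡ 0 → ∀ w → labV j v ≡ labV j w → deg 4 c j w ≡ r
    regular none w same = begin
      deg 4 c j w                          ≡⟨ load-base c j w ⟨
      load (base c) j w                    ≡⟨ cong (_+ load (base c) j w) others≡0 ⟨
      load others j w + load (base c) j w  ≡⟨ ∑-++ others (base c) _ ⟨
      load (others ++ base c) j w          ≡⟨ cong (λ ys → load ys j w) split ⟨
      load xs j w                          ≡⟨ loads j w ⟩
      r                                    ∎
      where
      open ≡-Reasoning
      absent : ∀ x → x ∈ₗ others → ⟦ proj₂ x Fin.≟ j ⟧ * (proj₁ x ∋ w) ≡ 0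
      absent x x∈ = n≤0⇒n≡0 (≮⇒≥ λ pos → present (m*n>0 ⟦ proj₂ x Fin.≟ j ⟧ (proj₁ x ∋ w) pos))
        where
        present : 0 < ⟦ proj₂ x Fin.≟ j ⟧ × 0 < proj₁ x ∋ w → ⊥
        present (j-ok , w-in) = <⇒≢ t>0 (sym (trans (sym (trans (cong (_* t e) (⟦⟧-yes (lab e Fin.≟ labV j v) lab≡)) (*-identityˡ (t e)))) (∑≡0⇒term≡0 (λ f → ⟦ lab f Fin.≟ labV j v ⟧ * t f) none (∈ₗ.∈-allFin e))))
          where
          found : ∃[ e ] (List.lookup xs e ≡ x)
          found = index (subst (x ∈ₗ_) (sym split) (∈ₗ.∈-++⁺ˡ x∈))
          e : Fin M
          e = proj₁ found
          t>0 : 0 < t e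
          t>0 = m<n⇒0<n∸m (≤∧≢⇒< (size≤4 e) λ eq → small x∈ (trans (cong ∣_∣ (sym (cong proj₁ (proj₂ found)))) eq))
          w∈ : w ∈ X e
          w∈ = subst (w ∈_) (sym (cong proj₁ (proj₂ found))) (∋>0⇒∈ (proj₁ x) w w-in)
          lab≡ : lab e ≡ labV j v
          lab≡ = trans (cong encode (find-incident e w w∈)) (trans (cong (λ i → labV i w) (trans (cong proj₂ (proj₂ found)) (⟦⟧>0 (proj₂ x Fin.≟ j) j-ok))) (sym same))
      others≡0 : load others j w ≡ 0
      others≡0 = trans (∑-cong∈ others absent) (∑-zero others)

  ∑-col : ∀ (j : Fin k) (f : Subset m → ℕ) → ∑ es (λ e → ⟦ col e Fin.≟ j ⟧ * f (X e)) ≡ ∑ xs (λ x → ⟦ proj₂ x Fin.≟ j ⟧ * f (proj₁ x))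
  ∑-col j f = trans (∑-cong es λ e → cong (λ i → ⟦ i Fin.≟ j ⟧ * f (X e)) (col≡ e)) (∑Fin-lookup xs (λ x → ⟦ proj₂ x Fin.≟ j ⟧ * f (proj₁ x)))

  degα : ∀ j → ∑ es (λ e → ⟦ col e Fin.≟ j ⟧ * t e) ≡ r * d
  degα j = trans (∑-col j (λ S → 4 ∸ ∣ S ∣)) (hinges j)

  pure : Fin k → Fin M → ℕ
  pure j e = ⟦ col e Fin.≟ j ⟧ * ⟦ ∣ X e ∣ ≟ 0 ⟧

  4*pure≤ : ∀ j → 4 * ∑ es (pure j) ≤ r * d
  4*pure≤ j = subst₂ _≤_ (∑-*ˡ es 4 (pure j)) (degα j) (∑-mono es λ e → bound ⟦ col e Fin.≟ j ⟧ ∣ X e ∣)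
    where
    bound : ∀ a b → 4 * (a * ⟦ b ≟ 0 ⟧) ≤ a * (4 ∸ b)
    bound a zero    = ≤-reflexive (lemma a)
      where
      lemma : ∀ a → 4 * (a * 1) ≡ a * 4
      lemma = solve-∀
    bound a (suc b) = ≤-trans (≤-reflexive (cong (4 *_) (*-zeroʳ a))) z≤n

  excessOf : Fin k → ℕ
  excessOf j = ∑ (allFin W) (λ C → ⟦ colL C Fin.≟ j ⟧ * (hingesOf C ∸ 1))

  occupied : ∀ j C → ⟦ colL C Fin.≟ j ⟧ * hingesOf C ≤
             ⟦ colL C Fin.≟ j ⟧ * (hingesOf C ∸ 1) + (∑ es (λ e → ⟦ lab e Fin.≟ C ⟧ * pure j e) + ∑ (allFin m) (λ v → ⟦ labV j v Fin.≟ C ⟧ * 1))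
  occupied j C = by (colL C Fin.≟ j) (0 <? hingesOf C)
    where
    N : ℕ
    N = ∑ es (λ e → ⟦ lab e Fin.≟ C ⟧ * pure j e) + ∑ (allFin m) (λ v → ⟦ labV j v Fin.≟ C ⟧ * 1)
    N>0 : colL C ≡ j → 0 < hingesOf C → 0 < N
    N>0 refl pos = inhabited (∣ X e ∣ ≟ 0)
      where
      found : ∃[ e ] (0 < ⟦ lab e Fin.≟ C ⟧ * t e)
      found = ∑Fin>0 (λ e → ⟦ lab e Fin.≟ C ⟧ * t e) pos
      e : Fin M
      e = proj₁ found
      lab≡ : lab e ≡ C
      lab≡ = ⟦⟧>0 (lab e Fin.≟ C) (proj₁ (m*n>0 ⟦ lab e Fin.≟ C ⟧ (t e) (proj₂ found)))
      inhabited : Dec (∣ X e ∣ ≡ 0) → 0 < N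
      inhabited (yes eq) = <-≤-trans (<-≤-trans (subst (0 <_) (sym (cong₂ _*_ (⟦⟧-yes (lab e Fin.≟ C) lab≡) (cong₂ _*_ (⟦⟧-yes (col e Fin.≟ colL C) (cong colL lab≡)) (⟦⟧-yes (∣ X e ∣ ≟ 0) eq)))) z<s)
        (term≤∑Fin (λ e → ⟦ lab e Fin.≟ C ⟧ * pure (colL C) e) e)) (m≤m+n _ _)
      inhabited (no ne) = <-≤-trans (<-≤-trans (subst (0 <_) (sym (cong (_* 1) (⟦⟧-yes (labV (colL C) v Fin.≟ C) labV≡))) z<s)
        (term≤∑Fin (λ v → ⟦ labV (colL C) v Fin.≟ C ⟧ * 1) v)) (m≤n+m _ _)
        where
        inside-X : ∃[ v ] (0 < X e ∋ v)
        inside-X = ∑Fin>0 (X e ∋_) (subst (0 <_) (sym (∑∋≡∣∣ (X e))) (n≢0⇒n>0 ne))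
        v : Fin m
        v = proj₁ inside-X
        labV≡ : labV (colL C) v ≡ C
        labV≡ = trans (cong (λ D → labV (colL D) v) (sym lab≡)) (trans (incident e v (∋>0⇒∈ (X e) v (proj₂ inside-X))) lab≡)
    by : (c? : Dec (colL C ≡ j)) → Dec (0 < hingesOf C) → ⟦ c? ⟧ * hingesOf C ≤ ⟦ c? ⟧ * (hingesOf C ∸ 1) + N
    by (no _)   _          = z≤n
    by (yes eq) (yes pos)  = begin
      1 * hingesOf C                 ≡⟨ *-identityˡ _ ⟩
      hingesOf C                     ≡⟨ m∸n+n≡m pos ⟨
      (hingesOf C ∸ 1) + 1           ≤⟨ +-mono-≤ (≤-reflexive (sym (*-identityˡ _))) (N>0 eq pos) ⟩
      1 * (hingesOf C ∸ 1) + N       ∎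
      where open ≤-Reasoning
    by (yes eq) (no ¬pos) = ≤-trans (≤-reflexive (trans (*-identityˡ _) (n≤0⇒n≡0 (≮⇒≥ ¬pos)))) z≤n

  excess : ∀ j → d ≤ suc (excessOf j)
  excess j = *-cancelˡ-≤ 4 (+-cancelˡ-≤ (3 * (r * d)) _ _ (+-cancelˡ-≤ (4 * (A₀ + m)) _ _ (begin
    4 * (A₀ + m) + (3 * (r * d) + 4 * d)                ≡⟨ lemma₁ A₀ m (r * d) d ⟩
    4 * A₀ + 3 * (r * d) + (4 * m + 4 * d)              ≤⟨ +-mono-≤ (+-monoˡ-≤ (3 * (r * d)) (4*pure≤ j)) wide ⟩
    r * d + 3 * (r * d) + (3 * (r * d) + 4)             ≡⟨ lemma₂ (r * d) ⟩
    4 * (r * d) + (3 * (r * d) + 4)                     ≤⟨ +-monoˡ-≤ (3 * (r * d) + 4) (*-monoʳ-≤ 4 rd≤) ⟩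
    4 * (excessOf j + (A₀ + m)) + (3 * (r * d) + 4)     ≡⟨ lemma₃ (excessOf j) (A₀ + m) (r * d) ⟩
    4 * (A₀ + m) + (3 * (r * d) + 4 * suc (excessOf j)) ∎)))
    where
    open ≤-Reasoning
    A₀ : ℕ
    A₀ = ∑ es (pure j)
    lemma₁ : ∀ a m x d → 4 * (a + m) + (3 * x + 4 * d) ≡ 4 * a + 3 * x + (4 * m + 4 * d)
    lemma₁ = solve-∀
    lemma₂ : ∀ x → x + 3 * x + (3 * x + 4) ≡ 4 * x + (3 * x + 4)
    lemma₂ = solve-∀
    lemma₃ : ∀ e a x → 4 * (e + a) + (3 * x + 4) ≡ 4 * a + (3 * x + 4 * suc e)
    lemma₃ = solve-∀
    collect : ∀ {B : Set} (ys : List B) (f : B → Fin W) (h : B → ℕ) → ∑ (allFin W) (λ C → ∑ ys (λ y → ⟦ f y Fin.≟ C ⟧ * h y)) ≡ ∑ ys h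
    collect ys f h = trans (∑-cong (allFin W) λ C → sym (*-identityʳ _)) (trans (∑Fin-fibre ys f h (λ _ → 1)) (∑-cong ys λ y → *-identityʳ (h y)))
    rd≤ : r * d ≤ excessOf j + (A₀ + m)
    rd≤ = begin
      r * d
        ≡⟨ degα j ⟨
      ∑ es (λ e → ⟦ col e Fin.≟ j ⟧ * t e)
        ≡⟨ ∑-cong es (λ e → *-comm (t e) _) ⟨
      ∑ es (λ e → t e * ⟦ col e Fin.≟ j ⟧)
        ≡⟨ ∑Fin-fibre es lab t (λ C → ⟦ colL C Fin.≟ j ⟧) ⟨
      ∑ (allFin W) (λ C → hingesOf C * ⟦ colL C Fin.≟ j ⟧)
        ≡⟨ ∑-cong (allFin W) (λ C → *-comm (hingesOf C) _) ⟩
      ∑ (allFin W) (λ C → ⟦ colL C Fin.≟ j ⟧ * hingesOf C)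
        ≤⟨ ∑-mono (allFin W) (occupied j) ⟩
      ∑ (allFin W) (λ C → ⟦ colL C Fin.≟ j ⟧ * (hingesOf C ∸ 1) + (∑ es (λ e → ⟦ lab e Fin.≟ C ⟧ * pure j e) + ∑ (allFin m) (λ v → ⟦ labV j v Fin.≟ C ⟧ * 1)))
        ≡⟨ trans (∑-+ (allFin W) _ _) (cong (excessOf j +_) (∑-+ (allFin W) _ _)) ⟩
      excessOf j + (∑ (allFin W) (λ C → ∑ es (λ e → ⟦ lab e Fin.≟ C ⟧ * pure j e)) + ∑ (allFin W) (λ C → ∑ (allFin m) (λ v → ⟦ labV j v Fin.≟ C ⟧ * 1)))
        ≡⟨ cong (excessOf j +_) (cong₂ _+_ (collect es lab (pure j)) (trans (collect (allFin m) (labV j) (λ _ → 1)) (trans (∑Fin-const m 1) (*-identityʳ m)))) ⟩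
      excessOf j + (A₀ + m) ∎

  initial : State l k r m d
  initial = record
    { M = M ; W = W ; X = X ; lab = lab ; labV = labV ; colL = colL
    ; mult     = λ S → trans (∑Fin-lookup xs (λ x → ⟦ proj₁ x ≟S S ⟧)) (mult S)
    ; degV     = λ j v → trans (∑-col j (_∋ v)) (loads j v)
    ; degα     = degα
    ; colLV    = λ j v → colL-label (inj₂ (j , v))
    ; incident = incident
    ; linked   = λ x y eq → label-linked x y (trans (sym (labN≡ x)) (trans eq (labN≡ y)))
    ; hinge    = λ _ → hinge
    ; excess   = excess
    }
    where
    labN≡ : ∀ x → [ lab , (λ jv → labV (proj₁ jv) (proj₂ jv)) ]′ x ≡ label x
    labN≡ (inj₁ e)       = refl
    labN≡ (inj₂ (j , v)) = refl

  initial-count : ∀ S j → ∣ S ∣ ≡ 4 → State.count initial S j ≡ hits c S j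
  initial-count S j size = begin
    ∑ es (λ e → ⟦ X e ≟S S ⟧ * ⟦ col e Fin.≟ j ⟧)
      ≡⟨ ∑-cong es (λ e → *-comm ⟦ X e ≟S S ⟧ _) ⟩
    ∑ es (λ e → ⟦ col e Fin.≟ j ⟧ * ⟦ X e ≟S S ⟧)
      ≡⟨ ∑-col j (λ T → ⟦ T ≟S S ⟧) ⟩
    ∑ xs (λ x → ⟦ proj₂ x Fin.≟ j ⟧ * ⟦ proj₁ x ≟S S ⟧)
      ≡⟨ trans (cong (λ ys → ∑ ys (λ x → ⟦ proj₂ x Fin.≟ j ⟧ * ⟦ proj₁ x ≟S S ⟧)) split) (∑-++ others (base c) _) ⟩
    ∑ others (λ x → ⟦ proj₂ x Fin.≟ j ⟧ * ⟦ proj₁ x ≟S S ⟧) + ∑ (base c) (λ x → ⟦ proj₂ x Fin.≟ j ⟧ * ⟦ proj₁ x ≟S S ⟧)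
      ≡⟨ cong₂ _+_ (trans (∑-cong∈ others λ x x∈ → trans (cong (⟦ proj₂ x Fin.≟ j ⟧ *_) (⟦⟧-no (proj₁ x ≟S S) λ eq → small x∈ (trans (cong ∣_∣ eq) size))) (*-zeroʳ ⟦ proj₂ x Fin.≟ j ⟧)) (∑-zero others))
                   (∑-base c (λ x → ⟦ proj₂ x Fin.≟ j ⟧ * ⟦ proj₁ x ≟S S ⟧)) ⟩
    ∑ (allSubsets m) (λ T → ⟦ ∣ T ∣ ≟ 4 ⟧ * ∑ (allFin l) (λ i → ⟦ c T i Fin.≟ j ⟧ * ⟦ T ≟S S ⟧))
      ≡⟨ ∑-cong (allSubsets m) (λ T → trans (cong (⟦ ∣ T ∣ ≟ 4 ⟧ *_) (∑-*ʳ (allFin l) ⟦ T ≟S S ⟧ _)) (lemma ⟦ ∣ T ∣ ≟ 4 ⟧ (hits c T j) ⟦ T ≟S S ⟧)) ⟩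
    ∑ (allSubsets m) (λ T → ⟦ T ≟S S ⟧ * (⟦ ∣ T ∣ ≟ 4 ⟧ * hits c T j))
      ≡⟨ ∑Subsets-⟦≟⟧ S (λ T → ⟦ ∣ T ∣ ≟ 4 ⟧ * hits c T j) ⟩
    ⟦ ∣ S ∣ ≟ 4 ⟧ * hits c S j
      ≡⟨ trans (cong (_* hits c S j) (⟦⟧-yes (∣ S ∣ ≟ 4) size)) (*-identityˡ _) ⟩
    hits c S j ∎
    where
    open ≡-Reasoning
    lemma : ∀ a b c → a * (b * c) ≡ c * (a * b)
    lemma = solve-∀

-- Necessity

∑-hits : ∀ {N l k} (c : Colouring N l k) S → ∑ (allFin k) (hits c S) ≡ l
∑-hits {l = l} {k} c S = begin
  ∑ (allFin k) (λ j → ∑ (allFin l) (λ i → ⟦ c S i Fin.≟ j ⟧))  ≡⟨ ∑-swap (allFin k) (allFin l) _ ⟩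
  ∑ (allFin l) (λ i → ∑ (allFin k) (λ j → ⟦ c S i Fin.≟ j ⟧))  ≡⟨ ∑-cong (allFin l) (λ i → trans (∑-cong (allFin k) λ j → ⟦≟⟧-sym Fin._≟_ (c S i) j) (∑Fin-once (c S i))) ⟩
  ∑ (allFin l) (λ _ → 1)                                        ≡⟨ trans (∑Fin-const l 1) (*-identityʳ l) ⟩
  l                                                             ∎
  where open ≡-Reasoning

∑-deg-colours : ∀ {N l k} (c : Colouring (suc N) l k) v → ∑ (allFin k) (λ j → deg 4 c j v) ≡ l * (N choose 3)
∑-deg-colours {N} {l} {k} c v = begin
  ∑ (allFin k) (λ j → deg 4 c j v)
    ≡⟨ ∑-cong (allFin k) (λ j → deg≡∑ 4 c j v) ⟩
  ∑ (allFin k) (λ j → ∑ (allSubsets (suc N)) (λ S → ⟦ ∣ S ∣ ≟ 4 ⟧ * ((S ∋ v) * hits c S j)))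
    ≡⟨ ∑-swap (allFin k) (allSubsets (suc N)) _ ⟩
  ∑ (allSubsets (suc N)) (λ S → ∑ (allFin k) (λ j → ⟦ ∣ S ∣ ≟ 4 ⟧ * ((S ∋ v) * hits c S j)))
    ≡⟨ ∑-cong (allSubsets (suc N)) (λ S → trans (∑-*ˡ (allFin k) ⟦ ∣ S ∣ ≟ 4 ⟧ _)
         (trans (cong (⟦ ∣ S ∣ ≟ 4 ⟧ *_) (trans (∑-*ˡ (allFin k) (S ∋ v) _) (cong ((S ∋ v) *_) (∑-hits c S)))) (lemma ⟦ ∣ S ∣ ≟ 4 ⟧ (S ∋ v) l))) ⟩
  ∑ (allSubsets (suc N)) (λ S → l * (⟦ ∣ S ∣ ≟ 4 ⟧ * (S ∋ v)))
    ≡⟨ trans (∑-*ˡ (allSubsets (suc N)) l _) (cong (l *_) (∑-size-∋ N 3 v)) ⟩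
  l * (N choose 3) ∎
  where
  open ≡-Reasoning
  lemma : ∀ a b l → a * (b * l) ≡ l * (a * b)
  lemma = solve-∀

∑-deg-vertices : ∀ {N l k} (c : Colouring N l k) j →
                 ∑ (allFin N) (λ v → deg 4 c j v) ≡ 4 * ∑ (allSubsets N) (λ S → ⟦ ∣ S ∣ ≟ 4 ⟧ * hits c S j)
∑-deg-vertices {N} c j = begin
  ∑ (allFin N) (λ v → deg 4 c j v)
    ≡⟨ ∑-cong (allFin N) (deg≡∑ 4 c j) ⟩
  ∑ (allFin N) (λ v → ∑ (allSubsets N) (λ S → ⟦ ∣ S ∣ ≟ 4 ⟧ * ((S ∋ v) * hits c S j)))
    ≡⟨ ∑-swap (allFin N) (allSubsets N) _ ⟩
  ∑ (allSubsets N) (λ S → ∑ (allFin N) (λ v → ⟦ ∣ S ∣ ≟ 4 ⟧ * ((S ∋ v) * hits c S j)))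
    ≡⟨ ∑-cong (allSubsets N) (λ S → trans (∑-*ˡ (allFin N) ⟦ ∣ S ∣ ≟ 4 ⟧ _)
         (trans (⟦⟧-*-cong (∣ S ∣ ≟ 4) λ size → trans (∑-*ʳ (allFin N) (hits c S j) (S ∋_)) (cong (_* hits c S j) (trans (∑∋≡∣∣ S) size))) (lemma ⟦ ∣ S ∣ ≟ 4 ⟧ (hits c S j)))) ⟩
  ∑ (allSubsets N) (λ S → 4 * (⟦ ∣ S ∣ ≟ 4 ⟧ * hits c S j))
    ≡⟨ ∑-*ˡ (allSubsets N) 4 _ ⟩
  4 * ∑ (allSubsets N) (λ S → ⟦ ∣ S ∣ ≟ 4 ⟧ * hits c S j) ∎
  where
  open ≡-Reasoning
  lemma : ∀ a b → a * (4 * b) ≡ 4 * (a * b)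
  lemma = solve-∀

∑-lifted : ∀ m d (f : Subset (m + d) → ℕ) →
           ∑ (allSubsets (m + d)) (λ S → ⟦ Vec.drop m S ≟S Vec.replicate d false ⟧ * f S) ≡ ∑ (allSubsets m) (λ T → f (T Vec.++ Vec.replicate d false))
∑-lifted m d f = begin
  ∑ (allSubsets (m + d)) (λ S → ⟦ Vec.drop m S ≟S ∅ ⟧ * f S)
    ≡⟨ ∑-cong (allSubsets (m + d)) (λ S → trans (cong (_* f S) (trans (sym (*-identityʳ ⟦ Vec.drop m S ≟S ∅ ⟧)) (cong (⟦ Vec.drop m S ≟S ∅ ⟧ *_) (sym (∑Subsets-once (Vec.take m S))))))
         (trans (cong (_* f S) (sym (∑-*ˡ (allSubsets m) ⟦ Vec.drop m S ≟S ∅ ⟧ _))) (sym (∑-*ʳ (allSubsets m) (f S) _)))) ⟩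
  ∑ (allSubsets (m + d)) (λ S → ∑ (allSubsets m) (λ T → ⟦ Vec.drop m S ≟S ∅ ⟧ * ⟦ T ≟S Vec.take m S ⟧ * f S))
    ≡⟨ ∑-swap (allSubsets (m + d)) (allSubsets m) _ ⟩
  ∑ (allSubsets m) (λ T → ∑ (allSubsets (m + d)) (λ S → ⟦ Vec.drop m S ≟S ∅ ⟧ * ⟦ T ≟S Vec.take m S ⟧ * f S))
    ≡⟨ ∑-cong (allSubsets m) (λ T → trans (∑-cong (allSubsets (m + d)) λ S → cong (_* f S) (same S T)) (∑Subsets-⟦≟⟧ (T Vec.++ ∅) f)) ⟩
  ∑ (allSubsets m) (λ T → f (T Vec.++ ∅)) ∎
  where
  open ≡-Reasoning
  ∅ : Subset d
  ∅ = Vec.replicate d false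
  same : ∀ S T → ⟦ Vec.drop m S ≟S ∅ ⟧ * ⟦ T ≟S Vec.take m S ⟧ ≡ ⟦ S ≟S (T Vec.++ ∅) ⟧
  same S T = trans (sym (⟦⟧-× (Vec.drop m S ≟S ∅) (T ≟S Vec.take m S))) (⟦⟧-iff ((Vec.drop m S ≟S ∅) ×-dec (T ≟S Vec.take m S)) (S ≟S (T Vec.++ ∅))
    (λ { (eq , refl) → trans (sym (Vecₚ.take++drop≡id m S)) (cong (Vec.take m S Vec.++_) eq) })
    (λ { refl → drop-++ T ∅ , sym (take-++ T ∅) }))

no-regular-component : ∀ {m d l k r} (c : Colouring m l k) (F : Colouring (m + suc d) l k) → IsConnectedFactorization 4 r F → Agrees 4 F c → NoRegularComponent 4 r c
no-regular-component {m} {d} {l} {k} {r} c F (regular , connected) agrees j v component = not-inside (stays (connected j (v ↑ˡ suc d) (m ↑ʳ zero)) here)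
  where
  ∅ : Subset (suc d)
  ∅ = Vec.replicate (suc d) false
  Inside : Fin (m + suc d) → Set
  Inside b = ∃[ u ] (b ≡ u ↑ˡ suc d × Reach 4 c j v u)
  not-inside : ¬ Inside (m ↑ʳ zero)
  not-inside (u , eq , _) = case trans (sym (Finₚ.splitAt-↑ʳ m (suc d) zero)) (trans (cong (splitAt m) eq) (Finₚ.splitAt-↑ˡ m u (suc d))) of λ ()
  F≡c : ∀ T → ∣ T ∣ ≡ 4 → ∀ i → F (T Vec.++ ∅) i ≡ c T i
  F≡c T size i = trans (cong (λ S → F S i) (sym (liftSubset≡++ m (suc d) T))) (agrees T size i)
  ∣++∅∣ : ∀ T → ∣ T Vec.++ ∅ ∣ ≡ ∣ T ∣
  ∣++∅∣ T = trans (∣++∣ T ∅) (trans (cong (∣ T ∣ +_) (Subsetₚ.∣⊥∣≡0 (suc d))) (+-identityʳ _))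
  module _ (u : Fin m) where
    f : Subset (m + suc d) → ℕ
    f S = ⟦ ∣ S ∣ ≟ 4 ⟧ * ((S ∋ (u ↑ˡ suc d)) * hits F S j)
    f-lift : ∀ T → f (T Vec.++ ∅) ≡ ⟦ ∣ T ∣ ≟ 4 ⟧ * ((T ∋ u) * hits c T j)
    f-lift T = trans (cong (λ a → ⟦ a ≟ 4 ⟧ * (((T Vec.++ ∅) ∋ (u ↑ˡ suc d)) * hits F (T Vec.++ ∅) j)) (∣++∅∣ T)) (⟦⟧-*-cong (∣ T ∣ ≟ 4) λ size →
      cong₂ _*_ (cong 𝟙 (Vecₚ.lookup-++ˡ T ∅ u)) (∑-cong (allFin l) λ i → cong (λ a → ⟦ a Fin.≟ j ⟧) (F≡c T size i)))
    totals : Reach 4 c j v u → ∑ (allSubsets (m + suc d)) (λ S → ⟦ Vec.drop m S ≟S ∅ ⟧ * f S) ≡ ∑ (allSubsets (m + suc d)) f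
    totals reach = trans (∑-lifted m (suc d) f) (trans (∑-cong (allSubsets m) f-lift) (trans (sym (deg≡∑ 4 c j u))
      (trans (component u reach) (trans (sym (regular j (u ↑ˡ suc d))) (deg≡∑ 4 F j (u ↑ˡ suc d))))))
    lifted : Reach 4 c j v u → ∀ S → 0 < f S → Vec.drop m S ≡ ∅
    lifted reach S pos = Dec.decidable-stable (Vec.drop m S ≟S ∅) λ ≢∅ → <-irrefl (totals reach)
      (∑-mono-<∈ (λ T → ≤-trans (*-monoˡ-≤ (f T) (⟦⟧≤1 (Vec.drop m T ≟S ∅))) (≤-reflexive (*-identityˡ (f T)))) (∈-allSubsets S)
                 (subst (_< f S) (sym (cong (_* f S) (⟦⟧-no (Vec.drop m S ≟S ∅) ≢∅))) pos))
  stays : ∀ {u b} → Reach 4 F j (u ↑ˡ suc d) b → Reach 4 c j v u → Inside b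
  stays {u} = follow refl
    where
    follow : ∀ {u a b} → a ≡ u ↑ˡ suc d → Reach 4 F j a b → Reach 4 c j v u → Inside b
    follow {u} refl here reach = u , refl , reach
    follow {u} refl (step {w = w} S i size eq u∈ w∈ rest) reach = proceed (splitAt m w) refl
      where
      T : Subset m
      T = Vec.take m S
      f>0 : 0 < f u S
      f>0 = subst (0 <_) (sym (trans (cong (_* ((S ∋ (u ↑ˡ suc d)) * hits F S j)) (⟦⟧-yes (∣ S ∣ ≟ 4) size)) (trans (*-identityˡ _) (trans (cong (_* hits F S j) (∈⇒∋≡1 S u∈)) (*-identityˡ _)))))
        (<-≤-trans (subst (0 <_) (sym (⟦⟧-yes (F S i Fin.≟ j) eq)) z<s) (term≤∑Fin (λ i → ⟦ F S i Fin.≟ j ⟧) i))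
      S≡ : S ≡ T Vec.++ ∅
      S≡ = trans (sym (Vecₚ.take++drop≡id m S)) (cong (T Vec.++_) (lifted u reach S f>0))
      size-T : ∣ T ∣ ≡ 4
      size-T = trans (sym (∣++∅∣ T)) (trans (cong ∣_∣ (sym S≡)) size)
      down : ∀ x → (x ↑ˡ suc d) ∈ S → x ∈ T
      down x x∈ = Vecₚ.lookup⇒[]= x T (trans (sym (Vecₚ.lookup-++ˡ T ∅ x)) (Vecₚ.[]=⇒lookup (subst ((x ↑ˡ suc d) ∈_) S≡ x∈)))
      proceed : ∀ s → splitAt m w ≡ s → Inside _
      proceed (inj₁ x) eqw = follow {u = x} (sym (Finₚ.splitAt⁻¹-↑ˡ eqw)) rest (reach-trans reach
        (step T i size-T (trans (sym (F≡c T size-T i)) (trans (cong (λ S → F S i) (sym S≡)) eq)) (down u u∈) (down x (subst (_∈ S) (sym (Finₚ.splitAt⁻¹-↑ˡ eqw)) w∈)) here))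
      proceed (inj₂ y) eqw = case trans (sym (Vecₚ.[]=⇒lookup (subst₂ _∈_ (sym (Finₚ.splitAt⁻¹-↑ʳ eqw)) S≡ w∈))) (trans (Vecₚ.lookup-++ʳ T ∅ y) (Vecₚ.lookup-replicate y false)) of λ ()

deg>0 : ∀ {N l k} (c : Colouring N l k) {j u} S i → ∣ S ∣ ≡ 4 → c S i ≡ j → u ∈ S → 0 < deg 4 c j u
deg>0 {N} {l} c {j} {u} S i size eq u∈ = subst (0 <_) (sym (deg≡∑ 4 c j u)) (<-≤-trans (subst (0 <_) (sym value) hit)
  (term≤∑ (λ S → ⟦ ∣ S ∣ ≟ 4 ⟧ * ((S ∋ u) * hits c S j)) (∈-allSubsets S)))
  where
  hit : 0 < hits c S j
  hit = <-≤-trans (subst (0 <_) (sym (⟦⟧-yes (c S i Fin.≟ j) eq)) z<s) (term≤∑Fin (λ i → ⟦ c S i Fin.≟ j ⟧) i)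
  value : ⟦ ∣ S ∣ ≟ 4 ⟧ * ((S ∋ u) * hits c S j) ≡ hits c S j
  value = trans (cong (_* ((S ∋ u) * hits c S j)) (⟦⟧-yes (∣ S ∣ ≟ 4) size)) (trans (*-identityˡ _) (trans (cong (_* hits c S j) (∈⇒∋≡1 S u∈)) (*-identityˡ _)))

-- For r = 1 every edge is a regular component.
r≥2 : ∀ {a l k r} → 0 < r → (c : Colouring (4 + a) (suc l) k) → IsPartialFactorization 4 r c → NoRegularComponent 4 r c → 2 ≤ r
r≥2 {a} {l} {k} {suc (suc r)} _ c partial norep = s≤s (s≤s z≤n)
r≥2 {a} {l} {k} {1} _ c partial norep = contradiction (λ w reach → ≤-antisym (partial j w) (positive reach (deg>0 c S zero ∣S∣≡4 refl Data.Vec.here))) (norep j zero)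
  where
  S : Subset (4 + a)
  S = true ∷ true ∷ true ∷ true ∷ Subset.⊥
  ∣S∣≡4 : ∣ S ∣ ≡ 4
  ∣S∣≡4 = cong (4 +_) (Subsetₚ.∣⊥∣≡0 a)
  j : Fin k
  j = c S zero
  positive : ∀ {u w} → Reach 4 c j u w → 0 < deg 4 c j u → 0 < deg 4 c j w
  positive here                            pos = pos
  positive (step T i size eq u∈ w∈ rest) _   = positive rest (deg>0 c T i size eq w∈)

-- Numerical estimates

choose-two : ∀ a → 2 * (suc a choose 2) ≡ suc a * a
choose-two a = trans (absorption a 1) (cong (suc a *_) (choose-one a))

choose-three : ∀ a → 6 * (suc (suc a) choose 3) ≡ suc (suc a) * (suc a * a)
choose-three a = begin
  6 * (suc (suc a) choose 3)            ≡⟨ lemma (suc (suc a) choose 3) ⟩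
  2 * (3 * (suc (suc a) choose 3))      ≡⟨ cong (2 *_) (absorption (suc a) 2) ⟩
  2 * (suc (suc a) * (suc a choose 2))  ≡⟨ lemma′ (suc (suc a)) (suc a choose 2) ⟩
  suc (suc a) * (2 * (suc a choose 2))  ≡⟨ cong (suc (suc a) *_) (choose-two a) ⟩
  suc (suc a) * (suc a * a)             ∎
  where
  open ≡-Reasoning
  lemma : ∀ x → 6 * x ≡ 2 * (3 * x)
  lemma = solve-∀
  lemma′ : ∀ a b → 2 * (a * b) ≡ a * (2 * b)
  lemma′ = solve-∀

vandermonde₂ : ∀ a b → (a + b) choose 2 ≡ (a choose 2) + a * b + (b choose 2)
vandermonde₂ zero    b = cong (_+ (b choose 2)) (sym (trans (+-identityʳ _) (zero-choose-suc 1)))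
vandermonde₂ (suc a) b = begin
  suc (a + b) choose 2                                  ≡⟨ choose-pascal (a + b) 1 ⟨
  ((a + b) choose 1) + ((a + b) choose 2)               ≡⟨ cong₂ _+_ (choose-one (a + b)) (vandermonde₂ a b) ⟩
  a + b + ((a choose 2) + a * b + (b choose 2))         ≡⟨ lemma a b (a choose 2) (b choose 2) ⟩
  (a + (a choose 2)) + suc a * b + (b choose 2)         ≡⟨ cong (λ x → x + suc a * b + (b choose 2)) (trans (cong (_+ (a choose 2)) (sym (choose-one a))) (choose-pascal a 1)) ⟩
  (suc a choose 2) + suc a * b + (b choose 2)           ∎
  where
  open ≡-Reasoning
  lemma : ∀ a b x y → a + b + (x + a * b + y) ≡ (a + x) + suc a * b + y
  lemma = solve-∀

vandermonde₃ : ∀ a b → (a + b) choose 3 ≡ (a choose 3) + (a choose 2) * b + a * (b choose 2) + (b choose 3)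
vandermonde₃ zero    b = cong (_+ (b choose 3)) (sym (trans (+-identityʳ _) (cong₂ (λ x y → x + y * b) (zero-choose-suc 2) (zero-choose-suc 1))))
vandermonde₃ (suc a) b = begin
  suc (a + b) choose 3
    ≡⟨ choose-pascal (a + b) 2 ⟨
  ((a + b) choose 2) + ((a + b) choose 3)
    ≡⟨ cong₂ _+_ (vandermonde₂ a b) (vandermonde₃ a b) ⟩
  (a choose 2) + a * b + (b choose 2) + ((a choose 3) + (a choose 2) * b + a * (b choose 2) + (b choose 3))
    ≡⟨ lemma a b (a choose 2) (b choose 2) (a choose 3) (b choose 3) ⟩
  ((a choose 2) + (a choose 3)) + (a + (a choose 2)) * b + suc a * (b choose 2) + (b choose 3)
    ≡⟨ cong₂ (λ x y → x + y * b + suc a * (b choose 2) + (b choose 3)) (choose-pascal a 2) (trans (cong (_+ (a choose 2)) (sym (choose-one a))) (choose-pascal a 1)) ⟩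
  (suc a choose 3) + (suc a choose 2) * b + suc a * (b choose 2) + (b choose 3) ∎
  where
  open ≡-Reasoning
  lemma : ∀ a b x y z w → x + a * b + y + (z + x * b + a * y + w) ≡ (x + z) + (a + x) * b + suc a * y + w
  lemma = solve-∀

-- The estimates use of A / B = 4847323 / 3847323 only that it is an upper approximation of n / d
-- whose cube is at most 2; the literals stay generic so that they are never unfolded in unary.
module Estimates {A B C : ℕ} .{{A≢0 : NonZero A}} .{{B≢0 : NonZero B}} .{{C≢0 : NonZero C}}
                 (A≡ : A ≡ B + C) (3C≤B : 3 * C ≤ B) (A≤2B : A ≤ 2 * B) (2A≤3B : 2 * A ≤ 3 * B) (A³≤2B³ : A * (A * A) ≤ 2 * (B * (B * B))) where

  m≤n : ∀ m n → A * m ≤ C * n → m ≤ n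
  m≤n m n le = *-cancelˡ-≤ A (≤-trans le (*-monoˡ-≤ n (subst (C ≤_) (sym A≡) (m≤n+m C B))))

  Bm≤Cd : ∀ m d → A * m ≤ C * (m + d) → B * m ≤ C * d
  Bm≤Cd m d le = +-cancelʳ-≤ (C * m) _ _ (subst₂ _≤_ (trans (cong (_* m) A≡) (*-distribʳ-+ m B C)) (trans (*-distribˡ-+ C m d) (+-comm (C * m) (C * d))) le)

  3m≤d : ∀ m d → A * m ≤ C * (m + d) → 3 * m ≤ d
  3m≤d m d le = *-cancelˡ-≤ C (begin
    C * (3 * m)     ≡⟨ lemma C m ⟩
    3 * C * m       ≤⟨ *-monoˡ-≤ m 3C≤B ⟩
    B * m           ≤⟨ Bm≤Cd m d le ⟩
    C * d           ∎)
    where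
    open ≤-Reasoning
    lemma : ∀ c m → c * (3 * m) ≡ 3 * c * m
    lemma = solve-∀

  Bn≤Ad : ∀ m d → A * m ≤ C * (m + d) → B * (m + d) ≤ A * d
  Bn≤Ad m d le = begin
    B * (m + d)       ≡⟨ *-distribˡ-+ B m d ⟩
    B * m + B * d     ≤⟨ +-monoˡ-≤ (B * d) (Bm≤Cd m d le) ⟩
    C * d + B * d     ≡⟨ trans (+-comm (C * d) (B * d)) (sym (*-distribʳ-+ d B C)) ⟩
    (B + C) * d       ≡⟨ cong (_* d) A≡ ⟨
    A * d             ∎
    where open ≤-Reasoning

  cubes : ∀ e b → B * (3 + e) ≤ A * (2 + b) → suc (suc e) choose 3 ≤ 2 * (suc (suc b) choose 3)
  cubes e b le = *-cancelˡ-≤ 6 (begin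
    6 * (suc (suc e) choose 3)             ≡⟨ choose-three e ⟩
    suc (suc e) * (suc e * e)              ≤⟨ *-cancelˡ-≤ (B * (B * B)) {{m*n≢0 B (B * B) {{B≢0}} {{m*n≢0 B B}}}} scaled ⟩
    2 * (suc (suc b) * (suc b * b))        ≡⟨ cong (2 *_) (choose-three b) ⟨
    2 * (6 * (suc (suc b) choose 3))       ≡⟨ lemma (suc (suc b) choose 3) ⟩
    6 * (2 * (suc (suc b) choose 3))       ∎)
    where
    open ≤-Reasoning
    lemma : ∀ x → 2 * (6 * x) ≡ 6 * (2 * x)
    lemma = solve-∀
    top : B * suc (suc e) ≤ A * suc (suc b)
    top = ≤-trans (*-monoʳ-≤ B (n≤1+n (suc (suc e)))) le
    middle : B * suc e ≤ A * suc b
    middle = +-cancelʳ-≤ (2 * B) _ _ (begin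
      B * suc e + 2 * B     ≡⟨ eq₁ B e ⟩
      B * (3 + e)           ≤⟨ le ⟩
      A * (2 + b)           ≡⟨ eq₂ A b ⟩
      A * suc b + A         ≤⟨ +-monoʳ-≤ (A * suc b) A≤2B ⟩
      A * suc b + 2 * B     ∎)
      where
      eq₁ : ∀ B e → B * suc e + 2 * B ≡ B * (3 + e)
      eq₁ = solve-∀
      eq₂ : ∀ A b → A * (2 + b) ≡ A * suc b + A
      eq₂ = solve-∀
    bottom : B * e ≤ A * b
    bottom = +-cancelʳ-≤ (3 * B) _ _ (begin
      B * e + 3 * B         ≡⟨ eq₁ B e ⟩
      B * (3 + e)           ≤⟨ le ⟩
      A * (2 + b)           ≡⟨ eq₂ A b ⟩
      A * b + 2 * A         ≤⟨ +-monoʳ-≤ (A * b) 2A≤3B ⟩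
      A * b + 3 * B         ∎)
      where
      eq₁ : ∀ B e → B * e + 3 * B ≡ B * (3 + e)
      eq₁ = solve-∀
      eq₂ : ∀ A b → A * (2 + b) ≡ A * b + 2 * A
      eq₂ = solve-∀
    group₃ : ∀ B x y z → B * (B * B) * (x * (y * z)) ≡ (B * x) * ((B * y) * (B * z))
    group₃ = solve-∀
    scaled : B * (B * B) * (suc (suc e) * (suc e * e)) ≤ B * (B * B) * (2 * (suc (suc b) * (suc b * b)))
    scaled = begin
      B * (B * B) * (suc (suc e) * (suc e * e))            ≡⟨ group₃ B (suc (suc e)) (suc e) e ⟩
      (B * suc (suc e)) * ((B * suc e) * (B * e))          ≤⟨ *-mono-≤ top (*-mono-≤ middle bottom) ⟩
      (A * suc (suc b)) * ((A * suc b) * (A * b))          ≡⟨ group₃ A (suc (suc b)) (suc b) b ⟨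
      A * (A * A) * (suc (suc b) * (suc b * b))            ≤⟨ *-monoˡ-≤ (suc (suc b) * (suc b * b)) A³≤2B³ ⟩
      2 * (B * (B * B)) * (suc (suc b) * (suc b * b))      ≡⟨ eq (B * (B * B)) (suc (suc b) * (suc b * b)) ⟩
      B * (B * B) * (2 * (suc (suc b) * (suc b * b)))      ∎
      where
      eq : ∀ x y → 2 * x * y ≡ x * (2 * y)
      eq = solve-∀

  ratio : ∀ m d → 4 < m → A * m ≤ C * (m + d) → (m + d ∸ 1) choose 3 ≤ 2 * (d choose 3)
  ratio m d m>4 le = shapes m d m>4 (3m≤d m d le) (Bn≤Ad m d le)
    where
    shapes : ∀ m d → 4 < m → 3 * m ≤ d → B * (m + d) ≤ A * d → (m + d ∸ 1) choose 3 ≤ 2 * (d choose 3)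
    shapes (suc (suc (suc (suc (suc a))))) (suc (suc b)) _ _ = cubes (2 + a + (2 + b)) b
    shapes (suc (suc (suc (suc (suc a))))) (suc zero) _ (s≤s ())
    shapes 1 _ (s≤s ())
    shapes 2 _ (s≤s (s≤s ()))
    shapes 3 _ (s≤s (s≤s (s≤s ())))
    shapes 4 _ (s≤s (s≤s (s≤s (s≤s ()))))

choose-rooms : ∀ m′ d → 2 ≤ m′ → m′ ≤ d → (m′ + d) choose 3 ≤ 2 * (d choose 3) →
               3 * ((m′ choose 3) + d * (m′ choose 2)) ≤ (m′ + d) choose 3 ×
               2 * ((m′ choose 3) + d * (m′ choose 2) + (d choose 2) * m′) ≤ (m′ + d) choose 3
choose-rooms (suc (suc a)) d@(suc (suc b)) (s≤s (s≤s z≤n)) (s≤s (s≤s a≤b)) le = room₃ , room₂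
  where
  open ≤-Reasoning
  x y z w : ℕ
  x = suc (suc a) choose 3
  y = d * (suc (suc a) choose 2)
  z = (d choose 2) * suc (suc a)
  w = d choose 3
  sum : (suc (suc a) + d) choose 3 ≡ x + y + z + w
  sum = trans (vandermonde₃ (suc (suc a)) d) (cong₂ (λ p q → x + p + q + w) (*-comm (suc (suc a) choose 2) d) (*-comm (suc (suc a)) (d choose 2)))
  x+y+z≤w : x + y + z ≤ w
  x+y+z≤w = +-cancelʳ-≤ w _ _ (begin
    x + y + z + w       ≡⟨ sum ⟨
    (suc (suc a) + d) choose 3 ≤⟨ le ⟩
    2 * w               ≡⟨ cong (w +_) (+-identityʳ w) ⟩
    w + w               ∎)
  room₂ : 2 * (x + y + z) ≤ (suc (suc a) + d) choose 3
  room₂ = begin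
    2 * (x + y + z)           ≡⟨ cong ((x + y + z) +_) (+-identityʳ _) ⟩
    x + y + z + (x + y + z)   ≤⟨ +-monoʳ-≤ (x + y + z) x+y+z≤w ⟩
    x + y + z + w             ≡⟨ sum ⟨
    (suc (suc a) + d) choose 3 ∎
  y≤z : y ≤ z
  y≤z = *-cancelˡ-≤ 2 (begin
    2 * y                                         ≡⟨ lemma₁ d (suc (suc a) choose 2) ⟩
    d * (2 * (suc (suc a) choose 2))              ≡⟨ cong (d *_) (choose-two (suc a)) ⟩
    d * (suc (suc a) * suc a)                     ≤⟨ *-monoʳ-≤ d (*-monoʳ-≤ (suc (suc a)) (s≤s a≤b)) ⟩
    d * (suc (suc a) * suc b)                     ≡⟨ lemma₂ d (suc (suc a)) (suc b) ⟩
    d * suc b * suc (suc a)                       ≡⟨ cong (_* suc (suc a)) (choose-two (suc b)) ⟨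
    2 * (d choose 2) * suc (suc a)                ≡⟨ *-assoc 2 (d choose 2) (suc (suc a)) ⟩
    2 * z                                         ∎)
    where
    lemma₁ : ∀ a b → 2 * (a * b) ≡ a * (2 * b)
    lemma₁ = solve-∀
    lemma₂ : ∀ a b c → a * (b * c) ≡ a * c * b
    lemma₂ = solve-∀
  x≤y : x ≤ y
  x≤y = *-cancelˡ-≤ 6 (begin
    6 * x                                         ≡⟨ choose-three a ⟩
    suc (suc a) * (suc a * a)                     ≤⟨ *-monoʳ-≤ (suc (suc a)) (*-monoʳ-≤ (suc a) (≤-trans a≤b (≤-trans (n≤1+n b) (n≤1+n (suc b))))) ⟩
    suc (suc a) * (suc a * d)                     ≡⟨ lemma₁ (suc (suc a)) (suc a) d ⟩
    d * (suc (suc a) * suc a)                     ≡⟨ cong (d *_) (choose-two (suc a)) ⟨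
    d * (2 * (suc (suc a) choose 2))              ≡⟨ lemma₂ d (suc (suc a) choose 2) ⟩
    2 * y                                         ≤⟨ *-monoˡ-≤ y {2} {6} (s≤s (s≤s z≤n)) ⟩
    6 * y                                         ∎)
    where
    lemma₁ : ∀ a b c → a * (b * c) ≡ c * (a * b)
    lemma₁ = solve-∀
    lemma₂ : ∀ a b → a * (2 * b) ≡ 2 * (a * b)
    lemma₂ = solve-∀
  room₃ : 3 * (x + y) ≤ (suc (suc a) + d) choose 3
  room₃ = begin
    3 * (x + y)                  ≡⟨ lemma x y ⟩
    x + y + (x + y) + (x + y)    ≤⟨ +-mono-≤ (+-monoʳ-≤ (x + y) (+-mono-≤ (≤-trans x≤y y≤z) y≤z)) (≤-refl {x + y}) ⟩
    x + y + (z + z) + (x + y)    ≡⟨ lemma′ x y z ⟩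
    x + y + z + (x + y + z)      ≤⟨ +-monoʳ-≤ (x + y + z) x+y+z≤w ⟩
    x + y + z + w                ≡⟨ sum ⟨
    (suc (suc a) + d) choose 3   ∎
    where
    lemma : ∀ x y → 3 * (x + y) ≡ x + y + (x + y) + (x + y)
    lemma = solve-∀
    lemma′ : ∀ x y z → x + y + (z + z) + (x + y) ≡ x + y + z + (x + y + z)
    lemma′ = solve-∀

extension : ∀ {m′ d l k r g} → (c : Colouring (5 + m′) (suc l) k) → 0 < r → IsPartialFactorization 4 r c → NoRegularComponent 4 r c →
            k * r ≡ suc l * ((4 + m′ + d) choose 3) → 4 * g ≡ r * (5 + m′ + d) → 3 * (5 + m′) ≤ d →
            (4 + m′ + d) choose 3 ≤ 2 * (d choose 3) → Extends (5 + m′ + d) 4 r c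
extension {m′} {d} {l} {k} {r} {g} c r>0 partial norep kr≡ 4g≡ 3m≤d estimate = Final.extends c (proj₁ final)
  (λ S j size → trans (proj₁ (proj₂ final) S j size) (initial-count S j size)) (proj₂ (proj₂ final) d>0 refl)
  where
  m : ℕ
  m = 5 + m′
  d>0 : 0 < d
  d>0 = <-≤-trans z<s 3m≤d
  m≤d : m ≤ d
  m≤d = ≤-trans (m≤m+n m (2 * m)) 3m≤d
  open Build {m′ = 4 + m′} {d} {suc l} {k} {r} {g} c partial kr≡ 4g≡ 3m≤d using (K; build)
  x y z : ℕ
  x = (4 + m′) choose 3
  y = d * ((4 + m′) choose 2)
  z = (d choose 2) * (4 + m′)
  rooms : 3 * (x + y) ≤ (4 + m′ + d) choose 3 × 2 * (x + y + z) ≤ (4 + m′ + d) choose 3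
  rooms = choose-rooms (4 + m′) d (s≤s (s≤s z≤n)) (≤-trans (n≤1+n (4 + m′)) m≤d) estimate
  K₃ : K 3 ≡ suc l * x
  K₃ = cong (_* ((4 + m′) choose 3)) (trans (cong (suc l *_) (choose-zero d)) (*-identityʳ (suc l)))
  K₂ : K 2 ≡ suc l * y
  K₂ = trans (cong (λ a → suc l * a * ((4 + m′) choose 2)) (choose-one d)) (*-assoc (suc l) d _)
  K₁ : K 1 ≡ suc l * z
  K₁ = trans (cong (λ a → suc l * (d choose 2) * a) (choose-one (4 + m′))) (*-assoc (suc l) (d choose 2) (4 + m′))
  scale : ∀ a x {y} → a * x ≤ y → a * (suc l * x) ≤ suc l * y
  scale a x {y} le = subst (_≤ suc l * y) (lemma (suc l) a x) (*-monoʳ-≤ (suc l) le)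
    where
    lemma : ∀ l a x → l * (a * x) ≡ a * (l * x)
    lemma = solve-∀
  room₃ : 3 * (K 3 + K 2) ≤ k * r
  room₃ = subst₂ _≤_ (cong (3 *_) (trans (*-distribˡ-+ (suc l) x y) (sym (cong₂ _+_ K₃ K₂)))) (sym kr≡) (scale 3 (x + y) (proj₁ rooms))
  room₂ : 2 * (K 3 + K 2 + K 1) ≤ k * r
  room₂ = subst₂ _≤_ (cong (2 *_) (trans (*-distribˡ-+ (suc l) (x + y) z) (cong₂ _+_ (trans (*-distribˡ-+ (suc l) x y) (sym (cong₂ _+_ K₃ K₂))) (sym K₁)))) (sym kr≡) (scale 2 (x + y + z) (proj₂ rooms))
  wide : 4 * m + 4 * d ≤ 3 * (r * d) + 4
  wide = begin
    4 * m + 4 * d         ≤⟨ +-monoˡ-≤ (4 * d) (≤-trans (≤-trans (m≤m+n (4 * m) (2 * m)) (≤-reflexive (lemma m))) (*-monoʳ-≤ 2 3m≤d)) ⟩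
    2 * d + 4 * d         ≡⟨ lemma′ d ⟩
    3 * (2 * d)           ≤⟨ *-monoʳ-≤ 3 (*-monoˡ-≤ d (r≥2 r>0 c partial norep)) ⟩
    3 * (r * d)           ≤⟨ m≤m+n _ 4 ⟩
    3 * (r * d) + 4       ∎
    where
    open ≤-Reasoning
    lemma : ∀ m → 4 * m + 2 * m ≡ 2 * (3 * m)
    lemma = solve-∀
    lemma′ : ∀ d → 2 * d + 4 * d ≡ 3 * (2 * d)
    lemma′ = solve-∀
  open Initial c (build room₃ room₂) norep wide using (initial; initial-count)
  final : Σ (State (suc l) k r (d + m) 0) λ s →
            (∀ S j → ∣ S ∣ ≡ 4 → State.count s (Vec.replicate d false Vec.++ S) j ≡ State.count initial S j) ×
            (0 < d → 0 ≡ 0 → ∀ j u v → State.labV s j u ≡ State.labV s j v)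
  final = splitOff r>0 initial d 0 (+-identityʳ d)

characterisation : ∀ m d r l .{{_ : NonZero r}} → 4 < m → 0 < l → 3 * m ≤ d → (m + d ∸ 1) choose 3 ≤ 2 * (d choose 3) →
                   (c : Colouring m l (numColours (m + d) 4 l r)) → IsPartialFactorization 4 r c →
                   Extends (m + d) 4 r c ⇔ (Admissible 4 (m + d) r l × NoRegularComponent 4 r c)
characterisation (suc (suc (suc (suc (suc m′))))) (suc d′) r (suc l) (s≤s (s≤s (s≤s (s≤s (s≤s _))))) _ 3m≤d estimate c partial = mk⇔ necessary sufficient
  where
  d m k : ℕ
  d = suc d′
  m = 5 + m′
  k = numColours (m + d) 4 (suc l) r
  necessary : Extends (m + d) 4 r c → Admissible 4 (m + d) r (suc l) × NoRegularComponent 4 r c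
  necessary (F , (regular , connected) , agrees) = (4∣rn , divides k r∣) , no-regular-component c F (regular , connected) agrees
    where
    j : Fin k
    j = c Subset.⊥ zero
    4∣rn : 4 ∣ r * (m + d)
    4∣rn = divides (∑ (allSubsets (m + d)) (λ S → ⟦ ∣ S ∣ ≟ 4 ⟧ * hits F S j)) (begin
      r * (m + d)                                     ≡⟨ *-comm r (m + d) ⟩
      (m + d) * r                                     ≡⟨ ∑Fin-const (m + d) r ⟨
      ∑ (allFin (m + d)) (λ _ → r)                    ≡⟨ ∑-cong (allFin (m + d)) (λ v → sym (regular j v)) ⟩
      ∑ (allFin (m + d)) (λ v → deg 4 F j v)          ≡⟨ ∑-deg-vertices F j ⟩
      4 * ∑ (allSubsets (m + d)) (λ S → ⟦ ∣ S ∣ ≟ 4 ⟧ * hits F S j) ≡⟨ *-comm 4 (∑ (allSubsets (m + d)) (λ S → ⟦ ∣ S ∣ ≟ 4 ⟧ * hits F S j)) ⟩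
      ∑ (allSubsets (m + d)) (λ S → ⟦ ∣ S ∣ ≟ 4 ⟧ * hits F S j) * 4 ∎)
      where open ≡-Reasoning
    r∣ : suc l * ((m + d ∸ 1) Comb.C 3) ≡ k * r
    r∣ = begin
      suc l * ((m + d ∸ 1) Comb.C 3)          ≡⟨ cong (suc l *_) (choose≡C (m + d ∸ 1) 3) ⟨
      suc l * ((m + d ∸ 1) choose 3)          ≡⟨ ∑-deg-colours F zero ⟨
      ∑ (allFin k) (λ j → deg 4 F j zero)     ≡⟨ ∑-cong (allFin k) (λ j → regular j zero) ⟩
      ∑ (allFin k) (λ _ → r)                  ≡⟨ ∑Fin-const k r ⟩
      k * r                                   ∎
      where open ≡-Reasoning
  sufficient : Admissible 4 (m + d) r (suc l) × NoRegularComponent 4 r c → Extends (m + d) 4 r c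
  sufficient ((divides g rn≡ , r∣) , norep) = extension {g = g} c (>-nonZero⁻¹ r) partial norep
    (trans (m/n*n≡m r∣) (cong (suc l *_) (sym (choose≡C (m + d ∸ 1) 3)))) (trans (*-comm 4 g) (sym rn≡)) 3m≤d estimate

open Estimates {4847323} {3847323} {1000000} refl (≤ᵇ⇒≤ _ _ _) (≤ᵇ⇒≤ _ _ _) (≤ᵇ⇒≤ _ _ _) (≤ᵇ⇒≤ _ _ _) using (m≤n; 3m≤d; ratio)

by-difference : ∀ n m d r l .{{_ : NonZero r}} → m + d ≡ n → 4 < m → 0 < l → 4847323 * m ≤ 1000000 * n →
                (c : Colouring m l (numColours n 4 l r)) → IsPartialFactorization 4 r c →
                Extends n 4 r c ⇔ (Admissible 4 n r l × NoRegularComponent 4 r c)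
by-difference _ m d r l refl m>4 l>0 bound = characterisation m d r l m>4 l>0 (3m≤d m d bound) (ratio m d m>4 bound)

theorem7p9 : (n m r l : ℕ) → .{{_ : NonZero r}} → 0 < n → 0 < m → 0 < l →
    4 < m → 4847323 * m ≤ 1000000 * n →
    (c : Colouring m l (numColours n 4 l r)) → IsPartialFactorization 4 r c →
    (Extends n 4 r c ⇔ (Admissible 4 n r l × NoRegularComponent 4 r c))
theorem7p9 n m r l _ _ l>0 m>4 bound = by-difference n m (n ∸ m) r l (m+[n∸m]≡n (m≤n m n bound)) m>4 l>0 bound
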